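{- Let $H_1,H_2$ be KNRS graphs, let $I$ be an independent set in $H_1$, and let $a\in V(H_1)\setminus I$. Then $H_1\ltimes_I^a H_2$ is KNRS. Moreover, if either $H_1$ is KNRS-forcing, or $H_2$ is density-forcing and $H_1\ltimes_I^a K_2$ is KNRS-forcing, then $H_1\ltimes_I^a H_2$ is KNRS-forcing.
   Context: All graphs are finite and simple. For graphs $H,G$, $t(H,G)$ denotes the probability that a uniformly random function $f:V(H)\to V(G)$ maps every edge of $H$ to an edge of $G$. For $S\subseteq V(G)$, $e(S)$ is the number of edges of $G$ with both endpoints in $S$. A graph $G$ is $(p,\delta)$-locally dense if every $S\subseteq V(G)$ with $|S|\ge\delta|V(G)|$ satisfies $e(S)\ge p|S|^2/2$. A graph $G$ is $(p,\delta)$-quasirandom if every $S\subseteq V(G)$ contains $\frac p2|S|^2\pm\delta\, v(G)^2$ edges. A graph $H$ is KNRS if for all $p,\varepsilon\in(0,1)$ there is $\delta>0$ such that every $(p,\delta)$-locally dense graph $G$ satisfies $t(H,G)\ge p^{e(H)}-\varepsilon$. $H$ is KNRS-forcing if for all $p,\alpha\in(0,1)$ there exist $\delta,\varepsilon>0$ such that every $(p,\delta)$-locally dense graph $G$ satisfies $t(H,G)>p^{e(H)}+\varepsilon$ unless $G$ is $(p,\alpha)$-quasirandom. $H$ is density-forcing if for all $p,\alpha\in(0,1)$ there exist $\delta,\varepsilon>0$ such that every $(p,\delta)$-locally dense graph $G$ with at least $(p+\alpha)v(G)^2/2$ edges satisfies $t(H,G)>p^{e(H)}+\varepsilon$. For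 graphs $H_1,H_2$, an independent set $I$ of $H_1$ and $a\in V(H_1)\setminus I$, the graph $H_1\ltimes_I^a H_2$ is defined as follows: take $v(H_2)$ copies $A_1,\dots,A_{v(H_2)}$ of $H_1$ in which the vertices of $I$ are identified (shared by all copies) and which are otherwise vertex-disjoint; then place a copy of $H_2$ on the $v(H_2)$ vertices corresponding to $a$ in $A_1,\dots,A_{v(H_2)}$. -}

module Defs where

open import Algebra.Bundles using (CommutativeRing; Semiring)
open import Algebra.Core using (Op₁; Op₂)
import Algebra.Definitions.RawSemiring as RawSemiringDefinitions
open import Algebra.Structures using (IsCommutativeRing)
open import Data.Bool.Base using (Bool; true; false; not; if_then_else_; T)
open import Data.Bool.Properties using (T?)
open import Data.Fin.Base as Fin using (Fin; finToFun)
open import Data.Fin.Patterns using (0F)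
import Data.Fin.Properties as Fin
open import Data.List.Base using (List; allFin; cartesianProduct; filter; length; map)
open import Data.Nat.Base as ℕ using (ℕ; NonZero)
open import Data.Product.Base using (Σ; ∃-syntax; _×_; _,_; proj₁; proj₂)
open import Data.Product.Function.Dependent.Propositional using (Σ-↔)
open import Data.Product.Function.NonDependent.Propositional using (_×-↔_)
open import Data.Sum.Base using (_⊎_; inj₁; inj₂; [_,_]′)
open import Data.Sum.Function.Propositional using (_⊎-↔_)
open import Function.Base using (_∘_)
open import Function.Bundles using (_↔_; Inverse; mk↔ₛ′)
open import Function.Construct.Composition using (_↔-∘_)
open import Function.Construct.Symmetry using (↔-sym)
open import Function.Properties.Inverse using (↔⇒↣)
open import Function.Related.Propositional using (K-reflexive)
open import Level using (Level; 0ℓ; suc; _⊔_)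
import Relation.Binary.Construct.NonStrictToStrict as ToStrict
open import Relation.Binary.Core using (Rel; _Preserves_⟶_)
open import Relation.Binary.Definitions using (Decidable; Irreflexive; Symmetric)
open import Relation.Binary.PropositionalEquality using (_≡_; _≢_; refl; sym; cong; subst)
open import Relation.Binary.Structures using (IsDecTotalOrder)
open import Relation.Nullary using (¬_; Dec)
open import Relation.Nullary.Decidable using (map′; ¬?; _×-dec_; _⊎-dec_; _→-dec_)
import Relation.Unary as Unary

private
  variable
    c ℓ₁ ℓ₂ : Level
    A B : Set

------------------------------------------------------------------------
-- Scalars

-- The role of ℝ is played by an arbitrary Archimedean ordered field.
-- Classically ℝ is such a field (with the order decided by excluded
-- middle), so statements about all of them specialise to ℝ; ℚ is an
-- instance without any classical axiom.  As usual the inverse is total,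
-- with an unspecified value at 0#.
record ArchimedeanOrderedField c ℓ₁ ℓ₂ : Set (suc (c ⊔ ℓ₁ ⊔ ℓ₂)) where
  infix  8 -_ _⁻¹
  infixl 7 _*_ _/_
  infixl 6 _+_ _-_
  infix  4 _≈_ _≤_

  field
    Carrier           : Set c
    _≈_               : Rel Carrier ℓ₁
    _≤_               : Rel Carrier ℓ₂
    _+_ _*_           : Op₂ Carrier
    -_ _⁻¹            : Op₁ Carrier
    0# 1#             : Carrier
    isCommutativeRing : IsCommutativeRing _≈_ _+_ _*_ -_ 0# 1#
    isDecTotalOrder   : IsDecTotalOrder _≈_ _≤_
    0≉1               : ¬ (0# ≈ 1#)
    ⁻¹-cong           : _⁻¹ Preserves _≈_ ⟶ _≈_
    ⁻¹-inverseʳ       : ∀ x → ¬ (x ≈ 0#) → (x * x ⁻¹) ≈ 1#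
    +-monoʳ-≤         : ∀ x {y z} → y ≤ z → (x + y) ≤ (x + z)
    *-nonneg          : ∀ {x y} → 0# ≤ x → 0# ≤ y → 0# ≤ (x * y)

  commutativeRing : CommutativeRing c ℓ₁
  commutativeRing = record { isCommutativeRing = isCommutativeRing }

  private
    module S = RawSemiringDefinitions (Semiring.rawSemiring (CommutativeRing.semiring commutativeRing))

  open S public using (_^_)

  fromℕ : ℕ → Carrier
  fromℕ n = n S.× 1#

  field
    archimedean : ∀ x → ∃[ n ] (x ≤ fromℕ n)

  open ToStrict _≈_ _≤_ public using (_<_)

  _-_ _/_ : Op₂ Carrier
  x - y = x + (- y)
  x / y = x * y ⁻¹

------------------------------------------------------------------------
-- Finite sets and their subsets

-- Boolean-valued, so that membership is proof-irrelevant and decidable.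
Subset : Set → Set
Subset A = A → Bool

infix 4 _∈_ _∉_

_∈_ _∉_ : A → Subset A → Set
x ∈ S = T (S x)
x ∉ S = T (not (S x))

∈-finite : ∀ n (S : Subset (Fin n)) → ∃[ k ] (Σ (Fin n) (_∈ S) ↔ Fin k)
∈-finite ℕ.zero    S = 0 , mk↔ₛ′ (λ ()) (λ ()) (λ ()) (λ ())
∈-finite (ℕ.suc n) S with ∈-finite n (S ∘ Fin.suc)
... | k , Σ↔k = _ , (↔-sym Fin.+↔⊎ ↔-∘ ((T↔ (S 0F) ⊎-↔ Σ↔k) ↔-∘ split))
  where
  T↔ : ∀ b → T b ↔ Fin (if b then 1 else 0)
  T↔ true  = ↔-sym Fin.1↔⊤
  T↔ false = ↔-sym Fin.0↔⊥

  split : Σ (Fin (ℕ.suc n)) (_∈ S) ↔ (0F ∈ S ⊎ Σ (Fin n) (_∈ S ∘ Fin.suc))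
  split = mk↔ₛ′
    (λ { (0F , x∈S) → inj₁ x∈S ; (Fin.suc i , x∈S) → inj₂ (i , x∈S) })
    (λ { (inj₁ x∈S) → 0F , x∈S ; (inj₂ (i , x∈S)) → Fin.suc i , x∈S })
    (λ { (inj₁ _) → refl ; (inj₂ _) → refl })
    (λ { (0F , _) → refl ; (Fin.suc _ , _) → refl })

subset-finite : ∀ {n} → A ↔ Fin n → (S : Subset A) → ∃[ k ] (Σ A (_∈ S) ↔ Fin k)
subset-finite {n = n} A↔n S with ∈-finite n (S ∘ Inverse.from A↔n)
... | k , Σ↔k =
  k , (Σ↔k ↔-∘ Σ-↔ A↔n (λ {x} →
    K-reflexive (cong (_∈ S) (sym (Inverse.strictlyInverseʳ A↔n x)))))

------------------------------------------------------------------------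
-- Graphs

-- Finite simple graphs, with at least one vertex.
record Graph : Set₁ where
  infix 4 _~_ _~?_
  field
    V        : Set
    v        : ℕ
    V↔Fin    : V ↔ Fin v
    nonempty : NonZero v
    _~_      : Rel V 0ℓ
    _~?_     : Decidable _~_
    ~-sym    : Symmetric _~_
    ~-irrefl : Irreflexive _≡_ _~_

  index : V → Fin v
  index = Inverse.to V↔Fin

  vertex : Fin v → V
  vertex = Inverse.from V↔Fin

  vertices : List V
  vertices = map vertex (allFin v)

  ∣_∣ : Subset V → ℕ
  ∣ S ∣ = length (filter (λ x → T? (S x)) vertices)

  -- Each edge is counted once, with its endpoints in increasing order.
  e[_] : Subset V → ℕ
  e[ S ] = length (filter
    (λ (x , y) → (index x Fin.<? index y) ×-dec (x ~? y) ×-dec T? (S x) ×-dec T? (S y))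
    (cartesianProduct vertices vertices))

  e : ℕ
  e = e[ (λ _ → true) ]

  Independent : Subset V → Set
  Independent S = ∀ {x y} → x ∈ S → y ∈ S → ¬ (x ~ y)

  ∀V? : ∀ {ℓ} {P : V → Set ℓ} → Unary.Decidable P → Dec (∀ x → P x)
  ∀V? {P = P} P? = map′
    (λ h x → subst P (Inverse.strictlyInverseʳ V↔Fin x) (h (index x)))
    (λ h i → h (vertex i))
    (Fin.all? (P? ∘ vertex))

open Graph using (V; v; e; vertex; index)

K₂ : Graph
K₂ = record
  { V        = Fin 2
  ; v        = 2
  ; V↔Fin    = K-reflexive refl
  ; nonempty = _
  ; _~_      = _≢_
  ; _~?_     = λ x y → ¬? (x Fin.≟ y)
  ; ~-sym    = λ x≢y y≡x → x≢y (sym y≡x)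
  ; ~-irrefl = λ x≡y x≢y → x≢y x≡y
  }

IsHom : (H G : Graph) → (V H → V G) → Set
IsHom H G f = ∀ x y → x H.~ y → f x G.~ f y
  where module H = Graph H ; module G = Graph G

isHom? : (H G : Graph) → Unary.Decidable (IsHom H G)
isHom? H G f = H.∀V? λ x → H.∀V? λ y → (x H.~? y) →-dec (f x G.~? f y)
  where module H = Graph H ; module G = Graph G

-- All v(G)^v(H) functions, each listed exactly once up to pointwise equality.
functions : (H G : Graph) → List (V H → V G)
functions H G = map (λ k → vertex G ∘ finToFun k ∘ index H) (allFin (v G ℕ.^ v H))

hom : (H G : Graph) → ℕ
hom H G = length (filter (isHom? H G) (functions H G))

-- The vertices of the shared set I occur once, the others once in each of the
-- copies of H₁, and the copies are indexed by the vertices of H₂.  The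
-- construction is only used for I independent and a outside I.
module _ (H₁ : Graph) (I : Subset (V H₁)) (a : V H₁) (H₂ : Graph) where
  private
    module H₁ = Graph H₁
    module H₂ = Graph H₂

    W : Set
    W = Σ H₁.V (_∈ I) ⊎ (Σ H₁.V (_∉ I) × H₂.V)

    Adj : Rel W 0ℓ
    Adj (inj₁ (x , _))       (inj₁ (y , _))       = x H₁.~ y
    Adj (inj₁ (x , _))       (inj₂ ((y , _) , j)) = x H₁.~ y
    Adj (inj₂ ((x , _) , i)) (inj₁ (y , _))       = x H₁.~ y
    Adj (inj₂ ((x , _) , i)) (inj₂ ((y , _) , j)) =
      (i ≡ j × x H₁.~ y) ⊎ (x ≡ a × y ≡ a × i H₂.~ j)

    ≡-dec : (G : Graph) → Decidable {A = V G} _≡_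
    ≡-dec G = Fin.inj⇒≟ (↔⇒↣ (Graph.V↔Fin G))

    Adj? : Decidable Adj
    Adj? (inj₁ (x , _))       (inj₁ (y , _))       = x H₁.~? y
    Adj? (inj₁ (x , _))       (inj₂ ((y , _) , j)) = x H₁.~? y
    Adj? (inj₂ ((x , _) , i)) (inj₁ (y , _))       = x H₁.~? y
    Adj? (inj₂ ((x , _) , i)) (inj₂ ((y , _) , j)) =
      (≡-dec H₂ i j ×-dec (x H₁.~? y)) ⊎-dec
      (≡-dec H₁ x a ×-dec ≡-dec H₁ y a ×-dec (i H₂.~? j))

    Adj-sym : Symmetric Adj
    Adj-sym {inj₁ _} {inj₁ _} x~y = H₁.~-sym x~y
    Adj-sym {inj₁ _} {inj₂ _} x~y = H₁.~-sym x~y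
    Adj-sym {inj₂ _} {inj₁ _} x~y = H₁.~-sym x~y
    Adj-sym {inj₂ _} {inj₂ _} (inj₁ (i≡j , x~y))       = inj₁ (sym i≡j , H₁.~-sym x~y)
    Adj-sym {inj₂ _} {inj₂ _} (inj₂ (x≡a , y≡a , i~j)) = inj₂ (y≡a , x≡a , H₂.~-sym i~j)

    Adj-irrefl : Irreflexive _≡_ Adj
    Adj-irrefl {inj₁ _} refl x~x                    = H₁.~-irrefl refl x~x
    Adj-irrefl {inj₂ _} refl (inj₁ (_ , x~x))       = H₁.~-irrefl refl x~x
    Adj-irrefl {inj₂ _} refl (inj₂ (_ , _ , i~i))   = H₂.~-irrefl refl i~i

    someVertex : (G : Graph) → V G
    someVertex G = vertex G (first (Graph.nonempty G))
      where
      first : ∀ {n} → NonZero n → Fin n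
      first {ℕ.suc _} _ = 0F

    someW : W
    someW = [ (λ x∈I → inj₁ (x , x∈I)) , (λ x∉I → inj₂ ((x , x∉I) , someVertex H₂)) ]′
            (∈⊎∉ (I x))
      where
      x = someVertex H₁
      ∈⊎∉ : ∀ b → T b ⊎ T (not b)
      ∈⊎∉ true  = inj₁ _
      ∈⊎∉ false = inj₂ _

    inside : ∃[ k ] (Σ H₁.V (_∈ I) ↔ Fin k)
    inside = subset-finite H₁.V↔Fin I

    outside : ∃[ k ] (Σ H₁.V (_∉ I) ↔ Fin k)
    outside = subset-finite H₁.V↔Fin (not ∘ I)

    W↔Fin : W ↔ Fin (proj₁ inside ℕ.+ proj₁ outside ℕ.* H₂.v)
    W↔Fin = ↔-sym Fin.+↔⊎ ↔-∘
      (proj₂ inside ⊎-↔ (↔-sym Fin.*↔× ↔-∘ (proj₂ outside ×-↔ H₂.V↔Fin)))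

  infix 8 _⋉[_,_]_

  _⋉[_,_]_ : Graph
  _⋉[_,_]_ = record
    { V        = W
    ; v        = _
    ; V↔Fin    = W↔Fin
    ; nonempty = Fin.nonZeroIndex (Inverse.to W↔Fin someW)
    ; _~_      = Adj
    ; _~?_     = Adj?
    ; ~-sym    = λ {x} {y} → Adj-sym {x} {y}
    ; ~-irrefl = λ {x} {y} → Adj-irrefl {x} {y}
    }

------------------------------------------------------------------------
-- Densities and the KNRS notions, with scalars in K

module _ (K : ArchimedeanOrderedField c ℓ₁ ℓ₂) where
  open ArchimedeanOrderedField K

  t : (H G : Graph) → Carrier
  t H G = fromℕ (hom H G) / fromℕ (v G ℕ.^ v H)

  InUnitInterval : Carrier → Set _
  InUnitInterval x = 0# < x × x < 1#

  LocallyDense : (p δ : Carrier) → Graph → Set _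
  LocallyDense p δ G = ∀ (S : Subset (V G)) →
    δ * fromℕ (v G) ≤ fromℕ ∣ S ∣ →
    p * fromℕ ∣ S ∣ ^ 2 / fromℕ 2 ≤ fromℕ e[ S ]
    where open Graph G using (∣_∣; e[_])

  Quasirandom : (p δ : Carrier) → Graph → Set _
  Quasirandom p δ G = ∀ (S : Subset (V G)) →
    p / fromℕ 2 * fromℕ ∣ S ∣ ^ 2 - δ * fromℕ (v G) ^ 2 ≤ fromℕ e[ S ] ×
    fromℕ e[ S ] ≤ p / fromℕ 2 * fromℕ ∣ S ∣ ^ 2 + δ * fromℕ (v G) ^ 2
    where open Graph G using (∣_∣; e[_])

  KNRS : Graph → Set _
  KNRS H = ∀ p ε → InUnitInterval p → InUnitInterval ε →
    ∃[ δ ] 0# < δ ×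
      (∀ G → LocallyDense p δ G → p ^ e H - ε ≤ t H G)

  KNRSForcing : Graph → Set _
  KNRSForcing H = ∀ p α → InUnitInterval p → InUnitInterval α →
    ∃[ δ ] ∃[ ε ] 0# < δ × 0# < ε ×
      (∀ G → LocallyDense p δ G → ¬ Quasirandom p α G → p ^ e H + ε < t H G)

  DensityForcing : Graph → Set _
  DensityForcing H = ∀ p α → InUnitInterval p → InUnitInterval α →
    ∃[ δ ] ∃[ ε ] 0# < δ × 0# < ε ×
      (∀ G → LocallyDense p δ G →
        (p + α) * fromℕ (v G) ^ 2 / fromℕ 2 ≤ fromℕ (e G) →
        p ^ e H + ε < t H G)

{-# OPTIONS --safe #-}

-- Fix a map g : I → V(G). The homomorphisms H₁ → G extending g are the vertices of a graph G_g, two of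
-- them being adjacent when their values at a are adjacent in G; then hom(H₁ ⋉ H₂, G) = ∑_g hom(H₂, G_g)
-- and hom(H₁, G) = ∑_g v(G_g). If G is (p,δ)-locally dense and G_g is not tiny, then G_g is (p,δ′)-locally
-- dense with the same p: a subset of G_g induces weights w : V(G) → [0,1] with total σ, and the function
-- ∑ A u u − 2pσ∑u + pσ² is affine in each coordinate of u, hence nonnegative at w because it is so at all
-- 0/1 vectors. So each property of H₂ applies to every G_g that is not tiny, giving
-- t(H₁ ⋉ H₂, G) ≥ p^e(H₂) E_g[W_g^v(H₂)] − o(1) for the normalised size W_g of G_g, and convexity of
-- w ↦ w^v(H₂) does the rest, all inequalities being linearised for each g before averaging.

module Submission where

open import Defs
open import Data.Product.Base using (_×_)
open import Data.Sum.Base using (_⊎_)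
open import Algebra.Bundles using (CommutativeRing)
import Algebra.Properties.Semiring.Sum as SemiringSum
open import Algebra.Solver.Ring.AlmostCommutativeRing using (_-Raw-AlmostCommutative⟶_; fromCommutativeRing)
open import Data.Bool.Base using (Bool; true; false; not; if_then_else_; T; _∧_)
open import Data.Bool.Properties using (T?; T-irrelevant)
open import Data.Fin.Base as Fin using (Fin; finToFun; funToFin; combine)
open import Data.Fin.Patterns using (0F; 1F)
import Data.Fin.Properties as Fin
open import Data.Integer.Base as ℤ using (ℤ)
import Data.Integer.Properties as ℤ
open import Data.List.Base using (_++_; allFin; cartesianProduct; filter; length; map; tabulate)
import Data.List.Properties as List
import Data.Maybe.Base as Maybe
open import Data.Nat.Base as ℕ using (ℕ; zero; suc; NonZero)
import Data.Nat.Properties as ℕ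
open import Data.Product.Base using (Σ; ∃-syntax; _,_; proj₁; proj₂; uncurry)
open import Data.Product.Function.NonDependent.Propositional using (_×-↔_)
import Data.Sign.Base as Sign
open import Data.Sum.Base using (inj₁; inj₂; [_,_]′)
open import Data.Sum.Function.Propositional using (_⊎-↔_)
open import Data.Unit.Base using (tt)
open import Function.Base using (_∘_; id; _⟨_⟩_)
open import Function.Bundles using (_↔_; Inverse; Injection; mk↔ₛ′; mk⇔)
open import Function.Construct.Composition using (_↔-∘_)
open import Function.Construct.Identity using (↔-id)
open import Function.Construct.Symmetry using (↔-sym)
open import Function.Properties.Inverse using (↔⇒↣)
open import Relation.Binary.Definitions using (tri<; tri≈; tri>)
open import Relation.Binary.PropositionalEquality
  using (_≡_; refl; sym; trans; cong; cong₂; subst; subst₂; _≗_; module ≡-Reasoning)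
open import Relation.Binary.Structures using (IsDecTotalOrder)
open import Relation.Nullary using (¬_; Dec; yes; no; does; contradiction)
open import Relation.Nullary.Decidable using (_×-dec_; _⊎-dec_; dec-true; dec-false; dec⇒maybe; does-≡; does-⇔)
import Relation.Unary as Unary

open Inverse using (to; from; strictlyInverseˡ; strictlyInverseʳ)

-- Finite sums and functions between finite sets

-- Adjacency in G_g sees only the values at a, so a vertex set of G_g reaches G as multiplicities
-- and not as a set; hence the passage from sets to weights. Only lower bounds on E_g[W_g] = t(H₁,G)
-- are known, so a linearised bound must have nonnegative slope in W_g; its base point is μ =
-- p^e(H₁). The second forcing criterion needs more. Let L be the number of maps from the complement
-- of I to V(G), and T_g = 2e(G_g)/L². Forcing for H₁ ⋉ K₂ says that E_g[T_g] exceeds pμ² by some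
-- ε₀, but not which fibres carry the excess. So the bound for every fibre is raised by c(T_g -
-- (p+q)W_g²) at a cost of cq: this term is nonpositive on fibres of density at most p+q, at most cq
-- if W_g ≤ q, and otherwise paid for by density-forcing of H₂. Its concave part -c(p+q)W_g² must be
-- absorbed by the convexity of p^e(H₂) W_g^v(H₂), which asks for v(H₂) ≥ 2 and a small c. A
-- one-vertex H₂ is treated apart: were it density-forcing, there would be some δ with no
-- (p,δ)-locally dense graph at all.

module ℕ-Sum = SemiringSum ℕ.+-*-semiring

module FiniteSums where
  open import Data.Nat.Base using (_+_; _*_; _^_)

  private variable
    A B C D : Set
    m n o c d : ℕ

  χ : Bool → ℕ
  χ b = if b then 1 else 0

  χ≤1 : ∀ b → χ b ℕ.≤ 1
  χ≤1 true  = ℕ.≤-refl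
  χ≤1 false = ℕ.z≤n

  χ-∧ : ∀ b b′ → χ (b ∧ b′) ≡ χ b * χ b′
  χ-∧ true  b′ = sym (ℕ.+-identityʳ (χ b′))
  χ-∧ false b′ = refl

  χ-does : ∀ {p} {P : Set p} (P? : Dec P) → P → χ (does P?) ≡ 1
  χ-does P? p = cong χ (dec-true P? p)

  T-does : ∀ {p} {P : Set p} (P? : Dec P) → T (does P?) → P
  T-does (yes p) _ = p

  does-T : ∀ {p} {P : Set p} (P? : Dec P) → P → T (does P?)
  does-T P? p = subst T (sym (dec-true P? p)) tt

  Fin↔ : ∀ n → Fin n ↔ Fin n
  Fin↔ n = ↔-id (Fin n)

  -- Opaque so that unification treats the summand as an argument.
  opaque
    ∑ : A ↔ Fin n → (A → ℕ) → ℕ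
    ∑ E f = ℕ-Sum.sum (f ∘ from E)

    ∑-Fin : (E : A ↔ Fin n) (f : A → ℕ) → ∑ E f ≡ ∑ (Fin↔ n) (f ∘ from E)
    ∑-Fin E f = refl

    ∑-empty : (E : A ↔ Fin 0) (f : A → ℕ) → ∑ E f ≡ 0
    ∑-empty E f = refl

    ∑-suc : (f : Fin (suc n) → ℕ) → ∑ (Fin↔ (suc n)) f ≡ f Fin.zero + ∑ (Fin↔ n) (f ∘ Fin.suc)
    ∑-suc f = refl

    ∑-cong : (E : A ↔ Fin n) {f g : A → ℕ} → f ≗ g → ∑ E f ≡ ∑ E g
    ∑-cong E {f} {g} f≗g = ℕ-Sum.sum-cong-≗ {x = f ∘ from E} {y = g ∘ from E} (f≗g ∘ from E)

    ∑-+ : (E : A ↔ Fin n) (f g : A → ℕ) → ∑ E (λ x → f x + g x) ≡ ∑ E f + ∑ E g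
    ∑-+ E f g = ℕ-Sum.∑-distrib-+ (f ∘ from E) (g ∘ from E)

    ∑-*ˡ : (E : A ↔ Fin n) (c : ℕ) (f : A → ℕ) → ∑ E (λ x → c * f x) ≡ c * ∑ E f
    ∑-*ˡ E c f = sym (ℕ-Sum.*-distribˡ-sum c (f ∘ from E))

    ∑-*ʳ : (E : A ↔ Fin n) (c : ℕ) (f : A → ℕ) → ∑ E (λ x → f x * c) ≡ ∑ E f * c
    ∑-*ʳ E c f = sym (ℕ-Sum.*-distribʳ-sum c (f ∘ from E))

    ∑-comm : (E : A ↔ Fin m) (E′ : B ↔ Fin n) (f : A → B → ℕ) →
      ∑ E (λ x → ∑ E′ (f x)) ≡ ∑ E′ (λ y → ∑ E (λ x → f x y))
    ∑-comm E E′ f = ℕ-Sum.∑-comm (λ i j → f (from E i) (from E′ j))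

    ∑-permute : (π : Fin m ↔ Fin n) (f : Fin n → ℕ) → ∑ (Fin↔ m) (f ∘ to π) ≡ ∑ (Fin↔ n) f
    ∑-permute π f = sym (ℕ-Sum.sum-permute f π)

  -- The two enumerations and `π` compose to a bijection `Fin m ↔ Fin n`, so only a reordering of
  -- indices is involved, although `m` and `n` are not yet known to be equal.
  ∑-↔ : (E : A ↔ Fin m) (E′ : B ↔ Fin n) (π : A ↔ B) (f : B → ℕ) →
    ∑ E (f ∘ to π) ≡ ∑ E′ f
  ∑-↔ E E′ π f = begin
    ∑ E (f ∘ to π)                                     ≡⟨ ∑-Fin E (f ∘ to π) ⟩
    ∑ (Fin↔ _) (f ∘ to π ∘ from E)                     ≡⟨ ∑-cong _ (λ i → cong f (sym (strictlyInverseʳ E′ _))) ⟩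
    ∑ (Fin↔ _) (f ∘ from E′ ∘ to E′ ∘ to π ∘ from E)   ≡⟨ ∑-permute (E′ ↔-∘ (π ↔-∘ ↔-sym E)) (f ∘ from E′) ⟩
    ∑ (Fin↔ _) (f ∘ from E′)                           ≡⟨ ∑-Fin E′ f ⟨
    ∑ E′ f                                             ∎
    where open ≡-Reasoning

  private
    ∑-Fin-const : ∀ n (c : ℕ) → ∑ (Fin↔ n) (λ _ → c) ≡ n * c
    ∑-Fin-const zero    c = ∑-empty _ _
    ∑-Fin-const (suc n) c = trans (∑-suc (λ _ → c)) (cong (c +_) (∑-Fin-const n c))

  ∑-const : (E : A ↔ Fin n) (c : ℕ) → ∑ E (λ _ → c) ≡ n * c
  ∑-const E c = trans (∑-Fin E _) (∑-Fin-const _ c)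

  card-unique : (E : A ↔ Fin m) (E′ : B ↔ Fin n) → A ↔ B → m ≡ n
  card-unique {m = m} {n = n} E E′ π = begin
    m                ≡⟨ ℕ.*-identityʳ m ⟨
    m * 1            ≡⟨ ∑-const E 1 ⟨
    ∑ E (λ _ → 1)    ≡⟨ ∑-↔ E E′ π (λ _ → 1) ⟩
    ∑ E′ (λ _ → 1)   ≡⟨ ∑-const E′ 1 ⟩
    n * 1            ≡⟨ ℕ.*-identityʳ n ⟩
    n                ∎
    where open ≡-Reasoning

  ∑-zero : (E : A ↔ Fin n) {f : A → ℕ} → (∀ x → f x ≡ 0) → ∑ E f ≡ 0
  ∑-zero {n = n} E f≡0 = trans (∑-cong E f≡0) (trans (∑-const E 0) (ℕ.*-zeroʳ n))

  private
    ∑-Fin-mono : ∀ n {f g : Fin n → ℕ} → (∀ x → f x ℕ.≤ g x) → ∑ (Fin↔ n) f ℕ.≤ ∑ (Fin↔ n) g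
    ∑-Fin-mono zero    {f} {g} f≤g rewrite ∑-empty (Fin↔ 0) f = ℕ.z≤n
    ∑-Fin-mono (suc n) {f} {g} f≤g rewrite ∑-suc f | ∑-suc g = ℕ.+-mono-≤ (f≤g _) (∑-Fin-mono n (f≤g ∘ Fin.suc))

  ∑-mono : (E : A ↔ Fin n) {f g : A → ℕ} → (∀ x → f x ℕ.≤ g x) → ∑ E f ℕ.≤ ∑ E g
  ∑-mono E {f} {g} f≤g rewrite ∑-Fin E f | ∑-Fin E g = ∑-Fin-mono _ (f≤g ∘ from E)

  private
    ∑-Fin-⊎ : ∀ m (f : Fin (m + n) → ℕ) →
      ∑ (Fin↔ (m + n)) f ≡ ∑ (Fin↔ m) (λ i → f (i Fin.↑ˡ n)) + ∑ (Fin↔ n) (λ j → f (m Fin.↑ʳ j))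
    ∑-Fin-⊎ zero    f = cong (_+ ∑ _ f) (sym (∑-empty _ _))
    ∑-Fin-⊎ (suc m) f = begin
      ∑ (Fin↔ _) f                                     ≡⟨ ∑-suc f ⟩
      f Fin.zero + ∑ (Fin↔ _) (f ∘ Fin.suc)            ≡⟨ cong (f Fin.zero +_) (∑-Fin-⊎ m (f ∘ Fin.suc)) ⟩
      f Fin.zero + (∑ (Fin↔ m) (λ i → f (Fin.suc i Fin.↑ˡ _)) + ∑ (Fin↔ _) _) ≡⟨ ℕ.+-assoc (f Fin.zero) _ _ ⟨
      f Fin.zero + ∑ (Fin↔ m) (λ i → f (Fin.suc i Fin.↑ˡ _)) + ∑ (Fin↔ _) (λ j → f (suc m Fin.↑ʳ j))
        ≡⟨ cong (_+ ∑ (Fin↔ _) (λ j → f (suc m Fin.↑ʳ j))) (∑-suc (λ i → f (i Fin.↑ˡ _))) ⟨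
      _ ∎
      where open ≡-Reasoning

    ∑-Fin-× : ∀ m n (f : Fin (m * n) → ℕ) →
      ∑ (Fin↔ (m * n)) f ≡ ∑ (Fin↔ m) (λ i → ∑ (Fin↔ n) (λ j → f (combine {m} {n} i j)))
    ∑-Fin-× zero    n f = trans (∑-empty _ f) (sym (∑-empty _ _))
    ∑-Fin-× (suc m) n f = begin
      ∑ (Fin↔ (n + m * n)) f ≡⟨ ∑-Fin-⊎ n f ⟩
      ∑ (Fin↔ n) (λ j → f (j Fin.↑ˡ (m * n))) + ∑ (Fin↔ (m * n)) (λ k → f (n Fin.↑ʳ k))
        ≡⟨ cong (∑ (Fin↔ n) (λ j → f (j Fin.↑ˡ (m * n))) +_) (∑-Fin-× m n (λ k → f (n Fin.↑ʳ k))) ⟩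
      _ ≡⟨ ∑-suc (λ i → ∑ (Fin↔ n) (λ j → f (combine {suc m} {n} i j))) ⟨
      _ ∎
      where open ≡-Reasoning

  -- `F` is arbitrary, since a graph brings its own enumeration; the identity bijection moves the
  -- sum to the standard one, where the index splits.
  ∑-⊎ : (E : A ↔ Fin m) (E′ : B ↔ Fin n) (F : (A ⊎ B) ↔ Fin o) (f : A ⊎ B → ℕ) →
    ∑ F f ≡ ∑ E (f ∘ inj₁) + ∑ E′ (f ∘ inj₂)
  ∑-⊎ {m = m} {n = n} E E′ F f = begin
    ∑ F f                                        ≡⟨ ∑-↔ F (↔-sym Fin.+↔⊎ ↔-∘ (E ⊎-↔ E′)) (↔-id _) f ⟩
    ∑ (↔-sym Fin.+↔⊎ ↔-∘ (E ⊎-↔ E′)) f           ≡⟨ trans (∑-Fin _ f) (∑-Fin-⊎ m _) ⟩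
    _                                            ≡⟨ cong₂ _+_
      (∑-cong _ (λ i → cong (f ∘ from (E ⊎-↔ E′)) (Fin.splitAt-↑ˡ m i n)))
      (∑-cong _ (λ j → cong (f ∘ from (E ⊎-↔ E′)) (Fin.splitAt-↑ʳ m n j))) ⟩
    ∑ (Fin↔ m) (f ∘ inj₁ ∘ from E) + ∑ (Fin↔ n) (f ∘ inj₂ ∘ from E′) ≡⟨ cong₂ _+_ (∑-Fin E _) (∑-Fin E′ _) ⟨
    ∑ E (f ∘ inj₁) + ∑ E′ (f ∘ inj₂)             ∎
    where open ≡-Reasoning

  ∑-× : (E : A ↔ Fin m) (E′ : B ↔ Fin n) (F : (A × B) ↔ Fin o) (f : A × B → ℕ) →
    ∑ F f ≡ ∑ E (λ x → ∑ E′ (λ y → f (x , y)))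
  ∑-× {m = m} {n = n} E E′ F f = begin
    ∑ F f                                        ≡⟨ ∑-↔ F (↔-sym Fin.*↔× ↔-∘ (E ×-↔ E′)) (↔-id _) f ⟩
    ∑ (↔-sym Fin.*↔× ↔-∘ (E ×-↔ E′)) f           ≡⟨ trans (∑-Fin _ f) (∑-Fin-× m n _) ⟩
    _                                            ≡⟨ ∑-cong _ (λ i → ∑-cong _ (λ j →
                                                      cong (f ∘ from (E ×-↔ E′)) (Fin.remQuot-combine i j))) ⟩
    _                                            ≡⟨ ∑-cong _ (λ i → ∑-Fin E′ (λ y → f (from E i , y))) ⟨
    _                                            ≡⟨ ∑-Fin E (λ x → ∑ E′ (λ y → f (x , y))) ⟨
    ∑ E (λ x → ∑ E′ (λ y → f (x , y)))           ∎
    where open ≡-Reasoning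

  -- A sum over a subset becomes a sum over the whole type with value zero outside. The summand may
  -- depend on the membership proof, so multiplying by `χ b` would not do.
  whenT : ∀ b → (T b → ℕ) → ℕ
  whenT true  f = f tt
  whenT false f = 0

  whenT-const : ∀ b c → whenT b (λ _ → c) ≡ χ b * c
  whenT-const true  c = sym (ℕ.+-identityʳ c)
  whenT-const false c = refl

  extend : (S : Subset A) → (Σ A (_∈ S) → ℕ) → A → ℕ
  extend S f x = whenT (S x) (λ x∈S → f (x , x∈S))

  private
    T↔Fin : ∀ b → T b ↔ Fin (χ b)
    T↔Fin true  = ↔-sym Fin.1↔⊤
    T↔Fin false = ↔-sym Fin.0↔⊥

    ∑-T : ∀ b (f : T b → ℕ) → ∑ (T↔Fin b) f ≡ whenT b f
    ∑-T true  f = ∑-const (T↔Fin true) (f tt) ⟨ trans ⟩ ℕ.+-identityʳ (f tt)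
    ∑-T false f = ∑-empty _ f

    ∈-suc : (S : Subset (Fin (suc n))) →
      Σ (Fin (suc n)) (_∈ S) ↔ (Fin.zero ∈ S ⊎ Σ (Fin n) (_∈ S ∘ Fin.suc))
    ∈-suc S = mk↔ₛ′
      (λ { (Fin.zero , p) → inj₁ p ; (Fin.suc i , p) → inj₂ (i , p) })
      [ (λ p → Fin.zero , p) , (λ (i , p) → Fin.suc i , p) ]′
      (λ { (inj₁ _) → refl ; (inj₂ _) → refl })
      (λ { (Fin.zero , _) → refl ; (Fin.suc _ , _) → refl })

    sum-extend : ∀ n (S : Subset (Fin n)) (E : Σ (Fin n) (_∈ S) ↔ Fin o) (f : Σ (Fin n) (_∈ S) → ℕ) →
      ∑ E f ≡ ∑ (Fin↔ n) (extend S f)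
    sum-extend zero    S E f = trans (∑-zero E (λ ())) (sym (∑-empty _ _))
    sum-extend (suc n) S E f = begin
      ∑ E f
        ≡⟨ ∑-↔ (E ↔-∘ ↔-sym (∈-suc S)) E (↔-sym (∈-suc S)) f ⟨
      ∑ (E ↔-∘ ↔-sym (∈-suc S)) (f ∘ from (∈-suc S))
        ≡⟨ ∑-⊎ (T↔Fin (S Fin.zero)) E′ (E ↔-∘ ↔-sym (∈-suc S)) (f ∘ from (∈-suc S)) ⟩
      ∑ (T↔Fin (S Fin.zero)) (λ p → f (Fin.zero , p)) + ∑ E′ (λ (i , p) → f (Fin.suc i , p))
        ≡⟨ cong₂ _+_ (∑-T (S Fin.zero) _) (sum-extend n (S ∘ Fin.suc) E′ _) ⟩
      _ ≡⟨ ∑-suc (extend S f) ⟨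
      ∑ (Fin↔ _) (extend S f) ∎
      where
      open ≡-Reasoning
      E′ = proj₂ (∈-finite n (S ∘ Fin.suc))

  -- Pulling the subset back along `E` reaches `Fin n`, where `sum-extend` can use induction.
  -- Membership being proof-irrelevant, elements of a subset are equal as soon as their underlying
  -- points are.
  ∑-subset : (E : A ↔ Fin n) (S : Subset A) (E′ : Σ A (_∈ S) ↔ Fin m) (f : Σ A (_∈ S) → ℕ) →
    ∑ E′ f ≡ ∑ E (extend S f)
  ∑-subset E S E′ f = begin
    ∑ E′ f                                       ≡⟨ ∑-↔ E₀ E′ π f ⟨
    ∑ E₀ (f ∘ to π)                              ≡⟨ sum-extend _ (S ∘ from E) E₀ (f ∘ to π) ⟩
    ∑ (Fin↔ _) (extend S f ∘ from E)             ≡⟨ ∑-Fin E (extend S f) ⟨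
    ∑ E (extend S f)                             ∎
    where
    open ≡-Reasoning
    E₀ = proj₂ (∈-finite _ (S ∘ from E))
    Σ-≡ : ∀ {x y} {p : x ∈ S} {q : y ∈ S} → x ≡ y → (x , p) ≡ (y , q)
    Σ-≡ {x} refl = cong (x ,_) (T-irrelevant _ _)
    π : Σ _ (λ i → from E i ∈ S) ↔ Σ _ (_∈ S)
    π = mk↔ₛ′ (λ (i , p) → from E i , p)
      (λ (x , p) → to E x , subst (_∈ S) (sym (strictlyInverseʳ E x)) p)
      (λ (x , p) → Σ-≡ (strictlyInverseʳ E x))
      (λ (i , p) → Σ-≡′ (strictlyInverseˡ E i))
      where
      Σ-≡′ : ∀ {i j} {p : from E i ∈ S} {q : from E j ∈ S} → i ≡ j → (i , p) ≡ (j , q)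
      Σ-≡′ {i} refl = cong (i ,_) (T-irrelevant _ _)

  card-subset : (E : A ↔ Fin n) (S : Subset A) (E′ : Σ A (_∈ S) ↔ Fin m) → m ≡ ∑ E (χ ∘ S)
  card-subset {m = m} E S E′ = begin
    m                        ≡⟨ ℕ.*-identityʳ m ⟨
    m * 1                    ≡⟨ ∑-const E′ 1 ⟨
    ∑ E′ (λ _ → 1)           ≡⟨ ∑-subset E S E′ (λ _ → 1) ⟩
    ∑ E (extend S (λ _ → 1)) ≡⟨ ∑-cong E (λ x → trans (whenT-const (S x) 1) (ℕ.*-identityʳ _)) ⟩
    ∑ E (χ ∘ S)              ∎
    where open ≡-Reasoning

  ∑-χ-↔ : (E : A ↔ Fin m) (S : Subset A) (E′ : B ↔ Fin n) (S′ : Subset B) →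
    Σ A (_∈ S) ↔ Σ B (_∈ S′) → ∑ E (χ ∘ S) ≡ ∑ E′ (χ ∘ S′)
  ∑-χ-↔ E S E′ S′ π = begin
    ∑ E (χ ∘ S)                  ≡⟨ card-subset E S (proj₂ (subset-finite E S)) ⟨
    proj₁ (subset-finite E S)    ≡⟨ card-unique (proj₂ (subset-finite E S)) (proj₂ (subset-finite E′ S′)) π ⟩
    proj₁ (subset-finite E′ S′)  ≡⟨ card-subset E′ S′ (proj₂ (subset-finite E′ S′)) ⟩
    ∑ E′ (χ ∘ S′)                ∎
    where open ≡-Reasoning

  length-filter-tabulate : ∀ {p} {P : A → Set p} (P? : Unary.Decidable P) {n} (f : Fin n → A) →
    length (filter P? (tabulate f)) ≡ ∑ (Fin↔ n) (λ i → χ (does (P? (f i))))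
  length-filter-tabulate P? {zero}  f = sym (∑-empty _ _)
  length-filter-tabulate P? {suc n} f rewrite ∑-suc (λ i → χ (does (P? (f i)))) with does (P? (f Fin.zero))
  ... | true  = cong suc (length-filter-tabulate P? (f ∘ Fin.suc))
  ... | false = length-filter-tabulate P? (f ∘ Fin.suc)

  length-filter-map : ∀ {p} {P : A → Set p} (P? : Unary.Decidable P) {n} (f : Fin n → A) →
    length (filter P? (map f (allFin n))) ≡ ∑ (Fin↔ n) (λ i → χ (does (P? (f i))))
  length-filter-map P? f = trans (cong (length ∘ filter P?) (List.map-tabulate id f)) (length-filter-tabulate P? f)

  length-filter-++ : ∀ {p} {P : A → Set p} (P? : Unary.Decidable P) xs ys →
    length (filter P? (xs ++ ys)) ≡ length (filter P? xs) + length (filter P? ys)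
  length-filter-++ P? xs ys = trans (cong length (List.filter-++ P? xs ys)) (List.length-++ (filter P? xs))

  length-filter-cartesianProduct : ∀ {p} {P : A × B → Set p} (P? : Unary.Decidable P)
    {m n} (f : Fin m → A) (g : Fin n → B) →
    length (filter P? (cartesianProduct (tabulate f) (tabulate g))) ≡
    ∑ (Fin↔ m) (λ i → ∑ (Fin↔ n) (λ j → χ (does (P? (f i , g j)))))
  length-filter-cartesianProduct P? {zero}  f g = sym (∑-empty _ _)
  length-filter-cartesianProduct P? {suc m} f g = begin
    _ ≡⟨ length-filter-++ P? (map (f Fin.zero ,_) (tabulate g)) _ ⟩
    _ ≡⟨ cong₂ _+_
           (trans (cong (length ∘ filter P?) (List.map-tabulate g (f Fin.zero ,_))) (length-filter-tabulate P? _))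
           (length-filter-cartesianProduct P? (f ∘ Fin.suc) g) ⟩
    _ ≡⟨ ∑-suc (λ i → ∑ (Fin↔ _) (λ j → χ (does (P? (f i , g j))))) ⟨
    _ ∎
    where open ≡-Reasoning

  length-filter-product : ∀ {p} {P : A × B → Set p} (P? : Unary.Decidable P)
    {m n} (f : Fin m → A) (g : Fin n → B) →
    length (filter P? (cartesianProduct (map f (allFin m)) (map g (allFin n)))) ≡
    ∑ (Fin↔ m) (λ i → ∑ (Fin↔ n) (λ j → χ (does (P? (f i , g j)))))
  length-filter-product P? f g = trans
    (cong₂ (λ xs ys → length (filter P? (cartesianProduct xs ys))) (List.map-tabulate id f) (List.map-tabulate id g))
    (length-filter-cartesianProduct P? f g)

  -- The decided predicate is a Kronecker delta; its support is summed as a one-element subset.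
  ∑-point : ∀ {p} {P : A → Set p} (E : A ↔ Fin n) (P? : Unary.Decidable P) (a : A) →
    P a → (∀ {x} → P x → x ≡ a) → (f : A → ℕ) → ∑ E (λ x → χ (does (P? x)) * f x) ≡ f a
  ∑-point {A = A} E P? a Pa unique f = begin
    ∑ E (λ x → χ (S x) * f x)
      ≡⟨ ∑-cong E (λ x → point x) ⟩
    ∑ E (extend S (λ _ → f a))
      ≡⟨ ∑-subset E S E₁ (λ _ → f a) ⟨
    ∑ E₁ (λ _ → f a)
      ≡⟨ ∑-const E₁ (f a) ⟩
    1 * f a
      ≡⟨ ℕ.*-identityˡ (f a) ⟩
    f a ∎
    where
    open ≡-Reasoning
    S : Subset A
    S = does ∘ P?
    a∈S = does-T (P? a) Pa
    E₁ : Σ A (_∈ S) ↔ Fin 1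
    E₁ = mk↔ₛ′ (λ _ → Fin.zero) (λ _ → a , a∈S) (λ { Fin.zero → refl ; (Fin.suc ()) }) (λ (x , x∈S) → eq x x∈S (unique (T-does (P? x) x∈S)))
      where
      eq : ∀ x (x∈S : x ∈ S) → x ≡ a → (a , a∈S) ≡ (x , x∈S)
      eq x x∈S refl = cong (a ,_) (T-irrelevant _ _)
    point : ∀ x → χ (S x) * f x ≡ extend S (λ _ → f a) x
    point x with P? x
    ... | yes Px = trans (ℕ.+-identityʳ (f x)) (cong f (unique Px))
    ... | no  _  = refl

  -- Functions between finite sets and their codes

  module _ (ED : D ↔ Fin d) (EC : C ↔ Fin c) where

    -- Has the same form as the entries of `functions`, so that `hom-∑` needs no transport.
    decode : Fin (c ^ d) → D → C
    decode k = from EC ∘ finToFun k ∘ to ED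

    encode : (D → C) → Fin (c ^ d)
    encode f = funToFin (to EC ∘ f ∘ from ED)

    decode-encode : ∀ f → decode (encode f) ≗ f
    decode-encode f x = begin
      from EC (finToFun (funToFin (to EC ∘ f ∘ from ED)) (to ED x)) ≡⟨ cong (from EC) (Fin.finToFun-funToFin _ (to ED x)) ⟩
      from EC (to EC (f (from ED (to ED x))))                       ≡⟨ strictlyInverseʳ EC _ ⟩
      f (from ED (to ED x))                                         ≡⟨ cong f (strictlyInverseʳ ED x) ⟩
      f x                                                           ∎
      where open ≡-Reasoning

    private
      funToFin-cong : ∀ {m n} {f g : Fin m → Fin n} → f ≗ g → funToFin f ≡ funToFin g
      funToFin-cong {zero}  f≗g = refl
      funToFin-cong {suc m} f≗g = cong₂ combine (f≗g Fin.zero) (funToFin-cong (f≗g ∘ Fin.suc))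

    encode-cong : ∀ {f g} → f ≗ g → encode f ≡ encode g
    encode-cong f≗g = funToFin-cong (cong (to EC) ∘ f≗g ∘ from ED)

    encode-decode : ∀ k → encode (decode k) ≡ k
    encode-decode k = begin
      funToFin (λ i → to EC (from EC (finToFun k (to ED (from ED i)))))
        ≡⟨ funToFin-cong (λ i → trans (strictlyInverseˡ EC _) (cong (finToFun k) (strictlyInverseˡ ED i))) ⟩
      funToFin (finToFun {c} {d} k)
        ≡⟨ Fin.funToFin-finToFin {d} {c} k ⟩
      k ∎
      where open ≡-Reasoning

    -- Asked of summands because `decode (encode f)` is equal to `f` only pointwise.
    Congruent : ((D → C) → ℕ) → Set
    Congruent φ = ∀ {f g} → f ≗ g → φ f ≡ φ g

    ∑ᶠ : ((D → C) → ℕ) → ℕ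
    ∑ᶠ φ = ∑ (Fin↔ (c ^ d)) (φ ∘ decode)

    -- In the absence of function extensionality, f need only list all functions up to pointwise equality.
    ∑ᶠ-enumerate : ∀ {m n} (f : Fin m → Fin n → D → C) (g₁ : (D → C) → Fin m) (g₂ : (D → C) → Fin n) →
      (∀ {h h′} → h ≗ h′ → g₁ h ≡ g₁ h′ × g₂ h ≡ g₂ h′) →
      (∀ i j → g₁ (f i j) ≡ i × g₂ (f i j) ≡ j) → (∀ h → f (g₁ h) (g₂ h) ≗ h) →
      ∀ {φ} → Congruent φ → ∑ᶠ φ ≡ ∑ (Fin↔ m) (λ i → ∑ (Fin↔ n) (λ j → φ (f i j)))
    ∑ᶠ-enumerate {m} {n} f g₁ g₂ g-cong gf fg {φ} φ-cong = begin
      ∑ (Fin↔ (c ^ d)) (φ ∘ decode)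
        ≡⟨ ∑-cong _ (λ k → φ-cong (sym ∘ fg (decode k))) ⟩
      ∑ (Fin↔ (c ^ d)) (uncurry (λ i j → φ (f i j)) ∘ to π)
        ≡⟨ ∑-↔ (↔-id _) (↔-sym Fin.*↔×) π (uncurry λ i j → φ (f i j)) ⟩
      ∑ (↔-sym Fin.*↔×) (uncurry λ i j → φ (f i j))
        ≡⟨ ∑-× (↔-id _) (↔-id _) (↔-sym Fin.*↔×) (uncurry λ i j → φ (f i j)) ⟩
      ∑ (Fin↔ m) (λ i → ∑ (Fin↔ n) (λ j → φ (f i j))) ∎
      where
      open ≡-Reasoning
      π : Fin (c ^ d) ↔ (Fin m × Fin n)
      π = mk↔ₛ′ (λ k → g₁ (decode k) , g₂ (decode k)) (λ (i , j) → encode (f i j))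
        (λ (i , j) → let (p , q) = g-cong (decode-encode (f i j)) ; (p′ , q′) = gf i j in
          cong₂ _,_ (trans p p′) (trans q q′))
        (λ k → trans (encode-cong (fg (decode k))) (encode-decode k))
open FiniteSums

-- Edges and homomorphisms as sums

module GraphCounting where
  open import Data.Nat.Base using (_+_; _*_; _^_)

  module _ (G : Graph) where
    open Graph G

    adj : V → V → ℕ
    adj x y = χ (does (x ~? y))

    adj-sym : ∀ x y → adj x y ≡ adj y x
    adj-sym x y = cong χ (does-⇔ (mk⇔ ~-sym ~-sym) (x ~? y) (y ~? x))

    adj-irrefl : ∀ x → adj x x ≡ 0
    adj-irrefl x = cong χ (dec-false (x ~? x) (~-irrefl refl))

    ∣∣-∑ : ∀ S → ∣ S ∣ ≡ ∑ V↔Fin (χ ∘ S)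
    ∣∣-∑ S = trans (length-filter-map (λ x → T? (S x)) vertex) (sym (∑-Fin V↔Fin _))

    -- Edges are counted with increasing indices. Adding the same count with the roles of the
    -- endpoints exchanged removes the order: distinct vertices are ordered in exactly one way, and
    -- the diagonal carries no edges.
    e-double : ∀ S → 2 * e[ S ] ≡ ∑ V↔Fin (λ x → ∑ V↔Fin (λ y → χ (S x) * χ (S y) * adj x y))
    e-double S = begin
      e[ S ] + (e[ S ] + 0)
        ≡⟨ cong (e[ S ] +_) (ℕ.+-identityʳ _) ⟩
      e[ S ] + e[ S ]
        ≡⟨ cong₂ _+_ e≡ (trans e≡ (∑-comm V↔Fin V↔Fin _)) ⟩
      ∑ V↔Fin (λ x → ∑ V↔Fin (λ y → lt x y * w x y)) + ∑ V↔Fin (λ x → ∑ V↔Fin (λ y → lt y x * w y x))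
        ≡⟨ ∑-+ V↔Fin _ _ ⟨
      ∑ V↔Fin (λ x → ∑ V↔Fin (λ y → lt x y * w x y) + ∑ V↔Fin (λ y → lt y x * w y x))
        ≡⟨ ∑-cong V↔Fin (λ x → sym (∑-+ V↔Fin _ _)) ⟩
      ∑ V↔Fin (λ x → ∑ V↔Fin (λ y → lt x y * w x y + lt y x * w y x))
        ≡⟨ ∑-cong V↔Fin (λ x → ∑-cong V↔Fin (λ y → order x y)) ⟩
      ∑ V↔Fin (λ x → ∑ V↔Fin (λ y → w x y)) ∎
      where
      open ≡-Reasoning
      w lt : V → V → ℕ
      w x y = χ (S x) * χ (S y) * adj x y
      lt x y = χ (does (index x Fin.<? index y))

      w-sym : ∀ x y → w y x ≡ w x y
      w-sym x y = cong₂ _*_ (ℕ.*-comm (χ (S y)) _) (adj-sym y x)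

      rearrange : ∀ a b s s′ → χ (a ∧ b ∧ s ∧ s′) ≡ χ a * (χ s * χ s′ * χ b)
      rearrange a b s s′ = trans (χ-∧ a _) (cong (χ a *_) (trans (χ-∧ b _)
        (trans (ℕ.*-comm (χ b) _) (cong (_* χ b) (χ-∧ s s′)))))

      e≡ : e[ S ] ≡ ∑ V↔Fin (λ x → ∑ V↔Fin (λ y → lt x y * w x y))
      e≡ = begin
        e[ S ]
          ≡⟨ length-filter-product (λ (x , y) → (index x Fin.<? index y) ×-dec (x ~? y) ×-dec T? (S x) ×-dec T? (S y)) vertex vertex ⟩
        ∑ (Fin↔ v) (λ i → ∑ (Fin↔ v) (λ j → χ (does (index (vertex i) Fin.<? index (vertex j)) ∧ does (vertex i ~? vertex j) ∧ S (vertex i) ∧ S (vertex j))))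
          ≡⟨ ∑-cong _ (λ i → ∑-cong _ (λ j → rearrange (does (index (vertex i) Fin.<? index (vertex j))) (does (vertex i ~? vertex j)) (S (vertex i)) (S (vertex j)))) ⟩
        ∑ (Fin↔ v) (λ i → ∑ (Fin↔ v) (λ j → lt (vertex i) (vertex j) * w (vertex i) (vertex j)))
          ≡⟨ ∑-cong _ (λ i → sym (∑-Fin V↔Fin _)) ⟩
        ∑ (Fin↔ v) (λ i → ∑ V↔Fin (λ y → lt (vertex i) y * w (vertex i) y))
          ≡⟨ ∑-Fin V↔Fin _ ⟨
        ∑ V↔Fin (λ x → ∑ V↔Fin (λ y → lt x y * w x y)) ∎

      order : ∀ x y → lt x y * w x y + lt y x * w y x ≡ w x y
      order x y with Fin.<-cmp (index x) (index y)
      ... | tri< x<y _ y≮x = begin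
        lt x y * w x y + lt y x * w y x
          ≡⟨ cong₂ (λ s t → s * w x y + t * w y x) (χ-does (_ Fin.<? _) x<y) (cong χ (dec-false (_ Fin.<? _) y≮x)) ⟩
        1 * w x y + 0 ≡⟨ ℕ.+-identityʳ _ ⟩
        1 * w x y     ≡⟨ ℕ.*-identityˡ _ ⟩
        w x y         ∎
      ... | tri> x≮y _ y<x = begin
        lt x y * w x y + lt y x * w y x
          ≡⟨ cong₂ (λ s t → s * w x y + t * w y x) (cong χ (dec-false (_ Fin.<? _) x≮y)) (χ-does (_ Fin.<? _) y<x) ⟩
        0 + 1 * w y x ≡⟨ ℕ.*-identityˡ _ ⟩
        w y x         ≡⟨ w-sym x y ⟩
        w x y         ∎
      -- Equal indices mean equal vertices, where `w` vanishes by `adj-irrefl`.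
      ... | tri≈ x≮y x≡y y≮x = begin
        lt x y * w x y + lt y x * w y x
          ≡⟨ cong₂ (λ s t → s * w x y + t * w y x) (cong χ (dec-false (_ Fin.<? _) x≮y)) (cong χ (dec-false (_ Fin.<? _) y≮x)) ⟩
        0      ≡⟨ ℕ.*-zeroʳ (χ (S x) * χ (S y)) ⟨
        χ (S x) * χ (S y) * 0 ≡⟨ cong (χ (S x) * χ (S y) *_) (trans (cong (adj x) (sym (Injection.injective (↔⇒↣ V↔Fin) x≡y))) (adj-irrefl x)) ⟨
        w x y  ∎

    e-double-total : 2 * e ≡ ∑ V↔Fin (λ x → ∑ V↔Fin (λ y → adj x y))
    e-double-total = trans (e-double _) (∑-cong V↔Fin (λ x → ∑-cong V↔Fin (λ y → ℕ.*-identityˡ _)))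

  module _ (H G : Graph) where
    private
      module H = Graph H
      module G = Graph G

    homχ : (H.V → G.V) → ℕ
    homχ f = χ (does (isHom? H G f))

    IsHom-resp : ∀ {f g} → f ≗ g → IsHom H G f → IsHom H G g
    IsHom-resp f≗g h x y x~y = subst (G._~ _) (f≗g x) (subst (_ G.~_) (f≗g y) (h x y x~y))

    homχ-cong : Congruent H.V↔Fin G.V↔Fin homχ
    homχ-cong f≗g = cong χ (does-⇔ (mk⇔ (IsHom-resp f≗g) (IsHom-resp (sym ∘ f≗g))) (isHom? H G _) (isHom? H G _))

    hom-∑ : hom H G ≡ ∑ᶠ H.V↔Fin G.V↔Fin homχ
    hom-∑ = length-filter-map (isHom? H G) (decode H.V↔Fin G.V↔Fin)

    hom≤ : hom H G ℕ.≤ G.v ^ H.v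
    hom≤ = ℕ.≤-trans (List.length-filter (isHom? H G) (functions H G))
      (ℕ.≤-reflexive (trans (List.length-map _ (allFin (G.v ^ H.v))) (List.length-tabulate id)))

  -- A homomorphism from `K₂` is an ordered adjacent pair, so each edge gives two of them.
  hom-K₂ : ∀ G → hom K₂ G ≡ 2 * Graph.e G
  hom-K₂ G = begin
    hom K₂ G
      ≡⟨ hom-∑ K₂ G ⟩
    ∑ᶠ (Graph.V↔Fin K₂) V↔ (homχ K₂ G)
      ≡⟨ ∑ᶠ-enumerate (Graph.V↔Fin K₂) V↔ (λ i j → pair (vertex i) (vertex j)) (λ h → index (h 0F)) (λ h → index (h 1F))
           (λ h≗h′ → cong index (h≗h′ 0F) , cong index (h≗h′ 1F))
           (λ i j → Inverse.strictlyInverseˡ V↔ i , Inverse.strictlyInverseˡ V↔ j)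
           (λ h → λ { 0F → Inverse.strictlyInverseʳ V↔ _ ; 1F → Inverse.strictlyInverseʳ V↔ _ })
           (homχ-cong K₂ G) ⟩
    ∑ (Fin↔ _) (λ i → ∑ (Fin↔ _) (λ j → homχ K₂ G (pair (vertex i) (vertex j))))
      ≡⟨ ∑-cong _ (λ i → ∑-cong _ (λ j → cong χ (does-⇔ (mk⇔ (λ h → h 0F 1F (λ ())) edge)
           (isHom? K₂ G (pair (vertex i) (vertex j))) (vertex i ~? vertex j)))) ⟩
    ∑ (Fin↔ _) (λ i → ∑ (Fin↔ _) (λ j → adj G (vertex i) (vertex j)))
      ≡⟨ ∑-cong _ (λ i → sym (∑-Fin V↔ _)) ⟩
    ∑ (Fin↔ _) (λ i → ∑ V↔ (λ y → adj G (vertex i) y))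
      ≡⟨ ∑-Fin V↔ _ ⟨
    ∑ V↔ (λ x → ∑ V↔ (λ y → adj G x y))
      ≡⟨ e-double-total G ⟨
    2 * Graph.e G ∎
    where
    open ≡-Reasoning
    open Graph G using (vertex; index; _~_; _~?_; ~-sym) renaming (V↔Fin to V↔)
    pair : Graph.V G → Graph.V G → Fin 2 → Graph.V G
    pair x y 0F = x
    pair x y 1F = y
    edge : ∀ {x y} → x ~ y → IsHom K₂ G (pair x y)
    edge x~y 0F 0F 0≢0 = contradiction refl 0≢0
    edge x~y 0F 1F _   = x~y
    edge x~y 1F 0F _   = ~-sym x~y
    edge x~y 1F 1F 1≢1 = contradiction refl 1≢1
open GraphCounting

-- Extensions of a map on the shared set

module Fibres where
  open import Data.Nat.Base using (_+_; _*_; _^_)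

  private variable
    C D : Set
    m c d : ℕ

  ∈? : ∀ b → T b ⊎ T (not b)
  ∈? true  = inj₁ tt
  ∈? false = inj₂ tt

  glueAt : ∀ b → (T b → C) → (T (not b) → C) → C
  glueAt true  g f = g tt
  glueAt false g f = f tt

  module _ {A : Set} (I : Subset A) where

    glue : (Σ A (_∈ I) → C) → (Σ A (_∉ I) → C) → A → C
    glue g f x = glueAt (I x) (λ p → g (x , p)) (λ p → f (x , p))

    glue-∈ : ∀ (g : Σ A (_∈ I) → C) f u → glue g f (proj₁ u) ≡ g u
    glue-∈ {C} g f (x , p) = at (I x) p _ _
      where
      at : ∀ b (p : T b) (g : T b → C) (f : T (not b) → C) → glueAt b g f ≡ g p
      at true tt g f = refl

    glue-∉ : ∀ (g : Σ A (_∈ I) → C) f u → glue g f (proj₁ u) ≡ f u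
    glue-∉ {C} g f (x , p) = at (I x) p _ _
      where
      at : ∀ b (p : T (not b)) (g : T b → C) (f : T (not b) → C) → glueAt b g f ≡ f p
      at false tt g f = refl

    glue-cong : ∀ {g g′ : Σ A (_∈ I) → C} {f f′} → g ≗ g′ → f ≗ f′ → glue g f ≗ glue g′ f′
    glue-cong {g = g} {g′} {f} {f′} g≗g′ f≗f′ x with ∈? (I x)
    ... | inj₁ p = trans (glue-∈ g f (x , p)) (trans (g≗g′ (x , p)) (sym (glue-∈ g′ f′ (x , p))))
    ... | inj₂ p = trans (glue-∉ g f (x , p)) (trans (f≗f′ (x , p)) (sym (glue-∉ g′ f′ (x , p))))

    glue-restrict : (h : A → C) → glue (h ∘ proj₁) (h ∘ proj₁) ≗ h
    glue-restrict h x with ∈? (I x)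
    ... | inj₁ p = glue-∈ (h ∘ proj₁) (h ∘ proj₁) (x , p)
    ... | inj₂ p = glue-∉ (h ∘ proj₁) (h ∘ proj₁) (x , p)

    ∈⊎∉↔ : (Σ A (_∈ I) ⊎ Σ A (_∉ I)) ↔ A
    ∈⊎∉↔ = mk↔ₛ′ [ proj₁ , proj₁ ]′ (glue inj₁ inj₂) toFrom
      λ { (inj₁ u) → glue-∈ inj₁ inj₂ u ; (inj₂ u) → glue-∉ inj₁ inj₂ u }
      where
      toFrom : ∀ x → [ proj₁ , proj₁ ]′ (glue inj₁ inj₂ x) ≡ x
      toFrom x with ∈? (I x)
      ... | inj₁ p = cong [ proj₁ , proj₁ ]′ (glue-∈ inj₁ inj₂ (x , p))
      ... | inj₂ p = cong [ proj₁ , proj₁ ]′ (glue-∉ inj₁ inj₂ (x , p))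

  module _ (ED : D ↔ Fin d) (EC : C ↔ Fin c) (q : Subset C) (Eq : Σ C (_∈ q) ↔ Fin m) where

    -- As `P` forces all values into `q`, restricting the codomain loses nothing; the bijection is
    -- between codes, and `P-cong` carries `P` across the pointwise equalities.
    ∑ᶠ-subset : (P : (D → C) → Bool) → (∀ {f g} → f ≗ g → P f ≡ P g) →
      (∀ f → T (P f) → ∀ x → f x ∈ q) →
      ∑ᶠ ED EC (χ ∘ P) ≡ ∑ᶠ ED Eq (λ f → χ (P (proj₁ ∘ f)))
    ∑ᶠ-subset P P-cong P⇒q = ∑-χ-↔ (Fin↔ _) (P ∘ decode ED EC) (Fin↔ _) (λ k → P (proj₁ ∘ decode ED Eq k))
      (mk↔ₛ′ F G FG GF)
      where
      into : ∀ f → T (P f) → D → Σ C (_∈ q)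
      into f p x = f x , P⇒q f p x
      F : Σ _ (_∈ P ∘ decode ED EC) → Σ _ (λ k → T (P (proj₁ ∘ decode ED Eq k)))
      F (k , p) = encode ED Eq (into _ p) ,
        subst T (P-cong (λ x → sym (cong proj₁ (decode-encode ED Eq (into _ p) x)))) p
      G : Σ _ (λ k → T (P (proj₁ ∘ decode ED Eq k))) → Σ _ (_∈ P ∘ decode ED EC)
      G (k , p) = encode ED EC (proj₁ ∘ decode ED Eq k) ,
        subst T (P-cong (λ x → sym (decode-encode ED EC (proj₁ ∘ decode ED Eq k) x))) p
      Σ-≡ : ∀ {A : Set} {S : Subset A} {u w : Σ A (_∈ S)} → proj₁ u ≡ proj₁ w → u ≡ w
      Σ-≡ {u = x , _} refl = cong (x ,_) (T-irrelevant _ _)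
      FG : ∀ y → F (G y) ≡ y
      FG (k , p) = Σ-≡ (trans
        (encode-cong ED Eq {into _ (proj₂ (G (k , p)))} {decode ED Eq k} (λ x → Σ-≡ (decode-encode ED EC (proj₁ ∘ decode ED Eq k) x)))
        (encode-decode ED Eq k))
      GF : ∀ x → G (F x) ≡ x
      GF (k , p) = Σ-≡ (trans
        (encode-cong ED EC {g = decode ED EC k} (λ x → cong proj₁ (decode-encode ED Eq (into _ p) x)))
        (encode-decode ED EC k))

  module _ (G : Graph) {A : Set} {n} (E : A ↔ Fin n) (π : A → Graph.V G) where
    private module G = Graph G

    -- A blow-up of `G`: elements with the same image under `π` are never adjacent.
    pullback : NonZero n → Graph
    pullback nz = record
      { V        = A
      ; v        = n
      ; V↔Fin    = E
      ; nonempty = nz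
      ; _~_      = λ x y → π x G.~ π y
      ; _~?_     = λ x y → π x G.~? π y
      ; ~-sym    = G.~-sym
      ; ~-irrefl = λ { refl → G.~-irrefl refl }
      }

    -- The homomorphism count of the pullback, stated so as to make sense for an empty `A` too: a
    -- fibre may be empty, while a `Graph` has a vertex.
    homsVia : Graph → ℕ
    homsVia H = ∑ᶠ (Graph.V↔Fin H) E (λ f → homχ H G (π ∘ f))

    homsVia-pullback : ∀ H nz → homsVia H ≡ hom H (pullback nz)
    homsVia-pullback H nz = sym (hom-∑ H (pullback nz))

    homsVia-≤ : ∀ H → homsVia H ℕ.≤ n ^ Graph.v H
    homsVia-≤ H = ℕ.≤-trans (∑-mono (Fin↔ _) (λ k → χ≤1 _))
      (ℕ.≤-reflexive (trans (∑-const (Fin↔ _) 1) (ℕ.*-identityʳ _)))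

  -- Homomorphisms grouped by their restriction to the shared set

  module Extensions (H₁ : Graph) (I : Subset (Graph.V H₁)) (a : Graph.V H₁) (a∉I : a ∉ I) (G : Graph) where
    private
      module H₁ = Graph H₁
      module G = Graph G

    Inner Outer : Set
    Inner = Σ H₁.V (_∈ I)
    Outer = Σ H₁.V (_∉ I)

    E-inner : Inner ↔ Fin (proj₁ (subset-finite H₁.V↔Fin I))
    E-inner = proj₂ (subset-finite H₁.V↔Fin I)

    E-outer : Outer ↔ Fin (proj₁ (subset-finite H₁.V↔Fin (not ∘ I)))
    E-outer = proj₂ (subset-finite H₁.V↔Fin (not ∘ I))

    i k N L : ℕ
    i = proj₁ (subset-finite H₁.V↔Fin I)
    k = proj₁ (subset-finite H₁.V↔Fin (not ∘ I))
    N = G.v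
    L = N ^ k

    i+k≡v : i + k ≡ H₁.v
    i+k≡v = card-unique (↔-sym Fin.+↔⊎ ↔-∘ (E-inner ⊎-↔ E-outer)) H₁.V↔Fin (∈⊎∉↔ I)

    boundary : Fin (N ^ i) → Inner → G.V
    boundary = decode E-inner G.V↔Fin

    extension : Fin L → Outer → G.V
    extension = decode E-outer G.V↔Fin

    root : Fin L → G.V
    root x = extension x (a , a∉I)

    valid : Fin (N ^ i) → Subset (Fin L)
    valid g x = does (isHom? H₁ G (glue I (boundary g) (extension x)))

    -- The vertex set of G_g. Only the values outside `I` are recorded, so all fibres lie in the
    -- same `Fin L` and can be normalised by the same `L`.
    Fibre : Fin (N ^ i) → Set
    Fibre g = Σ (Fin L) (_∈ valid g)

    fibreSize : Fin (N ^ i) → ℕ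
    fibreSize g = proj₁ (∈-finite L (valid g))

    E-fibre : ∀ g → Fibre g ↔ Fin (fibreSize g)
    E-fibre g = proj₂ (∈-finite L (valid g))

    fibreHoms : Graph → Fin (N ^ i) → ℕ
    fibreHoms H g = homsVia G (E-fibre g) (root ∘ proj₁) H

    fibreSize-∑ : ∀ g → fibreSize g ≡ ∑ (Fin↔ L) (χ ∘ valid g)
    fibreSize-∑ g = card-subset (Fin↔ L) (valid g) (E-fibre g)

    hom-H₁ : hom H₁ G ≡ ∑ (Fin↔ (N ^ i)) fibreSize
    hom-H₁ = begin
      hom H₁ G
        ≡⟨ hom-∑ H₁ G ⟩
      ∑ᶠ H₁.V↔Fin G.V↔Fin (homχ H₁ G)
        ≡⟨ ∑ᶠ-enumerate H₁.V↔Fin G.V↔Fin (λ g x → glue I (boundary g) (extension x))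
             (λ h → encode E-inner G.V↔Fin (h ∘ proj₁)) (λ h → encode E-outer G.V↔Fin (h ∘ proj₁))
             (λ h≗h′ → encode-cong E-inner G.V↔Fin (h≗h′ ∘ proj₁) , encode-cong E-outer G.V↔Fin (h≗h′ ∘ proj₁))
             (λ g x → trans (encode-cong E-inner G.V↔Fin (glue-∈ I (boundary g) (extension x))) (encode-decode E-inner G.V↔Fin g)
                    , trans (encode-cong E-outer G.V↔Fin (glue-∉ I (boundary g) (extension x))) (encode-decode E-outer G.V↔Fin x))
             (λ h x → trans (glue-cong I (decode-encode E-inner G.V↔Fin _) (decode-encode E-outer G.V↔Fin _) x) (glue-restrict I h x))
             (homχ-cong H₁ G) ⟩
      ∑ (Fin↔ (N ^ i)) (λ g → ∑ (Fin↔ L) (χ ∘ valid g))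
        ≡⟨ ∑-cong _ fibreSize-∑ ⟨
      ∑ (Fin↔ (N ^ i)) fibreSize ∎
      where open ≡-Reasoning

    module _ (H₂ : Graph) where
      private
        module H₂ = Graph H₂
        H = H₁ ⋉[ I , a ] H₂
        module H = Graph H

      assemble : (Inner → G.V) → (H₂.V → Outer → G.V) → H.V → G.V
      assemble g F = [ g , (λ (x , j) → F j x) ]′

      assemble-cong : ∀ {g g′ F F′} → g ≗ g′ → (∀ j → F j ≗ F′ j) → assemble g F ≗ assemble g′ F′
      assemble-cong g≗g′ F≗F′ (inj₁ u)       = g≗g′ u
      assemble-cong g≗g′ F≗F′ (inj₂ (x , j)) = F≗F′ j x

      -- The inclusion of copy `j`; composing with it restricts a homomorphism to that copy.
      lift : H₂.V → H₁.V → H.V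
      lift j = glue I inj₁ (λ x → inj₂ (x , j))

      lift-∈ : ∀ j u → lift j (proj₁ u) ≡ inj₁ u
      lift-∈ j = glue-∈ I inj₁ (λ x → inj₂ (x , j))

      lift-∉ : ∀ j u → lift j (proj₁ u) ≡ inj₂ (u , j)
      lift-∉ j = glue-∉ I inj₁ (λ x → inj₂ (x , j))

      lift-hom : ∀ j → IsHom H₁ H (lift j)
      lift-hom j x y x~y with ∈? (I x) | ∈? (I y)
      ... | inj₁ p | inj₁ r = subst₂ H._~_ (sym (lift-∈ j (x , p))) (sym (lift-∈ j (y , r))) x~y
      ... | inj₁ p | inj₂ r = subst₂ H._~_ (sym (lift-∈ j (x , p))) (sym (lift-∉ j (y , r))) x~y
      ... | inj₂ p | inj₁ r = subst₂ H._~_ (sym (lift-∉ j (x , p))) (sym (lift-∈ j (y , r))) x~y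
      ... | inj₂ p | inj₂ r = subst₂ H._~_ (sym (lift-∉ j (x , p))) (sym (lift-∉ j (y , r))) (inj₁ (refl , x~y))

      assemble-lift : ∀ g F j → assemble g F ∘ lift j ≗ glue I g (F j)
      assemble-lift g F j x with ∈? (I x)
      ... | inj₁ p = trans (cong (assemble g F) (lift-∈ j (x , p))) (sym (glue-∈ I g (F j) (x , p)))
      ... | inj₂ p = trans (cong (assemble g F) (lift-∉ j (x , p))) (sym (glue-∉ I g (F j) (x , p)))

      assemble-copy : ∀ g F → IsHom H G (assemble g F) → ∀ j → IsHom H₁ G (glue I g (F j))
      assemble-copy g F h j = IsHom-resp H₁ G (assemble-lift g F j) (λ x y x~y → h (lift j x) (lift j y) (lift-hom j x y x~y))

      assemble-roots : ∀ g F → IsHom H G (assemble g F) → IsHom H₂ G (λ j → F j (a , a∉I))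
      assemble-roots g F h i j i~j = h (inj₂ ((a , a∉I) , i)) (inj₂ ((a , a∉I) , j)) (inj₂ (refl , refl , i~j))

      assemble-hom : ∀ g F → (∀ j → IsHom H₁ G (glue I g (F j))) → IsHom H₂ G (λ j → F j (a , a∉I)) →
        IsHom H G (assemble g F)
      -- An edge between shared vertices belongs to every copy, so any copy will do; `nonempty`
      -- supplies one.
      assemble-hom g F copies roots (inj₁ u) (inj₁ w) u~w = 
        subst₂ G._~_ (glue-∈ I g (F j₀) u) (glue-∈ I g (F j₀) w) (copies j₀ _ _ u~w)
        where j₀ = Inverse.from H₂.V↔Fin (Fin.fromℕ< (ℕ.>-nonZero⁻¹ H₂.v {{H₂.nonempty}}))
      assemble-hom g F copies roots (inj₁ u) (inj₂ (w , j)) u~w =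
        subst₂ G._~_ (glue-∈ I g (F j) u) (glue-∉ I g (F j) w) (copies j _ _ u~w)
      assemble-hom g F copies roots (inj₂ (u , j)) (inj₁ w) u~w =
        subst₂ G._~_ (glue-∉ I g (F j) u) (glue-∈ I g (F j) w) (copies j _ _ u~w)
      assemble-hom g F copies roots (inj₂ (u , j)) (inj₂ (w , .j)) (inj₁ (refl , u~w)) =
        subst₂ G._~_ (glue-∉ I g (F j) u) (glue-∉ I g (F j) w) (copies j _ _ u~w)
      -- The proofs `p` and `r` that `a` is outside `I` must be identified with `a∉I`, at which the
      -- roots are taken.
      assemble-hom g F copies roots (inj₂ ((_ , p) , i)) (inj₂ ((_ , r) , j)) (inj₂ (refl , refl , i~j))
        rewrite T-irrelevant p a∉I | T-irrelevant r a∉I = roots i j i~j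

      glued : Fin (N ^ i) → (H₂.V → Fin L) → H.V → G.V
      glued g F = assemble (boundary g) (extension ∘ F)

      -- Once the values on `I` are fixed, the copies constrain each other only through the edges of
      -- `H₂` on their roots. A homomorphism is then a choice of a valid extension for each vertex
      -- of `H₂` that respects these edges.
      hom-⋉ : hom H G ≡ ∑ (Fin↔ (N ^ i)) (fibreHoms H₂)
      hom-⋉ = begin
        hom H G
          ≡⟨ hom-∑ H G ⟩
        ∑ᶠ H.V↔Fin G.V↔Fin (homχ H G)
          ≡⟨ ∑ᶠ-enumerate H.V↔Fin G.V↔Fin (λ g k → glued g (decode H₂.V↔Fin (Fin↔ L) k))
               (λ h → encode E-inner G.V↔Fin (h ∘ inj₁))
               (λ h → encode H₂.V↔Fin (Fin↔ L) (λ j → encode E-outer G.V↔Fin (λ x → h (inj₂ (x , j)))))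
               (λ h≗h′ → encode-cong E-inner G.V↔Fin (h≗h′ ∘ inj₁)
                       , encode-cong H₂.V↔Fin (Fin↔ L) (λ j → encode-cong E-outer G.V↔Fin (λ x → h≗h′ (inj₂ (x , j)))))
               (λ g k → encode-decode E-inner G.V↔Fin g
                      , trans (encode-cong H₂.V↔Fin (Fin↔ L) (λ j → encode-decode E-outer G.V↔Fin (decode H₂.V↔Fin (Fin↔ L) k j))) (encode-decode H₂.V↔Fin (Fin↔ L) k))
               (λ h w → trans
                 (assemble-cong (decode-encode E-inner G.V↔Fin _)
                   (λ j x → trans (cong (λ y → extension y x) (decode-encode H₂.V↔Fin (Fin↔ L) _ j)) (decode-encode E-outer G.V↔Fin _ x)) w)
                 ([,]-restrict h w))
               (homχ-cong H G) ⟩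
        ∑ (Fin↔ (N ^ i)) (λ g → ∑ᶠ H₂.V↔Fin (Fin↔ L) (λ F → homχ H G (glued g F)))
          -- Every copy of a homomorphism is valid, so its extensions may be taken in the fibre;
          -- then only the edges on the roots are left to check.
          ≡⟨ ∑-cong _ (λ g → trans
               (∑ᶠ-subset H₂.V↔Fin (Fin↔ L) (valid g) (E-fibre g) (λ F → does (isHom? H G (glued g F)))
                 (λ F≗F′ → let eq = assemble-cong (λ _ → refl) (λ j x → cong (λ y → extension y x) (F≗F′ j)) in
                   does-⇔ (mk⇔ (IsHom-resp H G eq) (IsHom-resp H G (sym ∘ eq))) (isHom? H G _) (isHom? H G _))
                 (λ F p j → does-T (isHom? H₁ G _) (assemble-copy _ _ (T-does (isHom? H G _) p) j)))
               (∑-cong _ (λ k → cong χ (hom-fibre g (decode H₂.V↔Fin (E-fibre g) k))))) ⟩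
        ∑ (Fin↔ (N ^ i)) (fibreHoms H₂) ∎
        where
        open ≡-Reasoning
        [,]-restrict : ∀ (h : H.V → G.V) → assemble (h ∘ inj₁) (λ j x → h (inj₂ (x , j))) ≗ h
        [,]-restrict h (inj₁ _) = refl
        [,]-restrict h (inj₂ _) = refl
        hom-fibre : ∀ g (F : H₂.V → Fibre g) →
          does (isHom? H G (glued g (proj₁ ∘ F))) ≡ does (isHom? H₂ G (root ∘ proj₁ ∘ F))
        hom-fibre g F = does-⇔ (mk⇔ (assemble-roots _ _)
          (assemble-hom _ _ (λ j → T-does (isHom? H₁ G _) (proj₂ (F j))))) (isHom? H G _) (isHom? H₂ G _)
open Fibres

-- Edges of the product, and resampling the root of an extension

module EdgeCounting where
  open import Data.Nat.Base using (_+_; _*_; _^_)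

  ≟V : (G : Graph) (x y : Graph.V G) → Dec (x ≡ y)
  ≟V G = Fin.inj⇒≟ (↔⇒↣ (Graph.V↔Fin G))

  χ-⊎ : ∀ {p q} {P : Set p} {Q : Set q} (P? : Dec P) (Q? : Dec Q) → (P → ¬ Q) →
    χ (does (P? ⊎-dec Q?)) ≡ χ (does P?) + χ (does Q?)
  χ-⊎ (yes p) Q? ¬both = sym (cong (λ b → 1 + χ b) (dec-false Q? (¬both p)))
  χ-⊎ (no ¬p) Q? ¬both = refl

  module _ (H₁ : Graph) (I : Subset (Graph.V H₁)) (a : Graph.V H₁) (H₂ : Graph)
           (independent : Graph.Independent H₁ I) (a∉I : a ∉ I) where
    private
      module H₁ = Graph H₁
      module H₂ = Graph H₂
      H = H₁ ⋉[ I , a ] H₂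
      module H = Graph H
      E₁ = H₁.V↔Fin
      E₂ = H₂.V↔Fin
      Eᵢ = proj₂ (subset-finite E₁ I)
      Eₒ = proj₂ (subset-finite E₁ (not ∘ I))
      n = H₂.v

      Outer = Σ H₁.V (_∉ I)

      ∑₁ : (H₁.V → ℕ) → ℕ
      ∑₁ = ∑ E₁
      ∑₂ : (H₂.V → ℕ) → ℕ
      ∑₂ = ∑ E₂
      ∑ᵢ : (Σ H₁.V (_∈ I) → ℕ) → ℕ
      ∑ᵢ = ∑ Eᵢ
      ∑ₒ : (Outer → ℕ) → ℕ
      ∑ₒ = ∑ Eₒ

      split₁ : ∀ f → ∑₁ f ≡ ∑ᵢ (f ∘ proj₁) + ∑ₒ (f ∘ proj₁)
      split₁ f = trans (sym (∑-↔ (E₁ ↔-∘ ∈⊎∉↔ I) E₁ (∈⊎∉↔ I) f))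
        (∑-⊎ Eᵢ Eₒ (E₁ ↔-∘ ∈⊎∉↔ I) (f ∘ [ proj₁ , proj₁ ]′))

      splitH : ∀ f → ∑ H.V↔Fin f ≡ ∑ᵢ (f ∘ inj₁) + ∑ₒ (λ x → ∑₂ (λ j → f (inj₂ (x , j))))
      splitH f = trans (∑-⊎ Eᵢ E H.V↔Fin f) (cong (∑ᵢ (f ∘ inj₁) +_) (∑-× Eₒ E₂ E (f ∘ inj₂)))
        where E = ↔-sym Fin.*↔× ↔-∘ (Eₒ ×-↔ E₂)

      α : H₁.V → H₁.V → ℕ
      α = adj H₁
      β : H₂.V → H₂.V → ℕ
      β = adj H₂

      δ₁ : Outer → ℕ
      δ₁ x = χ (does (≟V H₁ (proj₁ x) a))
      δ₂ : H₂.V → H₂.V → ℕ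
      δ₂ i j = χ (does (≟V H₂ i j))

      adj-inner : ∀ u w → adj H (inj₁ u) (inj₁ w) ≡ 0
      adj-inner u w = cong χ (dec-false (proj₁ u H₁.~? proj₁ w) (independent (proj₂ u) (proj₂ w)))

      -- The two ways of being adjacent exclude each other, as the first needs `i ≡ j` and the
      -- second an edge of `H₂` from `i` to `j`; hence their indicators add.
      adj-outer : ∀ x i y j → adj H (inj₂ (x , i)) (inj₂ (y , j)) ≡
        δ₂ i j * α (proj₁ x) (proj₁ y) + δ₁ x * (δ₁ y * β i j)
      adj-outer (x , p) i (y , r) j = begin
        adj H (inj₂ ((x , p) , i)) (inj₂ ((y , r) , j))
          ≡⟨ cong χ (does-≡ (Graph._~?_ H (inj₂ ((x , p) , i)) (inj₂ ((y , r) , j))) (P? ⊎-dec Q?)) ⟩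
        χ (does (P? ⊎-dec Q?))
          ≡⟨ χ-⊎ P? Q? (λ { (refl , _) (_ , _ , i~i) → H₂.~-irrefl refl i~i }) ⟩
        χ (does P?) + χ (does Q?)
          ≡⟨ cong₂ _+_ (χ-∧ (does (≟V H₂ i j)) _) (trans (χ-∧ (does (≟V H₁ x a)) _) (cong (δ₁ (x , p) *_) (χ-∧ (does (≟V H₁ y a)) _))) ⟩
        δ₂ i j * α x y + δ₁ (x , p) * (δ₁ (y , r) * β i j) ∎
        where
        open ≡-Reasoning
        P? = ≟V H₂ i j ×-dec (x H₁.~? y)
        Q? = ≟V H₁ x a ×-dec ≟V H₁ y a ×-dec (i H₂.~? j)

      ∑-δ₁ : ∀ c → ∑ₒ (λ x → δ₁ x * c) ≡ c
      ∑-δ₁ c = ∑-point Eₒ (λ x → ≟V H₁ (proj₁ x) a) (a , a∉I) refl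
        (λ { {x , p} refl → cong (x ,_) (T-irrelevant p a∉I) }) (λ _ → c)

      ∑-δ₂ : ∀ i c → ∑₂ (λ j → δ₂ i j * c) ≡ c
      ∑-δ₂ i c = ∑-point E₂ (≟V H₂ i) i refl sym (λ _ → c)

      -- Ordered adjacent pairs leading out of `I`, and those with both ends outside `I`.
      -- Independence of `I` leaves no third kind up to symmetry.
      cross mixed : ℕ
      cross = ∑ᵢ (λ u → ∑ₒ (λ x → α (proj₁ u) (proj₁ x)))
      mixed = ∑ₒ (λ x → ∑ₒ (λ y → α (proj₁ x) (proj₁ y)))

      cross′ : ∑ₒ (λ x → ∑ᵢ (λ u → α (proj₁ x) (proj₁ u))) ≡ cross
      cross′ = trans (∑-comm Eₒ Eᵢ _) (∑-cong Eᵢ (λ u → ∑-cong Eₒ (λ x → adj-sym H₁ _ _)))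

      e₁ : 2 * H₁.e ≡ cross + (cross + mixed)
      e₁ = begin
        2 * H₁.e
          ≡⟨ e-double-total H₁ ⟩
        ∑₁ (λ x → ∑₁ (α x))
          ≡⟨ split₁ _ ⟩
        ∑ᵢ (λ u → ∑₁ (α (proj₁ u))) + ∑ₒ (λ x → ∑₁ (α (proj₁ x)))
          ≡⟨ cong₂ _+_ (∑-cong Eᵢ (λ u → trans (split₁ _) (cong (_+ ∑ₒ (λ x → α (proj₁ u) (proj₁ x))) (∑-zero Eᵢ (adj-inner u)))))
                       (trans (∑-cong Eₒ (λ x → split₁ _)) (trans (∑-+ Eₒ _ _) (cong (_+ mixed) cross′))) ⟩
        cross + (cross + mixed) ∎
        where open ≡-Reasoning

      ∑₂-const : ∀ c → ∑₂ (λ _ → c) ≡ n * c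
      ∑₂-const = ∑-const E₂

      outer-sum : ∀ x i → ∑ₒ (λ y → ∑₂ (λ j → adj H (inj₂ (x , i)) (inj₂ (y , j)))) ≡
        ∑ₒ (λ y → α (proj₁ x) (proj₁ y)) + δ₁ x * ∑₂ (β i)
      outer-sum x i = begin
        ∑ₒ (λ y → ∑₂ (λ j → adj H (inj₂ (x , i)) (inj₂ (y , j))))
          ≡⟨ ∑-cong Eₒ (λ y → begin
               ∑₂ (λ j → adj H (inj₂ (x , i)) (inj₂ (y , j)))
                 ≡⟨ ∑-cong E₂ (adj-outer x i y) ⟩
               ∑₂ (λ j → δ₂ i j * α (proj₁ x) (proj₁ y) + δ₁ x * (δ₁ y * β i j))
                 ≡⟨ ∑-+ E₂ _ _ ⟩
               ∑₂ (λ j → δ₂ i j * α (proj₁ x) (proj₁ y)) + ∑₂ (λ j → δ₁ x * (δ₁ y * β i j))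
                 ≡⟨ cong₂ _+_ (∑-δ₂ i _) (trans (∑-*ˡ E₂ (δ₁ x) _) (cong (δ₁ x *_) (∑-*ˡ E₂ (δ₁ y) _))) ⟩
               α (proj₁ x) (proj₁ y) + δ₁ x * (δ₁ y * ∑₂ (β i)) ∎) ⟩
        ∑ₒ (λ y → α (proj₁ x) (proj₁ y) + δ₁ x * (δ₁ y * ∑₂ (β i)))
          ≡⟨ ∑-+ Eₒ _ _ ⟩
        ∑ₒ (λ y → α (proj₁ x) (proj₁ y)) + ∑ₒ (λ y → δ₁ x * (δ₁ y * ∑₂ (β i)))
          ≡⟨ cong (∑ₒ (λ y → α (proj₁ x) (proj₁ y)) +_) (trans (∑-*ˡ Eₒ (δ₁ x) _) (cong (δ₁ x *_) (∑-δ₁ _))) ⟩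
        ∑ₒ (λ y → α (proj₁ x) (proj₁ y)) + δ₁ x * ∑₂ (β i) ∎
        where open ≡-Reasoning

      eₕ : 2 * H.e ≡ n * cross + ((n * cross + n * mixed) + 2 * H₂.e)
      eₕ = begin
        2 * H.e
          ≡⟨ e-double-total H ⟩
        ∑ H.V↔Fin (λ u → ∑ H.V↔Fin (adj H u))
          ≡⟨ splitH _ ⟩
        ∑ᵢ (λ u → ∑ H.V↔Fin (adj H (inj₁ u))) + ∑ₒ (λ x → ∑₂ (λ i → ∑ H.V↔Fin (adj H (inj₂ (x , i)))))
          ≡⟨ cong₂ _+_
               (∑-cong Eᵢ (λ u → trans (splitH _) (cong₂ _+_ (∑-zero Eᵢ (adj-inner u)) (trans (∑-cong Eₒ (λ x → ∑₂-const _)) (∑-*ˡ Eₒ n _)))))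
               (∑-cong Eₒ (λ x → trans (∑-cong E₂ (λ i → trans (splitH _) (cong (∑ᵢ (λ u → α (proj₁ x) (proj₁ u)) +_) (outer-sum x i))))
                 (trans (∑-+ E₂ _ _) (cong₂ _+_ (∑₂-const _) (trans (∑-+ E₂ _ _) (cong₂ _+_ (∑₂-const _) (∑-*ˡ E₂ (δ₁ x) _))))))) ⟩
        ∑ᵢ (λ u → n * ∑ₒ (λ x → α (proj₁ u) (proj₁ x))) +
        ∑ₒ (λ x → n * ∑ᵢ (λ u → α (proj₁ x) (proj₁ u)) +
                  (n * ∑ₒ (λ y → α (proj₁ x) (proj₁ y)) + δ₁ x * ∑₂ (λ i → ∑₂ (β i))))
          ≡⟨ cong₂ _+_ (∑-*ˡ Eᵢ n _) (trans (∑-+ Eₒ _ _) (cong₂ _+_ (trans (∑-*ˡ Eₒ n _) (cong (n *_) cross′))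
               (trans (∑-+ Eₒ _ _) (cong₂ _+_ (∑-*ˡ Eₒ n _) (trans (∑-δ₁ _) (sym (e-double-total H₂))))))) ⟩
        n * cross + (n * cross + (n * mixed + 2 * H₂.e))
          ≡⟨ cong (n * cross +_) (sym (ℕ.+-assoc (n * cross) _ _)) ⟩
        n * cross + ((n * cross + n * mixed) + 2 * H₂.e) ∎
        where open ≡-Reasoning

    -- Since `I` is independent, every edge of `H₁` has an end outside `I`, so the copies share no
    -- edge; the edges of `H₂` join different copies. Ordered pairs are counted, whence the
    -- cancelled factor 2.
    e-⋉ : H.e ≡ n * H₁.e + H₂.e
    e-⋉ = ℕ.*-cancelˡ-≡ H.e (n * H₁.e + H₂.e) 2 (begin
      2 * H.e
        ≡⟨ eₕ ⟩
      n * cross + ((n * cross + n * mixed) + 2 * H₂.e)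
        ≡⟨ ℕ.+-assoc (n * cross) _ _ ⟨
      n * cross + (n * cross + n * mixed) + 2 * H₂.e
        ≡⟨ cong (_+ 2 * H₂.e) (trans (cong (n * cross +_) (sym (ℕ.*-distribˡ-+ n _ _))) (sym (ℕ.*-distribˡ-+ n _ _))) ⟩
      n * (cross + (cross + mixed)) + 2 * H₂.e
        ≡⟨ cong (λ z → n * z + 2 * H₂.e) e₁ ⟨
      n * (2 * H₁.e) + 2 * H₂.e
        ≡⟨ cong (_+ 2 * H₂.e) (trans (sym (ℕ.*-assoc n 2 _)) (trans (cong (_* H₁.e) (ℕ.*-comm n 2)) (ℕ.*-assoc 2 n _))) ⟩
      2 * (n * H₁.e) + 2 * H₂.e
        ≡⟨ ℕ.*-distribˡ-+ 2 (n * H₁.e) H₂.e ⟨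
      2 * (n * H₁.e + H₂.e) ∎)
      where open ≡-Reasoning

module Resampling (H₁ : Graph) (I : Subset (Graph.V H₁)) (a : Graph.V H₁) (a∉I : a ∉ I) (G : Graph) where
  open import Data.Nat.Base using (_+_; _*_; _^_)
  open Extensions H₁ I a a∉I G
  private
    module H₁ = Graph H₁
    module G = Graph G

    update : (Outer → G.V) → G.V → Outer → G.V
    update h y x = if does (EdgeCounting.≟V H₁ (proj₁ x) a) then y else h x

    update-root : ∀ h y → update h y (a , a∉I) ≡ y
    update-root h y = cong (if_then y else h (a , a∉I)) (dec-true (EdgeCounting.≟V H₁ a a) refl)

    update-cong : ∀ {h h′} → h ≗ h′ → ∀ y → update h y ≗ update h′ y
    update-cong h≗h′ y x = cong (if does (EdgeCounting.≟V H₁ (proj₁ x) a) then y else_) (h≗h′ x)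

    update-update : ∀ h y → update (update h y) (h (a , a∉I)) ≗ h
    update-update h y (x , p) = by (EdgeCounting.≟V H₁ x a)
      where
      by : (x≟a : Dec (x ≡ a)) →
        (if does x≟a then h (a , a∉I) else (if does x≟a then y else h (x , p))) ≡ h (x , p)
      by (yes refl) = cong (λ r → h (x , r)) (T-irrelevant a∉I p)
      by (no  _)    = refl

  resample : Fin L → G.V → Fin L
  resample x y = encode E-outer G.V↔Fin (update (extension x) y)

  root-resample : ∀ x y → root (resample x y) ≡ y
  root-resample x y = trans (decode-encode E-outer G.V↔Fin (update (extension x) y) (a , a∉I)) (update-root (extension x) y)

  resample-root : ∀ x y → resample (resample x y) (root x) ≡ x
  resample-root x y = begin
    encode E-outer G.V↔Fin (update (extension (resample x y)) (root x))
      ≡⟨ encode-cong E-outer G.V↔Fin (λ z → trans (update-cong (decode-encode E-outer G.V↔Fin (update (extension x) y)) (root x) z) (update-update (extension x) y z)) ⟩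
    encode E-outer G.V↔Fin (extension x)
      ≡⟨ encode-decode E-outer G.V↔Fin x ⟩
    x ∎
    where open ≡-Reasoning

  -- Sending (`x`, `y`) to (`resample x y`, `root x`) is invertible by the same rule, so it permutes
  -- the pairs of an extension and a vertex.
  ∑-resample : (f : Fin L → ℕ) → N * ∑ (Fin↔ L) f ≡ ∑ G.V↔Fin (λ y → ∑ (Fin↔ L) (λ x → f (resample x y)))
  ∑-resample f = begin
    N * ∑ (Fin↔ L) f                            ≡⟨ ∑-*ˡ (Fin↔ L) N f ⟨
    ∑ (Fin↔ L) (λ x → N * f x)                  ≡⟨ ∑-cong (Fin↔ L) (λ x → sym (∑-const G.V↔Fin (f x))) ⟩
    ∑ (Fin↔ L) (λ x → ∑ G.V↔Fin (λ _ → f x))    ≡⟨ ∑-× (Fin↔ L) G.V↔Fin LV (f ∘ proj₁) ⟨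
    ∑ LV (f ∘ proj₁)                            ≡⟨ ∑-↔ VL LV swap (f ∘ proj₁) ⟨
    ∑ VL (λ (y , x) → f (resample x y))         ≡⟨ ∑-× G.V↔Fin (Fin↔ L) VL (λ (y , x) → f (resample x y)) ⟩
    ∑ G.V↔Fin (λ y → ∑ (Fin↔ L) (λ x → f (resample x y))) ∎
    where
    open ≡-Reasoning
    LV : (Fin L × G.V) ↔ Fin (L * N)
    LV = ↔-sym Fin.*↔× ↔-∘ (Fin↔ L ×-↔ G.V↔Fin)
    VL : (G.V × Fin L) ↔ Fin (N * L)
    VL = ↔-sym Fin.*↔× ↔-∘ (G.V↔Fin ×-↔ Fin↔ L)
    swap : (G.V × Fin L) ↔ (Fin L × G.V)
    swap = mk↔ₛ′ (λ (y , x) → resample x y , root x) (λ (x , y) → root x , resample x y)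
      (λ (x , y) → cong₂ _,_ (resample-root x y) (root-resample x y))
      (λ (y , x) → cong₂ _,_ (root-resample x y) (resample-root x y))

  ∑-resample-root : (f : Fin L → ℕ) (h : G.V → ℕ) →
    N * ∑ (Fin↔ L) (λ x → f x * h (root x)) ≡ ∑ G.V↔Fin (λ y → ∑ (Fin↔ L) (λ x → f (resample x y)) * h y)
  ∑-resample-root f h = trans (∑-resample _) (∑-cong G.V↔Fin (λ y →
    trans (∑-cong (Fin↔ L) (λ x → cong (λ z → f (resample x y) * h z) (root-resample x y))) (∑-*ʳ (Fin↔ L) (h y) _)))

  module _ (g : Fin (N ^ i)) (S : Subset (Fibre g)) where

    private
      indicator : Fin L → ℕ
      indicator = extend (valid g) (χ ∘ S)

    -- This is `N` times the number of elements of `S` with root `y`, because each of them arises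
    -- from `N` extensions by resampling. The extra factor makes `L` the natural upper bound and
    -- keeps the exponent k - 1 out of the formulas.
    section : G.V → ℕ
    section y = ∑ (Fin↔ L) (λ x → indicator (resample x y))

    section≤ : ∀ y → section y ℕ.≤ L
    section≤ y = ℕ.≤-trans (∑-mono (Fin↔ L) (λ x → indicator≤1 (valid g (resample x y)) _ (λ _ → refl)))
      (ℕ.≤-reflexive (trans (∑-const (Fin↔ L) 1) (ℕ.*-identityʳ L)))
      where
      indicator≤1 : ∀ b (s : T b → Bool) {f : T b → ℕ} → (∀ p → f p ≡ χ (s p)) → whenT b f ℕ.≤ 1
      indicator≤1 false s f≡χ = ℕ.z≤n
      indicator≤1 true  s f≡χ rewrite f≡χ tt with s tt
      ... | true  = ℕ.≤-refl
      ... | false = ℕ.z≤n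

    ∑-section : N * ∑ (E-fibre g) (χ ∘ S) ≡ ∑ G.V↔Fin section
    ∑-section = trans (cong (N *_) (∑-subset (Fin↔ L) (valid g) (E-fibre g) (χ ∘ S))) (∑-resample indicator)

    ∑-section-root : (h : G.V → ℕ) →
      N * ∑ (E-fibre g) (λ u → χ (S u) * h (root (proj₁ u))) ≡ ∑ G.V↔Fin (λ y → section y * h y)
    ∑-section-root h = begin
      N * ∑ (E-fibre g) (λ u → χ (S u) * h (root (proj₁ u)))
        ≡⟨ cong (N *_) (∑-subset (Fin↔ L) (valid g) (E-fibre g) _) ⟩
      N * ∑ (Fin↔ L) (extend (valid g) (λ u → χ (S u) * h (root (proj₁ u))))
        ≡⟨ cong (N *_) (∑-cong (Fin↔ L) (λ x → whenT-* (valid g x) _ (h (root x)))) ⟩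
      N * ∑ (Fin↔ L) (λ x → indicator x * h (root x))
        ≡⟨ ∑-resample-root indicator h ⟩
      ∑ G.V↔Fin (λ y → section y * h y) ∎
      where
      open ≡-Reasoning
      whenT-* : ∀ b (f : T b → ℕ) c → whenT b (λ p → f p * c) ≡ whenT b f * c
      whenT-* true  f c = refl
      whenT-* false f c = refl

    -- Adjacency in the fibre graph depends on roots only, so the sum over pairs from `S` can be
    -- grouped by roots, at the price of one factor `N` for each endpoint.
    fibre-edges : ∀ nz → N * (N * (2 * Graph.e[_] (pullback G (E-fibre g) (root ∘ proj₁) nz) S)) ≡
      ∑ G.V↔Fin (λ y → section y * ∑ G.V↔Fin (λ z → section z * adj G y z))
    fibre-edges nz = begin
      N * (N * (2 * Graph.e[_] (pullback G (E-fibre g) (root ∘ proj₁) nz) S))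
        ≡⟨ cong (λ z → N * (N * z)) (e-double (pullback G (E-fibre g) (root ∘ proj₁) nz) S) ⟩
      N * (N * ∑ F (λ u → ∑ F (λ w → χ (S u) * χ (S w) * adj G (π u) (π w))))
        ≡⟨ cong (N *_) (∑-*ˡ F N _) ⟨
      N * ∑ F (λ u → N * ∑ F (λ w → χ (S u) * χ (S w) * adj G (π u) (π w)))
        ≡⟨ cong (N *_) (∑-cong F inner) ⟩
      N * ∑ F (λ u → χ (S u) * ∑ G.V↔Fin (λ z → section z * adj G (π u) z))
        ≡⟨ ∑-section-root (λ y → ∑ G.V↔Fin (λ z → section z * adj G y z)) ⟩
      ∑ G.V↔Fin (λ y → section y * ∑ G.V↔Fin (λ z → section z * adj G y z)) ∎
      where
      open ≡-Reasoning
      F = E-fibre g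
      π : Fibre g → G.V
      π = root ∘ proj₁
      inner : ∀ u → N * ∑ F (λ w → χ (S u) * χ (S w) * adj G (π u) (π w)) ≡
        χ (S u) * ∑ G.V↔Fin (λ z → section z * adj G (π u) z)
      inner u = begin
        N * ∑ F (λ w → χ (S u) * χ (S w) * adj G (π u) (π w))
          ≡⟨ cong (N *_) (trans (∑-cong F (λ w → ℕ.*-assoc (χ (S u)) _ _)) (∑-*ˡ F (χ (S u)) _)) ⟩
        N * (χ (S u) * ∑ F (λ w → χ (S w) * adj G (π u) (π w)))
          ≡⟨ x∙yz≈y∙xz N (χ (S u)) _ ⟩
        χ (S u) * (N * ∑ F (λ w → χ (S w) * adj G (π u) (π w)))
          ≡⟨ cong (χ (S u) *_) (∑-section-root (adj G (π u))) ⟩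
        χ (S u) * ∑ G.V↔Fin (λ z → section z * adj G (π u) z) ∎
        where open import Algebra.Properties.CommutativeSemigroup ℕ.*-commutativeSemigroup using (x∙yz≈y∙xz)

-- Ordered fields

module OrderedField {c ℓ₁ ℓ₂} (K : ArchimedeanOrderedField c ℓ₁ ℓ₂) where
  open ArchimedeanOrderedField K public
  open CommutativeRing commutativeRing public
    using (setoid; semiring; +-cong; +-congˡ; +-congʳ; *-cong; *-congˡ; *-congʳ; -‿cong;
           +-identityˡ; +-identityʳ; *-identityˡ; *-identityʳ; zeroˡ; zeroʳ; +-comm; *-comm; *-assoc)
    renaming (refl to ≈-refl; sym to ≈-sym; trans to ≈-trans; reflexive to ≈-reflexive)
  open IsDecTotalOrder isDecTotalOrder public using (total; ≤-respˡ-≈; ≤-respʳ-≈)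
    renaming (refl to ≤-refl; trans to ≤-trans; antisym to ≤-antisym; reflexive to ≤-reflexive)

  private
    module Ring = CommutativeRing commutativeRing
    open import Algebra.Properties.Semiring.Mult Ring.semiring using (×-homo-+; ×1-homo-*)
    open import Algebra.Properties.Ring Ring.ring using (-0#≈0#; -‿distribˡ-*; -‿distribʳ-*; -‿involutive)
    open import Relation.Binary.Reasoning.Setoid setoid

  fromℕ-+ : ∀ m n → fromℕ (m ℕ.+ n) ≈ fromℕ m + fromℕ n
  fromℕ-+ m n = ×-homo-+ 1# m n

  fromℕ-* : ∀ m n → fromℕ (m ℕ.* n) ≈ fromℕ m * fromℕ n
  fromℕ-* = ×1-homo-*

  module IntegerCoefficients where
    -- The canonical homomorphism from the integers. The solver computes with integer coefficients,
    -- whose equality is decidable, and interprets them here.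
    fromℤ : ℤ → Carrier
    fromℤ (ℤ.+ n)      = fromℕ n
    fromℤ (ℤ.-[1+ n ]) = - fromℕ (suc n)

    private
      cancel-suc : ∀ x y → (1# + x) - (1# + y) ≈ x - y
      cancel-suc x y = begin
        (1# + x) + - (1# + y)      ≈⟨ +-congˡ (⁻¹-∙-comm 1# y) ⟨
        (1# + x) + (- 1# + - y)    ≈⟨ +-congʳ (+-comm 1# x) ⟩
        (x + 1#) + (- 1# + - y)    ≈⟨ Ring.+-assoc x 1# _ ⟩
        x + (1# + (- 1# + - y))    ≈⟨ +-congˡ (Ring.+-assoc 1# (- 1#) (- y)) ⟨
        x + ((1# + - 1#) + - y)    ≈⟨ +-congˡ (+-congʳ (Ring.-‿inverseʳ 1#)) ⟩
        x + (0# + - y)             ≈⟨ +-congˡ (+-identityˡ (- y)) ⟩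
        x + - y                    ∎
        where open import Algebra.Properties.AbelianGroup Ring.+-abelianGroup using (⁻¹-∙-comm)

      fromℤ-⊖ : ∀ m n → fromℤ (m ℤ.⊖ n) ≈ fromℕ m - fromℕ n
      fromℤ-⊖ m       zero    = begin
        fromℕ m         ≈⟨ +-identityʳ _ ⟨
        fromℕ m + 0#    ≈⟨ +-congˡ -0#≈0# ⟨
        fromℕ m - 0#    ∎
      fromℤ-⊖ zero    (suc n) = ≈-sym (+-identityˡ _)
      fromℤ-⊖ (suc m) (suc n) = begin
        fromℤ (suc m ℤ.⊖ suc n)         ≡⟨ cong fromℤ (ℤ.[1+m]⊖[1+n]≡m⊖n m n) ⟩
        fromℤ (m ℤ.⊖ n)                 ≈⟨ fromℤ-⊖ m n ⟩
        fromℕ m - fromℕ n               ≈⟨ cancel-suc _ _ ⟨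
        fromℕ (suc m) - fromℕ (suc n)   ∎

      fromℤ-+ : ∀ x y → fromℤ (x ℤ.+ y) ≈ fromℤ x + fromℤ y
      fromℤ-+ (ℤ.+ m)      (ℤ.+ n)      = fromℕ-+ m n
      fromℤ-+ (ℤ.+ m)      (ℤ.-[1+ n ]) = fromℤ-⊖ m (suc n)
      fromℤ-+ (ℤ.-[1+ m ]) (ℤ.+ n)      = ≈-trans (fromℤ-⊖ n (suc m)) (+-comm _ _)
      fromℤ-+ (ℤ.-[1+ m ]) (ℤ.-[1+ n ]) = begin
        - fromℕ (suc (suc (m ℕ.+ n)))        ≡⟨ cong (λ k → - fromℕ (suc k)) (ℕ.+-suc m n) ⟨
        - fromℕ (suc m ℕ.+ suc n)            ≈⟨ -‿cong (fromℕ-+ (suc m) (suc n)) ⟩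
        - (fromℕ (suc m) + fromℕ (suc n))    ≈⟨ ⁻¹-∙-comm _ _ ⟨
        - fromℕ (suc m) - fromℕ (suc n)      ∎
        where open import Algebra.Properties.AbelianGroup Ring.+-abelianGroup using (⁻¹-∙-comm)

      fromℤ-◃- : ∀ n → fromℤ (Sign.- ℤ.◃ n) ≈ - fromℕ n
      fromℤ-◃- zero    = ≈-sym -0#≈0#
      fromℤ-◃- (suc n) = ≈-refl

      fromℤ-* : ∀ x y → fromℤ (x ℤ.* y) ≈ fromℤ x * fromℤ y
      fromℤ-* (ℤ.+ m)      (ℤ.+ n)      = ≈-trans (≈-reflexive (cong fromℤ (ℤ.+◃n≡+n (m ℕ.* n)))) (fromℕ-* m n)
      fromℤ-* (ℤ.+ m)      (ℤ.-[1+ n ]) = ≈-trans (fromℤ-◃- (m ℕ.* suc n))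
        (≈-trans (-‿cong (fromℕ-* m (suc n))) (-‿distribʳ-* _ _))
      fromℤ-* (ℤ.-[1+ m ]) (ℤ.+ n)      = ≈-trans (fromℤ-◃- (suc m ℕ.* n))
        (≈-trans (-‿cong (fromℕ-* (suc m) n)) (-‿distribˡ-* _ _))
      fromℤ-* (ℤ.-[1+ m ]) (ℤ.-[1+ n ]) = ≈-trans (fromℕ-* (suc m) (suc n)) (begin
        fromℕ (suc m) * fromℕ (suc n)           ≈⟨ -‿involutive _ ⟨
        - - (fromℕ (suc m) * fromℕ (suc n))     ≈⟨ -‿cong (-‿distribˡ-* _ _) ⟩
        - (- fromℕ (suc m) * fromℕ (suc n))     ≈⟨ -‿distribʳ-* _ _ ⟩
        - fromℕ (suc m) * - fromℕ (suc n)       ∎)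

      fromℤ-neg : ∀ x → fromℤ (ℤ.- x) ≈ - fromℤ x
      fromℤ-neg (ℤ.+ zero)   = ≈-sym -0#≈0#
      fromℤ-neg (ℤ.+ suc n)  = ≈-refl
      fromℤ-neg (ℤ.-[1+ n ]) = ≈-sym (-‿involutive _)

    -- fromℕ 1 is 1# + 0#; the solver should interpret the constant 1 as 1# itself.
    coefficient : ℤ → Carrier
    coefficient (ℤ.+ 1) = 1#
    coefficient x       = fromℤ x

    private
      coefficient≈ : ∀ x → coefficient x ≈ fromℤ x
      coefficient≈ (ℤ.+ 0)           = ≈-refl
      coefficient≈ (ℤ.+ 1)           = ≈-sym (+-identityʳ 1#)
      coefficient≈ (ℤ.+ suc (suc n)) = ≈-refl
      coefficient≈ (ℤ.-[1+ n ])      = ≈-refl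

    morphism : ℤ.+-*-rawRing -Raw-AlmostCommutative⟶ fromCommutativeRing commutativeRing
    morphism = record
      { ⟦_⟧    = coefficient
      ; +-homo = λ x y → ≈-trans (coefficient≈ (x ℤ.+ y)) (≈-trans (fromℤ-+ x y) (≈-sym (+-cong (coefficient≈ x) (coefficient≈ y))))
      ; *-homo = λ x y → ≈-trans (coefficient≈ (x ℤ.* y)) (≈-trans (fromℤ-* x y) (≈-sym (*-cong (coefficient≈ x) (coefficient≈ y))))
      ; -‿homo = λ x → ≈-trans (coefficient≈ (ℤ.- x)) (≈-trans (fromℤ-neg x) (≈-sym (-‿cong (coefficient≈ x))))
      ; 0-homo = ≈-refl
      ; 1-homo = ≈-refl
      }

    open import Algebra.Solver.Ring ℤ.+-*-rawRing (fromCommutativeRing commutativeRing) morphism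
      (λ x y → Maybe.map (λ x≡y → ≈-reflexive (cong coefficient x≡y)) (dec⇒maybe (x ℤ.≟ y))) public
      using (solve; _:=_; _:+_; _:*_; _:-_; :-_; _:^_; con; Polynomial)

  open IntegerCoefficients public using (solve; _:=_; _:+_; _:*_; _:-_; :-_; _:^_; con; Polynomial)

  :1 :0 :2 : ∀ {n} → Polynomial n
  :0 = con (ℤ.+ 0)
  :1 = con (ℤ.+ 1)
  :2 = con (ℤ.+ 2)

  private variable
    x y z w : Carrier

  -- The pattern of most inequalities below: the difference of the sides is exhibited as a visibly
  -- nonnegative `d`, and the identity is left to the solver.
  ≤-by : ∀ d → 0# ≤ d → y - x ≈ d → x ≤ y
  ≤-by {y} {x} d 0≤d y-x≈d = ≤-respˡ-≈ (+-identityʳ x) (≤-respʳ-≈ (begin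
    x + d         ≈⟨ +-congˡ y-x≈d ⟨
    x + (y - x)   ≈⟨ solve 2 (λ x y → x :+ (y :- x) := y) ≈-refl x y ⟩
    y             ∎) (+-monoʳ-≤ x 0≤d))

  ≤⇒0≤- : x ≤ y → 0# ≤ y - x
  ≤⇒0≤- {x} {y} x≤y = ≤-respˡ-≈ (≈-trans (+-comm (- x) x) (Ring.-‿inverseʳ x))
    (≤-respʳ-≈ (+-comm (- x) y) (+-monoʳ-≤ (- x) x≤y))

  0≤-⇒≤ : 0# ≤ y - x → x ≤ y
  0≤-⇒≤ 0≤y-x = ≤-by _ 0≤y-x ≈-refl

  +-mono-≤ : x ≤ y → z ≤ w → x + z ≤ y + w
  +-mono-≤ {x} {y} {z} {w} x≤y z≤w = ≤-trans (+-monoʳ-≤ x z≤w)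
    (≤-respˡ-≈ (+-comm w x) (≤-respʳ-≈ (+-comm w y) (+-monoʳ-≤ w x≤y)))

  +-nonneg : 0# ≤ x → 0# ≤ y → 0# ≤ x + y
  +-nonneg 0≤x 0≤y = ≤-respˡ-≈ (+-identityʳ 0#) (+-mono-≤ 0≤x 0≤y)

  *-monoˡ-≤ : 0# ≤ z → x ≤ y → z * x ≤ z * y
  *-monoˡ-≤ {z} {x} {y} 0≤z x≤y = ≤-by (z * (y - x)) (*-nonneg 0≤z (≤⇒0≤- x≤y))
    (solve 3 (λ x y z → z :* y :- z :* x := z :* (y :- x)) ≈-refl x y z)

  *-mono-≤ : 0# ≤ x → 0# ≤ w → x ≤ y → z ≤ w → x * z ≤ y * w
  *-mono-≤ {x} {w} {y} {z} 0≤x 0≤w x≤y z≤w = ≤-trans (*-monoˡ-≤ 0≤x z≤w)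
    (≤-respˡ-≈ (*-comm w x) (≤-respʳ-≈ (*-comm w y) (*-monoˡ-≤ 0≤w x≤y)))

  square-nonneg : ∀ x → 0# ≤ x * x
  square-nonneg x with total 0# x
  ... | inj₁ 0≤x = *-nonneg 0≤x 0≤x
  ... | inj₂ x≤0 = ≤-respʳ-≈ (solve 1 (λ x → (:0 :- x) :* (:0 :- x) := x :* x) ≈-refl x)
    (*-nonneg (≤⇒0≤- x≤0) (≤⇒0≤- x≤0))

  0≤1 : 0# ≤ 1#
  0≤1 = ≤-respʳ-≈ (*-identityʳ 1#) (square-nonneg 1#)

  fromℕ-nonneg : ∀ n → 0# ≤ fromℕ n
  fromℕ-nonneg zero    = ≤-refl
  fromℕ-nonneg (suc n) = +-nonneg 0≤1 (fromℕ-nonneg n)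

  fromℕ-mono : ∀ {m n} → m ℕ.≤ n → fromℕ m ≤ fromℕ n
  fromℕ-mono {n = n} ℕ.z≤n = fromℕ-nonneg n
  fromℕ-mono (ℕ.s≤s m≤n)   = +-monoʳ-≤ 1# (fromℕ-mono m≤n)

  <⇒≤ : x < y → x ≤ y
  <⇒≤ = proj₁

  ≤-<-trans : x ≤ y → y < z → x < z
  ≤-<-trans x≤y (y≤z , y≉z) = ≤-trans x≤y y≤z ,
    λ x≈z → y≉z (≤-antisym y≤z (≤-respˡ-≈ x≈z x≤y))

  <-≤-trans : x < y → y ≤ z → x < z
  <-≤-trans (x≤y , x≉y) y≤z = ≤-trans x≤y y≤z ,
    λ x≈z → x≉y (≤-antisym x≤y (≤-respʳ-≈ (≈-sym x≈z) y≤z))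

  <-irrefl : ¬ (x < x)
  <-irrefl (_ , x≉x) = x≉x ≈-refl

  <⇒≱ : x < y → ¬ (y ≤ x)
  <⇒≱ x<y y≤x = <-irrefl (<-≤-trans x<y y≤x)

  ≰⇒> : ¬ (x ≤ y) → y < x
  ≰⇒> {x} {y} x≰y with total x y
  ... | inj₁ x≤y = contradiction x≤y x≰y
  ... | inj₂ y≤x = y≤x , λ y≈x → x≰y (≤-reflexive (≈-sym y≈x))

  <-resp : x ≈ y → z ≈ w → x < z → y < w
  <-resp x≈y z≈w x<z = ≤-<-trans (≤-reflexive (≈-sym x≈y)) (<-≤-trans x<z (≤-reflexive z≈w))

  0<- : x < y → 0# < y - x
  0<- {x} {y} (x≤y , x≉y) = ≤⇒0≤- x≤y , λ 0≈y-x → x≉y (begin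
    x              ≈⟨ +-identityʳ x ⟨
    x + 0#         ≈⟨ +-congˡ 0≈y-x ⟩
    x + (y - x)    ≈⟨ solve 2 (λ x y → x :+ (y :- x) := y) ≈-refl x y ⟩
    y              ∎)

  <-by : ∀ d → 0# < d → y - x ≈ d → x < y
  <-by {y} {x} d (0≤d , 0≉d) y-x≈d = ≤-by d 0≤d y-x≈d , λ x≈y → 0≉d (begin
    0#       ≈⟨ Ring.-‿inverseʳ x ⟨
    x - x    ≈⟨ +-congʳ x≈y ⟩
    y - x    ≈⟨ y-x≈d ⟩
    d        ∎)

  0<1 : 0# < 1#
  0<1 = 0≤1 , 0≉1

  +-pos : 0# < x → 0# ≤ y → 0# < x + y
  +-pos 0<x 0≤y = <-≤-trans 0<x (≤-respˡ-≈ (+-identityʳ _) (+-monoʳ-≤ _ 0≤y))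

  private
    *-cancel-0 : ¬ (x ≈ 0#) → x * y ≈ 0# → y ≈ 0#
    *-cancel-0 {x} {y} x≉0 xy≈0 = begin
      y                 ≈⟨ *-identityˡ y ⟨
      1# * y            ≈⟨ *-congʳ (⁻¹-inverseʳ x x≉0) ⟨
      x * x ⁻¹ * y      ≈⟨ solve 3 (λ x i y → x :* i :* y := i :* (x :* y)) ≈-refl x (x ⁻¹) y ⟩
      x ⁻¹ * (x * y)    ≈⟨ *-congˡ xy≈0 ⟩
      x ⁻¹ * 0#         ≈⟨ zeroʳ _ ⟩
      0#                ∎

  *-pos : 0# < x → 0# < y → 0# < x * y
  *-pos (0≤x , 0≉x) (0≤y , 0≉y) = *-nonneg 0≤x 0≤y , λ 0≈xy → 0≉y (≈-sym (*-cancel-0 (0≉x ∘ ≈-sym) (≈-sym 0≈xy)))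

  ^-pos : 0# < x → ∀ n → 0# < x ^ n
  ^-pos 0<x zero    = 0<1
  ^-pos 0<x (suc n) = *-pos 0<x (^-pos 0<x n)

  ^-nonneg : 0# ≤ x → ∀ n → 0# ≤ x ^ n
  ^-nonneg 0≤x zero    = 0≤1
  ^-nonneg 0≤x (suc n) = *-nonneg 0≤x (^-nonneg 0≤x n)

  ^-mono : 0# ≤ x → x ≤ y → ∀ n → x ^ n ≤ y ^ n
  ^-mono 0≤x x≤y zero    = ≤-refl
  ^-mono 0≤x x≤y (suc n) = *-mono-≤ 0≤x (^-nonneg (≤-trans 0≤x x≤y) n) x≤y (^-mono 0≤x x≤y n)

  ^-≤1 : 0# ≤ x → x ≤ 1# → ∀ n → x ^ n ≤ 1#
  ^-≤1 0≤x x≤1 zero    = ≤-refl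
  ^-≤1 0≤x x≤1 (suc n) = ≤-respʳ-≈ (*-identityʳ 1#) (*-mono-≤ 0≤x 0≤1 x≤1 (^-≤1 0≤x x≤1 n))

  fromℕ-pos : ∀ n → .{{NonZero n}} → 0# < fromℕ n
  fromℕ-pos (suc n) = +-pos 0<1 (fromℕ-nonneg n)

  ⁻¹-inverse : 0# < x → x * x ⁻¹ ≈ 1#
  ⁻¹-inverse (_ , 0≉x) = ⁻¹-inverseʳ _ (0≉x ∘ ≈-sym)

  -- Otherwise x · (0 - x⁻¹) = 0 - 1 would be nonnegative.
  ⁻¹-pos : 0# < x → 0# < x ⁻¹
  ⁻¹-pos {x} 0<x = ≰⇒> λ x⁻¹≤0 → <⇒≱ 0<1 (≤-by (x * (0# - x ⁻¹)) (*-nonneg (<⇒≤ 0<x) (≤⇒0≤- x⁻¹≤0)) (begin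
    0# - 1#            ≈⟨ +-congˡ (-‿cong (⁻¹-inverse 0<x)) ⟨
    0# - x * x ⁻¹      ≈⟨ solve 2 (λ x i → :0 :- x :* i := x :* (:0 :- i)) ≈-refl x (x ⁻¹) ⟩
    x * (0# - x ⁻¹)    ∎))

  ⁻¹-unique : 0# < x → x * y ≈ 1# → y ≈ x ⁻¹
  ⁻¹-unique {x} {y} 0<x xy≈1 = begin
    y                 ≈⟨ *-identityˡ y ⟨
    1# * y            ≈⟨ *-congʳ (⁻¹-inverse 0<x) ⟨
    x * x ⁻¹ * y      ≈⟨ solve 3 (λ x i y → x :* i :* y := i :* (x :* y)) ≈-refl x (x ⁻¹) y ⟩
    x ⁻¹ * (x * y)    ≈⟨ *-congˡ xy≈1 ⟩
    x ⁻¹ * 1#         ≈⟨ *-identityʳ _ ⟩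
    x ⁻¹              ∎

  *-cancelˡ-≤ : 0# < z → z * x ≤ z * y → x ≤ y
  *-cancelˡ-≤ {z} {x} {y} 0<z zx≤zy = ≤-respˡ-≈ (cancel x) (≤-respʳ-≈ (cancel y) (*-monoˡ-≤ (<⇒≤ (⁻¹-pos 0<z)) zx≤zy))
    where
    cancel : ∀ x → z ⁻¹ * (z * x) ≈ x
    cancel x = begin
      z ⁻¹ * (z * x)    ≈⟨ solve 3 (λ z i x → i :* (z :* x) := z :* i :* x) ≈-refl z (z ⁻¹) x ⟩
      z * z ⁻¹ * x      ≈⟨ *-congʳ (⁻¹-inverse 0<z) ⟩
      1# * x            ≈⟨ *-identityˡ x ⟩
      x                 ∎

  lowerBound : 0# < x → 0# < y → ∃[ m ] 0# < m × m ≤ x × m ≤ y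
  lowerBound {x} {y} 0<x 0<y with total x y
  ... | inj₁ x≤y = x , 0<x , ≤-refl , x≤y
  ... | inj₂ y≤x = y , 0<y , y≤x , ≤-refl

  ^-cong : x ≈ y → ∀ n → x ^ n ≈ y ^ n
  ^-cong x≈y zero    = ≈-refl
  ^-cong x≈y (suc n) = *-cong x≈y (^-cong x≈y n)

  ^-distrib-* : ∀ x y n → (x * y) ^ n ≈ x ^ n * y ^ n
  ^-distrib-* x y zero    = ≈-sym (*-identityʳ 1#)
  ^-distrib-* x y (suc n) = ≈-trans (*-congˡ (^-distrib-* x y n))
    (solve 4 (λ x y a b → x :* y :* (a :* b) := x :* a :* (y :* b)) ≈-refl x y (x ^ n) (y ^ n))

  ^-+ : ∀ x m n → x ^ (m ℕ.+ n) ≈ x ^ m * x ^ n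
  ^-+ x zero    n = ≈-sym (*-identityˡ _)
  ^-+ x (suc m) n = ≈-trans (*-congˡ (^-+ x m n)) (≈-sym (*-assoc _ _ _))

  ^-*ℕ : ∀ x m n → x ^ (m ℕ.* n) ≈ (x ^ n) ^ m
  ^-*ℕ x zero    n = ≈-refl
  ^-*ℕ x (suc m) n = ≈-trans (^-+ x n (m ℕ.* n)) (*-congˡ (^-*ℕ x m n))

  1^ : ∀ n → 1# ^ n ≈ 1#
  1^ zero    = ≈-refl
  1^ (suc n) = ≈-trans (*-identityˡ _) (1^ n)

  fromℕ-^ : ∀ m n → fromℕ (m ℕ.^ n) ≈ fromℕ m ^ n
  fromℕ-^ m zero    = +-identityʳ 1#
  fromℕ-^ m (suc n) = ≈-trans (fromℕ-* m (m ℕ.^ n)) (*-congˡ (fromℕ-^ m n))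

  private module KSum = SemiringSum semiring

  opaque
    ∑ᴷ : ∀ {n} → (Fin n → Carrier) → Carrier
    ∑ᴷ f = KSum.sum f

    ∑ᴷ-empty : (f : Fin 0 → Carrier) → ∑ᴷ f ≈ 0#
    ∑ᴷ-empty f = ≈-refl

    ∑ᴷ-suc : ∀ {n} (f : Fin (suc n) → Carrier) → ∑ᴷ f ≈ f Fin.zero + ∑ᴷ (f ∘ Fin.suc)
    ∑ᴷ-suc f = ≈-refl

    ∑ᴷ-cong : ∀ {n} {f g : Fin n → Carrier} → (∀ i → f i ≈ g i) → ∑ᴷ f ≈ ∑ᴷ g
    ∑ᴷ-cong = KSum.sum-cong-≋

    ∑ᴷ-+ : ∀ {n} (f g : Fin n → Carrier) → ∑ᴷ (λ i → f i + g i) ≈ ∑ᴷ f + ∑ᴷ g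
    ∑ᴷ-+ = KSum.∑-distrib-+

    ∑ᴷ-*ˡ : ∀ {n} x (f : Fin n → Carrier) → ∑ᴷ (λ i → x * f i) ≈ x * ∑ᴷ f
    ∑ᴷ-*ˡ x f = ≈-sym (KSum.*-distribˡ-sum x f)

    ∑ᴷ-*ʳ : ∀ {n} x (f : Fin n → Carrier) → ∑ᴷ (λ i → f i * x) ≈ ∑ᴷ f * x
    ∑ᴷ-*ʳ x f = ≈-sym (KSum.*-distribʳ-sum x f)

    private
      fromℕ-sum : ∀ {n} (f : Fin n → ℕ) → fromℕ (ℕ-Sum.sum f) ≈ KSum.sum (fromℕ ∘ f)
      fromℕ-sum {zero}  f = ≈-refl
      fromℕ-sum {suc n} f = ≈-trans (fromℕ-+ (f Fin.zero) (ℕ-Sum.sum (f ∘ Fin.suc))) (+-congˡ (fromℕ-sum (f ∘ Fin.suc)))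

  opaque
    unfolding ∑ᴷ FiniteSums.∑

    fromℕ-∑ : ∀ {A : Set} {n} (E : A ↔ Fin n) (f : A → ℕ) →
      fromℕ (FiniteSums.∑ E f) ≈ ∑ᴷ (λ i → fromℕ (f (Inverse.from E i)))
    fromℕ-∑ E f = fromℕ-sum (f ∘ Inverse.from E)

  ∑ᴷ-const : ∀ n x → ∑ᴷ {n} (λ _ → x) ≈ fromℕ n * x
  ∑ᴷ-const zero    x = ≈-trans (∑ᴷ-empty _) (≈-sym (zeroˡ x))
  ∑ᴷ-const (suc n) x = ≈-trans (∑ᴷ-suc _) (≈-trans (+-congˡ (∑ᴷ-const n x))
    (solve 2 (λ x n → x :+ n :* x := (:1 :+ n) :* x) ≈-refl x (fromℕ n)))

  ∑ᴷ-mono : ∀ {n} {f g : Fin n → Carrier} → (∀ i → f i ≤ g i) → ∑ᴷ f ≤ ∑ᴷ g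
  ∑ᴷ-mono {zero}  f≤g = ≤-reflexive (≈-trans (∑ᴷ-empty _) (≈-sym (∑ᴷ-empty _)))
  ∑ᴷ-mono {suc n} f≤g = ≤-respˡ-≈ (≈-sym (∑ᴷ-suc _)) (≤-respʳ-≈ (≈-sym (∑ᴷ-suc _))
    (+-mono-≤ (f≤g Fin.zero) (∑ᴷ-mono (f≤g ∘ Fin.suc))))

  χᴷ : Bool → Carrier
  χᴷ b = fromℕ (FiniteSums.χ b)

  -- Quadratic forms without square terms on the cube

  module MultiAffine where

    quadratic : ∀ {n} → Carrier → (Fin n → Carrier) → (Fin n → Fin n → Carrier) → (Fin n → Carrier) → Carrier
    quadratic c l b w = c + ∑ᴷ (λ i → l i * w i) + ∑ᴷ (λ i → w i * ∑ᴷ (λ j → w j * b i j))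

    private
      tail₂ : ∀ {n} → (Fin (suc n) → Fin (suc n) → Carrier) → Fin n → Fin n → Carrier
      tail₂ b i j = b (Fin.suc i) (Fin.suc j)

      -- Fixing the first coordinate at `z` turns its products with the other coordinates into
      -- linear terms; `b` is not assumed symmetric, so both orders contribute.
      linear : ∀ {n} → (Fin (suc n) → Carrier) → (Fin (suc n) → Fin (suc n) → Carrier) → Carrier → Fin n → Carrier
      linear l b z i = l (Fin.suc i) + z * (b Fin.zero (Fin.suc i) + b (Fin.suc i) Fin.zero)

      module _ {n} (c : Carrier) (l : Fin (suc n) → Carrier) (b : Fin (suc n) → Fin (suc n) → Carrier) where

        slope : (Fin n → Carrier) → Carrier
        slope u = l Fin.zero + ∑ᴷ (λ i → (b Fin.zero (Fin.suc i) + b (Fin.suc i) Fin.zero) * u i)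

        affine : ∀ z u → quadratic (c + z * l Fin.zero) (linear l b z) (tail₂ b) u ≈
          quadratic c (l ∘ Fin.suc) (tail₂ b) u + z * slope u
        affine z u = begin
          c + z * l Fin.zero + ∑ᴷ (λ i → linear l b z i * u i) + Q
            ≈⟨ +-congʳ (+-congˡ (≈-trans (∑ᴷ-cong (λ i →
                 solve 4 (λ l z s u → (l :+ z :* s) :* u := l :* u :+ z :* (s :* u)) ≈-refl _ z _ (u i)))
                 (≈-trans (∑ᴷ-+ _ _) (+-congˡ (∑ᴷ-*ˡ z _))))) ⟩
          c + z * l Fin.zero + (∑ᴷ (λ i → l (Fin.suc i) * u i) + z * ∑ᴷ (λ i → (b Fin.zero (Fin.suc i) + b (Fin.suc i) Fin.zero) * u i)) + Q
            ≈⟨ solve 6 (λ c z l s t q → c :+ z :* l :+ (s :+ z :* t) :+ q := c :+ s :+ q :+ z :* (l :+ t)) ≈-refl c z _ _ _ Q ⟩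
          quadratic c (l ∘ Fin.suc) (tail₂ b) u + z * slope u ∎
          where Q = ∑ᴷ (λ i → u i * ∑ᴷ (λ j → u j * b (Fin.suc i) (Fin.suc j)))

        -- The vanishing diagonal entry removes the square of the first coordinate, the only term
        -- that `affine` could not express.
        restrict : b Fin.zero Fin.zero ≈ 0# → ∀ w → quadratic c l b w ≈
          quadratic (c + w Fin.zero * l Fin.zero) (linear l b (w Fin.zero)) (tail₂ b) (w ∘ Fin.suc)
        restrict b₀₀≈0 w = begin
          c + ∑ᴷ (λ i → l i * w i) + ∑ᴷ (λ i → w i * ∑ᴷ (λ j → w j * b i j))
            ≈⟨ +-cong (+-congˡ (∑ᴷ-suc _)) (≈-trans (∑ᴷ-suc _) (+-cong (*-congˡ first) rest)) ⟩
          c + (l Fin.zero * w₀ + ∑ᴷ (λ i → l (Fin.suc i) * w₊ i)) + (w₀ * S₂ + (w₀ * S₃ + Q))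
            ≈⟨ solve 7 (λ c l w₀ s p q r → c :+ (l :* w₀ :+ s) :+ (w₀ :* p :+ (w₀ :* q :+ r)) := c :+ s :+ r :+ w₀ :* (l :+ (p :+ q))) ≈-refl c _ w₀ _ S₂ S₃ Q ⟩
          quadratic c (l ∘ Fin.suc) (tail₂ b) w₊ + w₀ * (l Fin.zero + (S₂ + S₃))
            ≈⟨ +-congˡ (*-congˡ (+-congˡ (≈-trans (≈-sym (∑ᴷ-+ _ _)) (∑ᴷ-cong (λ i →
                 solve 3 (λ w₊ p q → w₊ :* p :+ w₊ :* q := (p :+ q) :* w₊) ≈-refl (w₊ i) _ _))))) ⟩
          quadratic c (l ∘ Fin.suc) (tail₂ b) w₊ + w₀ * slope w₊
            ≈⟨ affine w₀ w₊ ⟨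
          _ ∎
          where
          w₀ = w Fin.zero
          w₊ = w ∘ Fin.suc
          S₂ = ∑ᴷ (λ j → w₊ j * b Fin.zero (Fin.suc j))
          S₃ = ∑ᴷ (λ i → w₊ i * b (Fin.suc i) Fin.zero)
          Q = ∑ᴷ (λ i → w₊ i * ∑ᴷ (λ j → w₊ j * b (Fin.suc i) (Fin.suc j)))
          first : ∑ᴷ (λ j → w j * b Fin.zero j) ≈ S₂
          first = ≈-trans (∑ᴷ-suc _) (≈-trans (+-congʳ (≈-trans (*-congˡ b₀₀≈0) (zeroʳ w₀))) (+-identityˡ S₂))
          rest : ∑ᴷ (λ i → w₊ i * ∑ᴷ (λ j → w j * b (Fin.suc i) j)) ≈ w₀ * S₃ + Q
          rest = ≈-trans (∑ᴷ-cong (λ i → ≈-trans (*-congˡ (∑ᴷ-suc _))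
              (solve 4 (λ w₊ w₀ b q → w₊ :* (w₀ :* b :+ q) := w₀ :* (w₊ :* b) :+ w₊ :* q) ≈-refl (w₊ i) w₀ _ _)))
            (≈-trans (∑ᴷ-+ _ _) (+-congʳ (∑ᴷ-*ˡ w₀ _)))

    -- With no square terms the form is affine in each variable, so its minimum over the cube is at a vertex.
    nonneg-on-cube : ∀ n c (l : Fin n → Carrier) b → (∀ i → b i i ≈ 0#) →
      (∀ (R : Fin n → Bool) → 0# ≤ quadratic c l b (χᴷ ∘ R)) →
      ∀ w → (∀ i → 0# ≤ w i) → (∀ i → w i ≤ 1#) → 0# ≤ quadratic c l b w
    nonneg-on-cube zero c l b diag vertices w 0≤w w≤1 =
      ≤-respʳ-≈ (+-cong (+-congˡ (≈-trans (∑ᴷ-empty _) (≈-sym (∑ᴷ-empty _)))) (≈-trans (∑ᴷ-empty _) (≈-sym (∑ᴷ-empty _))))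
        (vertices (λ _ → true))
    nonneg-on-cube (suc n) c l b diag vertices w 0≤w w≤1 =
      ≤-respʳ-≈ (≈-sym (≈-trans (restrict c l b (diag Fin.zero) w) (affine c l b w₀ w₊)))
        -- The value at `w₀` is the convex combination of the values at the ends 0 and 1, both
        -- nonnegative by induction.
        (≤-respʳ-≈ (solve 3 (λ α β w₀ → (:1 :- w₀) :* α :+ w₀ :* (α :+ β) := α :+ w₀ :* β) ≈-refl α β w₀)
          (+-nonneg (*-nonneg (≤⇒0≤- (w≤1 Fin.zero)) 0≤α) (*-nonneg (0≤w Fin.zero) 0≤α+β)))
      where
      w₀ = w Fin.zero
      w₊ = w ∘ Fin.suc
      α = quadratic c (l ∘ Fin.suc) (tail₂ b) w₊
      β = slope c l b w₊
      end : ∀ v → 0# ≤ α + χᴷ v * β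
      end v = ≤-respʳ-≈ (affine c l b (χᴷ v) w₊)
        (nonneg-on-cube n _ _ (tail₂ b) (diag ∘ Fin.suc)
          (λ R → ≤-respʳ-≈ (restrict c l b (diag Fin.zero) _) (vertices (λ { Fin.zero → v ; (Fin.suc i) → R i })))
          w₊ (0≤w ∘ Fin.suc) (w≤1 ∘ Fin.suc))
      0≤α : 0# ≤ α
      0≤α = ≤-respʳ-≈ (solve 2 (λ α β → α :+ :0 :* β := α) ≈-refl α β) (end false)
      0≤α+β : 0# ≤ α + β
      0≤α+β = ≤-respʳ-≈ (solve 2 (λ α β → α :+ (:1 :+ :0) :* β := α :+ β) ≈-refl α β) (end true)

-- Densities in the fibre graphs

module FibreDensity {c ℓ₁ ℓ₂} (K : ArchimedeanOrderedField c ℓ₁ ℓ₂) where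
  open OrderedField K
  open import Relation.Binary.Reasoning.Setoid setoid

  0<2 : 0# < fromℕ 2
  0<2 = fromℕ-pos 2

  -- Unfolds to the division by `fromℕ 2` in the density definitions, so `2*half` clears it there.
  half : Carrier → Carrier
  half x = x * fromℕ 2 ⁻¹

  2*half : ∀ x → fromℕ 2 * half x ≈ x
  2*half x = begin
    fromℕ 2 * (x * fromℕ 2 ⁻¹)   ≈⟨ solve 3 (λ a x i → a :* (x :* i) := a :* i :* x) ≈-refl (fromℕ 2) x (fromℕ 2 ⁻¹) ⟩
    fromℕ 2 * fromℕ 2 ⁻¹ * x     ≈⟨ *-congʳ (⁻¹-inverse 0<2) ⟩
    1# * x                       ≈⟨ *-identityˡ x ⟩
    x                            ∎

  half+half : ∀ x → half x + half x ≈ x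
  half+half x = ≈-trans (solve 1 (λ h → h :+ h := :2 :* h) ≈-refl (half x)) (2*half x)

  half-pos : ∀ {x} → 0# < x → 0# < half x
  half-pos 0<x = *-pos 0<x (⁻¹-pos 0<2)

  -- Doubling clears the division and leaves the quantity that `e-double` computes.
  LocallyDense⇒ : ∀ {p δ} G → LocallyDense K p δ G → ∀ S → δ * fromℕ (Graph.v G) ≤ fromℕ (Graph.∣_∣ G S) →
    p * (fromℕ (Graph.∣_∣ G S) * fromℕ (Graph.∣_∣ G S)) ≤ fromℕ (2 ℕ.* Graph.e[_] G S)
  LocallyDense⇒ {p} G ld S big = ≤-respˡ-≈ (2*half _ ⟨ ≈-trans ⟩ solve 2 (λ p s → p :* s :^ 2 := p :* (s :* s)) ≈-refl p _)
    (≤-respʳ-≈ (≈-sym (fromℕ-* 2 (Graph.e[_] G S))) (*-monoˡ-≤ (<⇒≤ 0<2) (ld S big)))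

  ⇒LocallyDense : ∀ {p δ} G → (∀ S → δ * fromℕ (Graph.v G) ≤ fromℕ (Graph.∣_∣ G S) →
    p * (fromℕ (Graph.∣_∣ G S) * fromℕ (Graph.∣_∣ G S)) ≤ fromℕ (2 ℕ.* Graph.e[_] G S)) → LocallyDense K p δ G
  ⇒LocallyDense {p} G ld S big = *-cancelˡ-≤ 0<2
    (≤-respˡ-≈ (solve 2 (λ p s → p :* (s :* s) := p :* s :^ 2) ≈-refl p _ ⟨ ≈-trans ⟩ ≈-sym (2*half _))
      (≤-respʳ-≈ (fromℕ-* 2 (Graph.e[_] G S)) (ld S big)))

  module _ (G : Graph) where
    private module G = Graph G

    ∣∣-∑ᴷ : ∀ (R : Fin G.v → Bool) → fromℕ (Graph.∣_∣ G (R ∘ G.index)) ≈ ∑ᴷ (χᴷ ∘ R)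
    ∣∣-∑ᴷ R = begin
      fromℕ (Graph.∣_∣ G (R ∘ G.index))             ≡⟨ cong fromℕ (∣∣-∑ G _) ⟩
      fromℕ (∑ G.V↔Fin (χ ∘ R ∘ G.index))           ≈⟨ fromℕ-∑ G.V↔Fin _ ⟩
      ∑ᴷ (λ i → χᴷ (R (G.index (G.vertex i))))      ≈⟨ ∑ᴷ-cong (λ i → ≈-reflexive (cong (χᴷ ∘ R) (Inverse.strictlyInverseˡ G.V↔Fin i))) ⟩
      ∑ᴷ (χᴷ ∘ R)                                   ∎

    adjᴷ : Fin G.v → Fin G.v → Carrier
    adjᴷ i j = fromℕ (adj G (G.vertex i) (G.vertex j))

    -- The quadratic form of the adjacency matrix.
    form : (Fin G.v → Carrier) → Carrier
    form w = ∑ᴷ (λ i → w i * ∑ᴷ (λ j → w j * adjᴷ i j))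

    fromℕ-form : (f : G.V → ℕ) →
      fromℕ (∑ G.V↔Fin (λ y → f y ℕ.* ∑ G.V↔Fin (λ z → f z ℕ.* adj G y z))) ≈ form (fromℕ ∘ f ∘ G.vertex)
    fromℕ-form f = ≈-trans (fromℕ-∑ G.V↔Fin _) (∑ᴷ-cong (λ i → ≈-trans (fromℕ-* (f (G.vertex i)) _) (*-congˡ
      (≈-trans (fromℕ-∑ G.V↔Fin _) (∑ᴷ-cong (λ j → fromℕ-* (f (G.vertex j)) _))))))

    form-cong : ∀ {w w′} → (∀ i → w i ≈ w′ i) → form w ≈ form w′
    form-cong w≈w′ = ∑ᴷ-cong (λ i → *-cong (w≈w′ i) (∑ᴷ-cong (λ j → *-congʳ (w≈w′ j))))

    form-scale : ∀ w x → form (λ i → w i * x) ≈ form w * (x * x)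
    form-scale w x = begin
      ∑ᴷ (λ i → w i * x * ∑ᴷ (λ j → w j * x * adjᴷ i j))
        ≈⟨ ∑ᴷ-cong (λ i → *-congˡ (≈-trans (∑ᴷ-cong (λ j →
             solve 3 (λ w x a → w :* x :* a := w :* a :* x) ≈-refl (w j) x (adjᴷ i j))) (∑ᴷ-*ʳ x _))) ⟩
      ∑ᴷ (λ i → w i * x * (∑ᴷ (λ j → w j * adjᴷ i j) * x))
        ≈⟨ ∑ᴷ-cong (λ i → solve 3 (λ w x a → w :* x :* (a :* x) := w :* a :* (x :* x)) ≈-refl (w i) x _) ⟩
      ∑ᴷ (λ i → w i * ∑ᴷ (λ j → w j * adjᴷ i j) * (x * x))
        ≈⟨ ∑ᴷ-*ʳ (x * x) _ ⟩
      form w * (x * x) ∎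

    e-form : ∀ (R : Fin G.v → Bool) → fromℕ (2 ℕ.* Graph.e[_] G (R ∘ G.index)) ≈ form (χᴷ ∘ R)
    e-form R = begin
      fromℕ (2 ℕ.* Graph.e[_] G (R ∘ G.index))
        ≡⟨ cong fromℕ (trans (e-double G _) (∑-cong G.V↔Fin (λ y → trans
             (∑-cong G.V↔Fin (λ z → ℕ.*-assoc (χ (R (G.index y))) _ _)) (∑-*ˡ G.V↔Fin (χ (R (G.index y))) _)))) ⟩
      fromℕ (∑ G.V↔Fin (λ y → χ (R (G.index y)) ℕ.* ∑ G.V↔Fin (λ z → χ (R (G.index z)) ℕ.* adj G y z)))
        ≈⟨ fromℕ-form (χ ∘ R ∘ G.index) ⟩
      form (λ i → χᴷ (R (G.index (G.vertex i))))
        ≈⟨ form-cong (λ i → ≈-reflexive (cong (χᴷ ∘ R) (Inverse.strictlyInverseˡ G.V↔Fin i))) ⟩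
      form (χᴷ ∘ R) ∎

    -- For σ = ∑ w the function u ↦ form u − 2pσ∑u + pσ² has no square terms. At a 0/1 vector of a set R it
    -- is (2e(R) − p|R|²) + p(|R| − σ)² or 2e(R) + pσ(σ − 2|R|); one of these is nonnegative by inspection
    -- according to whether |R| ≥ δv(G) or not.
    weighted-density : ∀ {p δ} → 0# ≤ p → LocallyDense K p δ G →
      ∀ w → (∀ i → 0# ≤ w i) → (∀ i → w i ≤ 1#) → 0# ≤ ∑ᴷ w → δ * fromℕ G.v + δ * fromℕ G.v ≤ ∑ᴷ w →
      p * (∑ᴷ w * ∑ᴷ w) ≤ form w
    weighted-density {p} {δ} 0≤p ld w 0≤w w≤1 0≤σ 2δN≤σ = 0≤-⇒≤ (≤-respʳ-≈
      (≈-trans (quadratic≈ w) (solve 3 (λ p s e → p :* (s :* s) :+ (:- (p :* s :+ p :* s)) :* s :+ e := e :- p :* (s :* s)) ≈-refl p σ (form w)))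
      (MultiAffine.nonneg-on-cube G.v _ _ adjᴷ (λ i → ≈-reflexive (cong fromℕ (adj-irrefl G (G.vertex i)))) vertices w 0≤w w≤1))
      where
      σ = ∑ᴷ w
      m = - (p * σ + p * σ)

      quadratic≈ : ∀ u → MultiAffine.quadratic (p * (σ * σ)) (λ _ → m) adjᴷ u ≈ p * (σ * σ) + m * ∑ᴷ u + form u
      quadratic≈ u = +-congʳ (+-congˡ (∑ᴷ-*ˡ m u))

      at-set : ∀ r e₂ → 0# ≤ e₂ → (δ * fromℕ G.v ≤ r → p * (r * r) ≤ e₂) → 0# ≤ p * (σ * σ) + m * r + e₂
      at-set r e₂ 0≤e₂ dense with total (δ * fromℕ G.v) r
      ... | inj₁ large = ≤-respʳ-≈
        (solve 4 (λ p s r e → (e :- p :* (r :* r)) :+ p :* ((s :- r) :* (s :- r)) := p :* (s :* s) :+ (:- (p :* s :+ p :* s)) :* r :+ e) ≈-refl p σ r e₂)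
        (+-nonneg (≤⇒0≤- (dense large)) (*-nonneg 0≤p (square-nonneg (σ - r))))
      -- Here 2r ≤ 2δv(G) ≤ σ; this is what the doubled `δ` in the hypothesis on `∑ᴷ w` is for.
      ... | inj₂ small = ≤-respʳ-≈
        (solve 4 (λ p s r e → e :+ p :* s :* (s :- (r :+ r)) := p :* (s :* s) :+ (:- (p :* s :+ p :* s)) :* r :+ e) ≈-refl p σ r e₂)
        (+-nonneg 0≤e₂ (*-nonneg (*-nonneg 0≤p 0≤σ) (≤⇒0≤- (≤-trans (+-mono-≤ small small) 2δN≤σ))))

      vertices : ∀ R → 0# ≤ MultiAffine.quadratic (p * (σ * σ)) (λ _ → m) adjᴷ (χᴷ ∘ R)
      vertices R = ≤-respʳ-≈
        (≈-trans (+-cong (+-congˡ (*-congˡ (∣∣-∑ᴷ R))) (e-form R)) (≈-sym (quadratic≈ (χᴷ ∘ R))))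
        (at-set _ _ (fromℕ-nonneg (2 ℕ.* Graph.e[_] G (R ∘ G.index))) (LocallyDense⇒ G ld (R ∘ G.index)))

  -- Normalised counts and averages over the fibres

  module Transfer (H₁ : Graph) (I : Subset (Graph.V H₁)) (a : Graph.V H₁) (a∉I : a ∉ I) (G : Graph) where
    open Extensions H₁ I a a∉I G
    open Resampling H₁ I a a∉I G
    private
      module G = Graph G
      module H₁ = Graph H₁

    0<N : 0# < fromℕ N
    0<N = fromℕ-pos N {{G.nonempty}}

    0<N^ : ∀ m → 0# < fromℕ (N ℕ.^ m)
    0<N^ m = <-resp ≈-refl (≈-sym (fromℕ-^ N m)) (^-pos 0<N m)

    ℓ ν : Carrier
    ℓ = fromℕ L ⁻¹
    ν = fromℕ (N ℕ.^ i) ⁻¹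

    0<ℓ : 0# < ℓ
    0<ℓ = ⁻¹-pos (0<N^ k)

    -- The probability that a random extension of the map numbered `g` is a homomorphism.
    W : Fin (N ℕ.^ i) → Carrier
    W g = fromℕ (fibreSize g) * ℓ

    -- Measured against all tuples of extensions, not against tuples from the fibre. Hence it
    -- averages to the density of the product (`t-⋉`), and differs from the density in the fibre
    -- graph by a power of `W g` (`F≈`).
    F : Graph → Fin (N ℕ.^ i) → Carrier
    F H g = fromℕ (fibreHoms H g) * ℓ ^ Graph.v H

    scaled≤1 : ∀ {m} → m ℕ.≤ L → fromℕ m * ℓ ≤ 1#
    scaled≤1 {m} m≤L = ≤-respʳ-≈ (⁻¹-inverse (0<N^ k))
      (*-mono-≤ (fromℕ-nonneg m) (<⇒≤ 0<ℓ) (fromℕ-mono m≤L) ≤-refl)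

    0≤W : ∀ g → 0# ≤ W g
    0≤W g = *-nonneg (fromℕ-nonneg (fibreSize g)) (<⇒≤ 0<ℓ)

    W≤1 : ∀ g → W g ≤ 1#
    W≤1 g = scaled≤1 (ℕ.≤-trans (ℕ.≤-reflexive (fibreSize-∑ g)) (ℕ.≤-trans (∑-mono (Fin↔ L) (λ x → χ≤1 (valid g x)))
      (ℕ.≤-reflexive (trans (∑-const (Fin↔ L) 1) (ℕ.*-identityʳ L)))))

    0≤F : ∀ H g → 0# ≤ F H g
    0≤F H g = *-nonneg (fromℕ-nonneg (fibreHoms H g)) (^-nonneg (<⇒≤ 0<ℓ) (Graph.v H))

    F≤W^ : ∀ H g → F H g ≤ W g ^ Graph.v H
    F≤W^ H g = ≤-respʳ-≈ (≈-sym (≈-trans (^-distrib-* _ ℓ (Graph.v H)) (*-congʳ (≈-sym (fromℕ-^ (fibreSize g) (Graph.v H))))))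
      (*-mono-≤ (fromℕ-nonneg (fibreHoms H g)) (^-nonneg (<⇒≤ 0<ℓ) (Graph.v H)) (fromℕ-mono (homsVia-≤ G (E-fibre g) (root ∘ proj₁) H)) ≤-refl)

    fibreGraph : ∀ g → NonZero (fibreSize g) → Graph
    fibreGraph g = pullback G (E-fibre g) (root ∘ proj₁)

    -- With the weights `section` / `L`, the total is `N * ℓ` times the size of `S` and the form is
    -- the square of that factor times twice the edges in `S`, so `weighted-density` gives the claim
    -- after cancellation. Its size condition holds as |S|/L ≥ δ′ · `W g` ≥ δ′η ≥ 2δ.
    fibre-dense : ∀ {p δ δ′ η} → 0# ≤ p → 0# ≤ δ′ → δ + δ ≤ δ′ * η → LocallyDense K p δ G →
      ∀ g → η ≤ W g → ∀ nz → LocallyDense K p δ′ (fibreGraph g nz)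
    fibre-dense {p} {δ} {δ′} {η} 0≤p 0≤δ′ 2δ≤δ′η ld g η≤W nz = ⇒LocallyDense (fibreGraph g nz) dense
      where
      dense : ∀ S → δ′ * fromℕ (fibreSize g) ≤ fromℕ (Graph.∣_∣ (fibreGraph g nz) S) →
        p * (fromℕ (Graph.∣_∣ (fibreGraph g nz) S) * fromℕ (Graph.∣_∣ (fibreGraph g nz) S)) ≤
        fromℕ (2 ℕ.* Graph.e[_] (fibreGraph g nz) S)
      dense S large = *-cancelˡ-≤ (*-pos 0<Nℓ 0<Nℓ) (≤-respˡ-≈
        (≈-trans (*-congˡ (*-cong σ≈ σ≈)) (solve 4 (λ p n s l → p :* (n :* s :* l :* (n :* s :* l)) := n :* l :* (n :* l) :* (p :* (s :* s))) ≈-refl p (fromℕ N) s ℓ))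
        (≤-respʳ-≈ form≈ (weighted-density G 0≤p ld w (λ j → *-nonneg (fromℕ-nonneg (section g S (G.vertex j))) (<⇒≤ 0<ℓ))
          (λ j → scaled≤1 (section≤ g S (G.vertex j))) 0≤σ 2δN≤σ)))
        where
        0<Nℓ : 0# < fromℕ N * ℓ
        0<Nℓ = *-pos 0<N 0<ℓ
        s = fromℕ (Graph.∣_∣ (fibreGraph g nz) S)
        e₂ = fromℕ (2 ℕ.* Graph.e[_] (fibreGraph g nz) S)
        w : Fin G.v → Carrier
        w j = fromℕ (section g S (G.vertex j)) * ℓ
        σ≈ : ∑ᴷ w ≈ fromℕ N * s * ℓ
        σ≈ = begin
          ∑ᴷ w                                                       ≈⟨ ∑ᴷ-*ʳ ℓ _ ⟩
          ∑ᴷ (λ j → fromℕ (section g S (G.vertex j))) * ℓ            ≈⟨ *-congʳ (fromℕ-∑ G.V↔Fin (section g S)) ⟨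
          fromℕ (∑ G.V↔Fin (section g S)) * ℓ                        ≡⟨ cong (λ z → fromℕ z * ℓ) (∑-section g S) ⟨
          fromℕ (N ℕ.* ∑ (E-fibre g) (χ ∘ S)) * ℓ                    ≡⟨ cong (λ z → fromℕ (N ℕ.* z) * ℓ) (∣∣-∑ (fibreGraph g nz) S) ⟨
          fromℕ (N ℕ.* Graph.∣_∣ (fibreGraph g nz) S) * ℓ            ≈⟨ *-congʳ (fromℕ-* N _) ⟩
          fromℕ N * s * ℓ                                            ∎
        form≈ : form G w ≈ fromℕ N * ℓ * (fromℕ N * ℓ) * e₂
        form≈ = begin
          form G w
            ≈⟨ form-scale G _ ℓ ⟩
          form G (λ j → fromℕ (section g S (G.vertex j))) * (ℓ * ℓ)
            ≈⟨ *-congʳ (fromℕ-form G (section g S)) ⟨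
          fromℕ (∑ G.V↔Fin (λ y → section g S y ℕ.* ∑ G.V↔Fin (λ z → section g S z ℕ.* adj G y z))) * (ℓ * ℓ)
            ≡⟨ cong (λ z → fromℕ z * (ℓ * ℓ)) (fibre-edges g S nz) ⟨
          fromℕ (N ℕ.* (N ℕ.* (2 ℕ.* Graph.e[_] (fibreGraph g nz) S))) * (ℓ * ℓ)
            ≈⟨ *-congʳ (≈-trans (fromℕ-* N _) (*-congˡ (fromℕ-* N _))) ⟩
          fromℕ N * (fromℕ N * e₂) * (ℓ * ℓ)
            ≈⟨ solve 3 (λ n l e → n :* (n :* e) :* (l :* l) := n :* l :* (n :* l) :* e) ≈-refl (fromℕ N) ℓ e₂ ⟩
          fromℕ N * ℓ * (fromℕ N * ℓ) * e₂ ∎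
        0≤σ : 0# ≤ ∑ᴷ w
        0≤σ = ≤-respʳ-≈ (≈-sym σ≈) (*-nonneg (*-nonneg (<⇒≤ 0<N) (fromℕ-nonneg (Graph.∣_∣ (fibreGraph g nz) S))) (<⇒≤ 0<ℓ))
        2δN≤σ : δ * fromℕ G.v + δ * fromℕ G.v ≤ ∑ᴷ w
        2δN≤σ = ≤-respˡ-≈ (solve 2 (λ n d → n :* (d :+ d) := d :* n :+ d :* n) ≈-refl (fromℕ N) δ)
          (≤-respʳ-≈ (≈-trans (solve 3 (λ n s l → n :* l :* s := n :* s :* l) ≈-refl (fromℕ N) s ℓ) (≈-sym σ≈))
            (≤-trans (*-monoˡ-≤ (<⇒≤ 0<N) (≤-trans 2δ≤δ′η (*-monoˡ-≤ 0≤δ′ η≤W)))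
              (≤-respˡ-≈ (solve 4 (λ n l d v → n :* l :* (d :* v) := n :* (d :* (v :* l))) ≈-refl (fromℕ N) ℓ δ′ _)
                (*-monoˡ-≤ (<⇒≤ 0<Nℓ) large))))

    fibre-nonempty : ∀ {η} → 0# < η → ∀ g → η ≤ W g → NonZero (fibreSize g)
    fibre-nonempty 0<η g η≤W = ℕ.≢-nonZero λ size≡0 → <⇒≱ 0<η (≤-trans η≤W
      (≤-reflexive (≈-trans (*-congʳ (≈-reflexive (cong fromℕ size≡0))) (zeroˡ ℓ))))

    F≈ : ∀ H g nz → F H g ≈ t K H (fibreGraph g nz) * W g ^ Graph.v H
    F≈ H g nz = begin
      fromℕ (fibreHoms H g) * ℓ ^ n                 ≡⟨ cong (λ z → fromℕ z * ℓ ^ n) (homsVia-pullback G (E-fibre g) (root ∘ proj₁) H nz) ⟩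
      h * ℓ ^ n                                     ≈⟨ *-congʳ (*-identityʳ h) ⟨
      h * 1# * ℓ ^ n                                ≈⟨ *-congʳ (*-congˡ (⁻¹-inverse 0<V^n)) ⟨
      h * (V^n * V^n ⁻¹) * ℓ ^ n                    ≈⟨ solve 4 (λ h v i l → h :* (v :* i) :* l := h :* i :* (v :* l)) ≈-refl h V^n (V^n ⁻¹) (ℓ ^ n) ⟩
      h * V^n ⁻¹ * (V^n * ℓ ^ n)                    ≈⟨ *-congˡ (*-congʳ (fromℕ-^ (fibreSize g) n)) ⟩
      h * V^n ⁻¹ * (fromℕ (fibreSize g) ^ n * ℓ ^ n) ≈⟨ *-congˡ (^-distrib-* _ ℓ n) ⟨
      t K H (fibreGraph g nz) * W g ^ n             ∎
      where
      n = Graph.v H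
      h = fromℕ (hom H (fibreGraph g nz))
      V^n = fromℕ (fibreSize g ℕ.^ n)
      0<V^n : 0# < V^n
      0<V^n = <-resp ≈-refl (≈-sym (fromℕ-^ (fibreSize g) n)) (^-pos (fromℕ-pos (fibreSize g) {{nz}}) n)

    average : (Fin (N ℕ.^ i) → Carrier) → Carrier
    average f = ν * ∑ᴷ f

    t-H₁ : t K H₁ G ≈ average W
    t-H₁ = begin
      fromℕ (hom H₁ G) * fromℕ (N ℕ.^ H₁.v) ⁻¹
        ≈⟨ *-cong (≈-trans (≈-reflexive (cong fromℕ hom-H₁)) (fromℕ-∑ (Fin↔ _) fibreSize)) (≈-sym (⁻¹-unique (0<N^ H₁.v) inverse)) ⟩
      ∑ᴷ (fromℕ ∘ fibreSize) * (ν * ℓ)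
        ≈⟨ solve 3 (λ s n l → s :* (n :* l) := n :* (s :* l)) ≈-refl _ ν ℓ ⟩
      ν * (∑ᴷ (fromℕ ∘ fibreSize) * ℓ)
        ≈⟨ *-congˡ (∑ᴷ-*ʳ ℓ _) ⟨
      average W ∎
      where
      inverse : fromℕ (N ℕ.^ H₁.v) * (ν * ℓ) ≈ 1#
      inverse = begin
        fromℕ (N ℕ.^ H₁.v) * (ν * ℓ)
          ≡⟨ cong (λ z → fromℕ z * (ν * ℓ)) (trans (cong (N ℕ.^_) (sym i+k≡v)) (ℕ.^-distribˡ-+-* N i k)) ⟩
        fromℕ (N ℕ.^ i ℕ.* L) * (ν * ℓ)
          ≈⟨ *-congʳ (fromℕ-* (N ℕ.^ i) L) ⟩
        fromℕ (N ℕ.^ i) * fromℕ L * (ν * ℓ)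
          ≈⟨ solve 4 (λ a b x y → a :* b :* (x :* y) := a :* x :* (b :* y)) ≈-refl (fromℕ (N ℕ.^ i)) (fromℕ L) ν ℓ ⟩
        fromℕ (N ℕ.^ i) * ν * (fromℕ L * ℓ)
          ≈⟨ *-cong (⁻¹-inverse (0<N^ i)) (⁻¹-inverse (0<N^ k)) ⟩
        1# * 1#
          ≈⟨ *-identityʳ 1# ⟩
        1# ∎

    t-⋉ : ∀ H₂ → t K (H₁ ⋉[ I , a ] H₂) G ≈ average (F H₂)
    t-⋉ H₂ = begin
      fromℕ (hom (H₁ ⋉[ I , a ] H₂) G) * fromℕ (N ℕ.^ (i ℕ.+ k ℕ.* n)) ⁻¹
        ≈⟨ *-cong (≈-trans (≈-reflexive (cong fromℕ (hom-⋉ H₂))) (fromℕ-∑ (Fin↔ _) (fibreHoms H₂))) (≈-sym (⁻¹-unique (0<N^ (i ℕ.+ k ℕ.* n)) inverse)) ⟩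
      ∑ᴷ (fromℕ ∘ fibreHoms H₂) * (ν * ℓ ^ n)
        ≈⟨ solve 3 (λ s n l → s :* (n :* l) := n :* (s :* l)) ≈-refl _ ν (ℓ ^ n) ⟩
      ν * (∑ᴷ (fromℕ ∘ fibreHoms H₂) * ℓ ^ n)
        ≈⟨ *-congˡ (∑ᴷ-*ʳ (ℓ ^ n) _) ⟨
      average (F H₂) ∎
      where
      n = Graph.v H₂
      inverse : fromℕ (N ℕ.^ (i ℕ.+ k ℕ.* n)) * (ν * ℓ ^ n) ≈ 1#
      inverse = begin
        fromℕ (N ℕ.^ (i ℕ.+ k ℕ.* n)) * (ν * ℓ ^ n)
          ≡⟨ cong (λ z → fromℕ z * (ν * ℓ ^ n)) (trans (ℕ.^-distribˡ-+-* N i (k ℕ.* n)) (cong (N ℕ.^ i ℕ.*_) (sym (ℕ.^-*-assoc N k n)))) ⟩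
        fromℕ (N ℕ.^ i ℕ.* L ℕ.^ n) * (ν * ℓ ^ n)
          ≈⟨ *-congʳ (≈-trans (fromℕ-* (N ℕ.^ i) (L ℕ.^ n)) (*-congˡ (fromℕ-^ L n))) ⟩
        fromℕ (N ℕ.^ i) * fromℕ L ^ n * (ν * ℓ ^ n)
          ≈⟨ solve 4 (λ a b x y → a :* b :* (x :* y) := a :* x :* (b :* y)) ≈-refl (fromℕ (N ℕ.^ i)) (fromℕ L ^ n) ν (ℓ ^ n) ⟩
        fromℕ (N ℕ.^ i) * ν * (fromℕ L ^ n * ℓ ^ n)
          ≈⟨ *-cong (⁻¹-inverse (0<N^ i)) (≈-trans (≈-sym (^-distrib-* _ ℓ n)) (≈-trans (^-cong (⁻¹-inverse (0<N^ k)) n) (1^ n))) ⟩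
        1# * 1#
          ≈⟨ *-identityʳ 1# ⟩
        1# ∎

    -- An average is monotone and fixes constants, so a pointwise affine bound passes to it. The
    -- slots `u` and `v` are meant for `W` and for `F` at `K₂`.
    average-linear : ∀ {f} x y z u v → (∀ g → x + y * u g + z * v g ≤ f g) →
      x + y * average u + z * average v ≤ average f
    average-linear {f} x y z u v bound = ≤-respˡ-≈ (begin
      ν * ∑ᴷ (λ g → x + y * u g + z * v g)
        ≈⟨ *-congˡ (≈-trans (∑ᴷ-+ _ _) (+-cong (≈-trans (∑ᴷ-+ _ _) (+-cong (∑ᴷ-const (N ℕ.^ i) x) (∑ᴷ-*ˡ y u))) (∑ᴷ-*ˡ z v))) ⟩
      ν * (M * x + y * ∑ᴷ u + z * ∑ᴷ v)
        ≈⟨ solve 7 (λ n m x y z u v → n :* (m :* x :+ y :* u :+ z :* v) := m :* n :* x :+ y :* (n :* u) :+ z :* (n :* v)) ≈-refl ν M x y z (∑ᴷ u) (∑ᴷ v) ⟩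
      M * ν * x + y * average u + z * average v
        ≈⟨ +-congʳ (+-congʳ (≈-trans (*-congʳ (⁻¹-inverse (0<N^ i))) (*-identityˡ x))) ⟩
      x + y * average u + z * average v ∎)
      (*-monoˡ-≤ (<⇒≤ (⁻¹-pos (0<N^ i))) (∑ᴷ-mono bound))
      where M = fromℕ (N ℕ.^ i)

-- The KNRS properties

module _ {c ℓ₁ ℓ₂} (K : ArchimedeanOrderedField c ℓ₁ ℓ₂) where
  open OrderedField K
  open FibreDensity K
  open import Relation.Binary.Reasoning.Setoid setoid

  private
    Unit : Carrier → Set _
    Unit = InUnitInterval K

  -- Small constants and tangent inequalities

  half<1 : half 1# < 1#
  half<1 = <-by (half 1#) (half-pos 0<1) (≈-trans (+-congʳ (≈-sym (half+half 1#)))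
    (solve 1 (λ h → h :+ h :- h := h) ≈-refl (half 1#)))

  half≤ : ∀ {x} → 0# ≤ x → half x ≤ x
  half≤ {x} 0≤x = ≤-by (half x) (*-nonneg 0≤x (<⇒≤ (⁻¹-pos 0<2))) (≈-trans (+-congʳ (≈-sym (half+half x)))
    (solve 1 (λ h → h :+ h :- h := h) ≈-refl (half x)))

  ≤half⇒Unit : ∀ {x} → 0# < x → x ≤ half 1# → Unit x
  ≤half⇒Unit 0<x x≤½ = 0<x , ≤-<-trans x≤½ half<1

  -- The witness x/(1 + A) satisfies y + Ay = x, so each summand is at most `x`; the added 1 covers
  -- A = 0.
  small : ∀ {A x} → 0# ≤ A → 0# < x → ∃[ y ] 0# < y × y ≤ x × A * y ≤ x
  small {A} {x} 0≤A 0<x = y , 0<y , y≤x , Ay≤x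
    where
    0<A+1 : 0# < 1# + A
    0<A+1 = +-pos 0<1 0≤A
    y = x * (1# + A) ⁻¹
    0<y = *-pos 0<x (⁻¹-pos 0<A+1)
    x≈ : y + A * y ≈ x
    x≈ = begin
      x * (1# + A) ⁻¹ + A * (x * (1# + A) ⁻¹)    ≈⟨ solve 3 (λ x a i → x :* i :+ a :* (x :* i) := x :* ((:1 :+ a) :* i)) ≈-refl x A _ ⟩
      x * ((1# + A) * (1# + A) ⁻¹)               ≈⟨ *-congˡ (⁻¹-inverse 0<A+1) ⟩
      x * 1#                                     ≈⟨ *-identityʳ x ⟩
      x                                          ∎
    y≤x = ≤-respʳ-≈ x≈ (≤-by (A * y) (*-nonneg 0≤A (<⇒≤ 0<y)) (solve 2 (λ y z → y :+ z :- y := z) ≈-refl y (A * y)))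
    Ay≤x = ≤-respʳ-≈ x≈ (≤-by y (<⇒≤ 0<y) (solve 2 (λ y z → y :+ z :- z := y) ≈-refl y (A * y)))

  LocallyDense-mono : ∀ {p p′ δ δ′} G → p′ ≤ p → δ ≤ δ′ → LocallyDense K p δ G → LocallyDense K p′ δ′ G
  LocallyDense-mono G p′≤p δ≤δ′ ld = ⇒LocallyDense G λ S large →
    let s = fromℕ (Graph.∣_∣ G S)
        0≤s = fromℕ-nonneg (Graph.∣_∣ G S)
    in ≤-trans
      (≤-respˡ-≈ (*-comm (s * s) _) (≤-respʳ-≈ (*-comm (s * s) _) (*-monoˡ-≤ (*-nonneg 0≤s 0≤s) p′≤p)))
      (LocallyDense⇒ G ld S (≤-trans (≤-respˡ-≈ (*-comm _ _) (≤-respʳ-≈ (*-comm _ _)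
        (*-monoˡ-≤ (fromℕ-nonneg (Graph.v G)) δ≤δ′))) large))

  -- A power lies above its tangent at `x`. Multiplying the bound for `m` by `y` gives the next one
  -- with a surplus of (m + 1)xᵐ(y - x)².
  bernoulli : ∀ {x y} m → 0# ≤ x → 0# ≤ y →
    x ^ suc m + fromℕ (suc m) * x ^ m * (y - x) ≤ y ^ suc m
  bernoulli {x} {y} zero    0≤x 0≤y = ≤-reflexive
    (solve 2 (λ x y → x :* :1 :+ (:1 :+ :0) :* :1 :* (y :- x) := y :* :1) ≈-refl x y)
  bernoulli {x} {y} (suc m) 0≤x 0≤y = ≤-trans
    (≤-by (fromℕ (suc m) * x ^ m * ((y - x) * (y - x)))
      (*-nonneg (*-nonneg (fromℕ-nonneg (suc m)) (^-nonneg 0≤x m)) (square-nonneg (y - x)))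
      (solve 4 (λ x y z n → y :* (x :* z :+ n :* z :* (y :- x)) :- (x :* (x :* z) :+ (:1 :+ n) :* (x :* z) :* (y :- x)) :=
        n :* z :* ((y :- x) :* (y :- x))) ≈-refl x y (x ^ m) (fromℕ (suc m))))
    (*-monoˡ-≤ 0≤y (bernoulli m 0≤x 0≤y))

  -- Tangent to y ↦ yᵐ⁺² at x, with the convexity kept as the term xᵐ(y² − x²).
  bernoulli² : ∀ {x y} m → 0# ≤ x → 0# ≤ y →
    x ^ (2 ℕ.+ m) + x ^ m * (y * y - x * x) + fromℕ m * (x * x ^ m) * (y - x) ≤ y ^ (2 ℕ.+ m)
  bernoulli² {x} {y} zero    0≤x 0≤y = ≤-reflexive
    (solve 2 (λ x y → x :* (x :* :1) :+ :1 :* (y :* y :- x :* x) :+ :0 :* (x :* :1) :* (y :- x) := y :* (y :* :1)) ≈-refl x y)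
  bernoulli² {x} {y} (suc m) 0≤x 0≤y = ≤-trans
    (≤-by (x ^ m * (y + x) * ((y - x) * (y - x)) + fromℕ m * (x * x ^ m) * ((y - x) * (y - x)))
      (+-nonneg (*-nonneg (*-nonneg (^-nonneg 0≤x m) (+-nonneg 0≤y 0≤x)) (square-nonneg (y - x)))
        (*-nonneg (*-nonneg (fromℕ-nonneg m) (*-nonneg 0≤x (^-nonneg 0≤x m))) (square-nonneg (y - x))))
      (solve 4 (λ x y z n →
        y :* (x :* (x :* z) :+ z :* (y :* y :- x :* x) :+ n :* (x :* z) :* (y :- x)) :-
        (x :* (x :* (x :* z)) :+ x :* z :* (y :* y :- x :* x) :+ (:1 :+ n) :* (x :* (x :* z)) :* (y :- x)) :=
        z :* (y :+ x) :* ((y :- x) :* (y :- x)) :+ n :* (x :* z) :* ((y :- x) :* (y :- x))) ≈-refl x y (x ^ m) (fromℕ m)))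
    (*-monoˡ-≤ 0≤y (bernoulli² m 0≤x 0≤y))

  -- P wⁿ + c (T − r w²) − (c η + ε₁) is a lower bound for F in all cases; it is then linearised at w = μ.
  gain : ∀ {P μ r η c ε₁ ε′ w T F} m → 0# ≤ P → 0# ≤ μ → 0# ≤ r → 0# ≤ η → 0# ≤ c → 0# ≤ ε₁ → 0# ≤ ε′ →
    c ≤ ε′ * η ^ m → c * r ≤ P * μ ^ m → 0# ≤ w → w ≤ 1# → T ≤ w * w →
    P * w ^ (2 ℕ.+ m) - ε₁ ≤ F → (r * (w * w) ≤ T → η ≤ w → (P + ε′) * w ^ (2 ℕ.+ m) ≤ F) →
    let A = P * (fromℕ m * (μ * μ ^ m)) + ((P * μ ^ m - c * r) * μ + (P * μ ^ m - c * r) * μ) in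
    P * μ ^ (2 ℕ.+ m) - c * r * (μ * μ) - A * μ - (c * η + ε₁) + A * w + c * T ≤ F
  gain {P} {μ} {r} {η} {c} {ε₁} {ε′} {w} {T} {F} m 0≤P 0≤μ 0≤r 0≤η 0≤c 0≤ε₁ 0≤ε′ c≤ cr≤ 0≤w w≤1 T≤w² always often =
    ≤-trans linearise lower
    where
    x = μ ^ (2 ℕ.+ m)
    y = w ^ (2 ℕ.+ m)
    C = P * μ ^ m
    B = P * (fromℕ m * (μ * μ ^ m))
    D = C - c * r
    A = B + (D * μ + D * μ)

    tangent : P * x + C * (w * w - μ * μ) + B * (w - μ) ≤ P * y
    tangent = ≤-respˡ-≈ (solve 6 (λ P x z s b t → P :* (x :+ z :* s :+ b :* t) := P :* x :+ P :* z :* s :+ P :* b :* t)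
      ≈-refl P x (μ ^ m) (w * w - μ * μ) (fromℕ m * (μ * μ ^ m)) (w - μ)) (*-monoˡ-≤ 0≤P (bernoulli² m 0≤μ 0≤w))

    -- The tangent bound keeps C(w² - μ²), which absorbs the concave -crw². What remains is D(w² -
    -- μ²) with D = C - cr ≥ 0, and this lies above its own tangent by D(w - μ)².
    linearise : P * x - c * r * (μ * μ) - A * μ - (c * η + ε₁) + A * w + c * T ≤
      P * y + c * (T - r * (w * w)) - (c * η + ε₁)
    linearise = ≤-by (P * y - (P * x + C * (w * w - μ * μ) + B * (w - μ)) + D * ((w - μ) * (w - μ)))
      (+-nonneg (≤⇒0≤- tangent) (*-nonneg (≤⇒0≤- cr≤) (square-nonneg (w - μ))))
      (≈-trans (+-congʳ (+-congʳ (+-congˡ (solve 4 (λ c t r w → c :* (t :- r :* w) := c :* t :- c :* r :* w) ≈-refl c T r (w * w)))))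
        (solve 9 (λ X Y C B cr cT E μ w →
          Y :+ (cT :- cr :* (w :* w)) :- E :-
            (X :- cr :* (μ :* μ) :- (B :+ ((C :- cr) :* μ :+ (C :- cr) :* μ)) :* μ :- E :+ (B :+ ((C :- cr) :* μ :+ (C :- cr) :* μ)) :* w :+ cT) :=
          Y :- (X :+ C :* (w :* w :- μ :* μ) :+ B :* (w :- μ)) :+ (C :- cr) :* ((w :- μ) :* (w :- μ)))
          ≈-refl (P * x) (P * y) C B (c * r) (c * T) (c * η + ε₁) μ w))

    0≤w² = *-nonneg 0≤w 0≤w
    0≤cη = *-nonneg 0≤c 0≤η
    w²≤w : w * w ≤ w
    w²≤w = ≤-respʳ-≈ (*-identityʳ w) (*-monoˡ-≤ 0≤w w≤1)

    lower : P * y + c * (T - r * (w * w)) - (c * η + ε₁) ≤ F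
    lower with total T (r * (w * w)) | total w η
    -- A sparse fibre: the added term is nonpositive, so the general bound suffices.
    ... | inj₁ few | _ = ≤-trans (≤-by (c * (r * (w * w) - T) + c * η)
        (+-nonneg (*-nonneg 0≤c (≤⇒0≤- few)) 0≤cη)
        (solve 6 (λ a c T s e n → a :- e :- (a :+ c :* (T :- s) :- (c :* n :+ e)) := c :* (s :- T) :+ c :* n) ≈-refl (P * y) c T (r * (w * w)) ε₁ η)) always
    -- A small fibre: T ≤ w² ≤ w ≤ η, so the added term is at most the subtracted cη.
    ... | inj₂ _ | inj₁ w≤η = ≤-trans (≤-by (c * (η - T) + c * (r * (w * w)))
        (+-nonneg (*-nonneg 0≤c (≤⇒0≤- (≤-trans T≤w² (≤-trans w²≤w w≤η)))) (*-nonneg 0≤c (*-nonneg 0≤r 0≤w²)))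
        (solve 6 (λ a c T s e n → a :- e :- (a :+ c :* (T :- s) :- (c :* n :+ e)) := c :* (n :- T) :+ c :* s) ≈-refl (P * y) c T (r * (w * w)) ε₁ η)) always
    -- A large dense fibre: cT ≤ ε′ηᵐw² ≤ ε′wᵐ⁺², so the surplus `ε′` pays for the added term.
    ... | inj₂ many | inj₂ η≤w = ≤-trans (≤-by (ε′ * y - c * T + c * (r * (w * w)) + (c * η + ε₁))
        (+-nonneg (+-nonneg (≤⇒0≤- cT≤) (*-nonneg 0≤c (*-nonneg 0≤r 0≤w²))) (+-nonneg 0≤cη 0≤ε₁))
        (solve 7 (λ P ε′ y c T s E → (P :+ ε′) :* y :- (P :* y :+ c :* (T :- s) :- E) := ε′ :* y :- c :* T :+ c :* s :+ E) ≈-refl P ε′ y c T (r * (w * w)) (c * η + ε₁)))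
        (often many η≤w)
      where
      cT≤ : c * T ≤ ε′ * y
      cT≤ = ≤-respʳ-≈ (solve 3 (λ e w z → e :* z :* (w :* w) := e :* (w :* (w :* z))) ≈-refl ε′ w (w ^ m))
        (*-mono-≤ 0≤c 0≤w² (≤-trans c≤ (*-monoˡ-≤ 0≤ε′ (^-mono 0≤η η≤w m))) T≤w²)

  -- As μ² ≤ 1, the term c(T₂ - (p+q)μ²) exceeds c(4q - q). Paying cq, `ε₁` ≤ h and `A * ε₂` ≤ h
  -- leaves more than 2cq - 2h ≥ 2h.
  averaging-margin : ∀ {X A T₁ μ ε₂ c p q ε₀ ε₁ h T₂} → 0# ≤ A → 0# < c → 0# ≤ q → 0# ≤ h → μ * μ ≤ 1# →
    μ - ε₂ ≤ T₁ → A * ε₂ ≤ h → ε₁ ≤ h → h + h ≤ c * q → (q + q) + (q + q) ≤ ε₀ → p * (μ * μ) + ε₀ < T₂ →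
    X + h < X - c * (p + q) * (μ * μ) - A * μ - (c * q + ε₁) + A * T₁ + c * T₂
  averaging-margin {X} {A} {T₁} {μ} {ε₂} {c} {p} {q} {ε₀} {ε₁} {h} {T₂} 0≤A 0<c 0≤q 0≤h μ²≤1 T₁≥ Aε₂≤h ε₁≤h 2h≤cq 4q≤ε₀ T₂> =
    <-by (c * (T₂ - (p * (μ * μ) + ε₀)) + rest)
      (+-pos (*-pos 0<c (0<- T₂>))
        (+-nonneg (+-nonneg (*-nonneg 0≤A (≤⇒0≤- T₁≥)) (*-nonneg 0≤c (≤⇒0≤- 4q≤ε₀)))
          (+-nonneg (*-nonneg (*-nonneg 0≤c 0≤q) (≤⇒0≤- μ²≤1))
            (+-nonneg (+-nonneg (≤⇒0≤- 2h≤cq) (≤⇒0≤- 2h≤cq)) (+-nonneg (+-nonneg (≤⇒0≤- Aε₂≤h) (≤⇒0≤- ε₁≤h)) 0≤h)))))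
      (solve 13 (λ X A T μ M ε₂ c p q ε₀ ε₁ h U →
        X :- c :* (p :+ q) :* M :- A :* μ :- (c :* q :+ ε₁) :+ A :* T :+ c :* U :- (X :+ h) :=
        c :* (U :- (p :* M :+ ε₀)) :+ (A :* (T :- (μ :- ε₂)) :+ c :* (ε₀ :- ((q :+ q) :+ (q :+ q))) :+
          (c :* q :* (:1 :- M) :+ ((c :* q :- (h :+ h) :+ (c :* q :- (h :+ h))) :+ ((h :- A :* ε₂) :+ (h :- ε₁) :+ h)))))
        ≈-refl X A T₁ μ (μ * μ) ε₂ c p q ε₀ ε₁ h T₂)
    where
    0≤c = <⇒≤ 0<c
    rest = A * (T₁ - (μ - ε₂)) + c * (ε₀ - ((q + q) + (q + q))) +
      (c * q * (1# - μ * μ) + ((c * q - (h + h) + (c * q - (h + h))) + ((h - A * ε₂) + (h - ε₁) + h)))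

  -- The three statements about the product

  module _ (H₁ H₂ : Graph) (I : Subset (Graph.V H₁)) (a : Graph.V H₁)
           (independent : Graph.Independent H₁ I) (a∉I : a ∉ I) where
    private
      module H₁ = Graph H₁
      module H₂ = Graph H₂
      n = H₂.v
      H = H₁ ⋉[ I , a ] H₂

    open module TransferTo (G : Graph) = Transfer H₁ I a a∉I G using (W; F; 0≤W; W≤1; 0≤F; F≤W^)

    power-e : ∀ H₂ p → p ^ Graph.e (H₁ ⋉[ I , a ] H₂) ≈ p ^ Graph.e H₂ * (p ^ Graph.e H₁) ^ Graph.v H₂
    power-e H₂ p = begin
      p ^ Graph.e (H₁ ⋉[ I , a ] H₂)                     ≡⟨ cong (p ^_) (EdgeCounting.e-⋉ H₁ I a H₂ independent a∉I) ⟩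
      p ^ (Graph.v H₂ ℕ.* Graph.e H₁ ℕ.+ Graph.e H₂)     ≈⟨ ^-+ p (Graph.v H₂ ℕ.* Graph.e H₁) (Graph.e H₂) ⟩
      p ^ (Graph.v H₂ ℕ.* Graph.e H₁) * p ^ Graph.e H₂   ≈⟨ *-congʳ (^-*ℕ p (Graph.v H₂) (Graph.e H₁)) ⟩
      (p ^ Graph.e H₁) ^ Graph.v H₂ * p ^ Graph.e H₂     ≈⟨ *-comm _ _ ⟩
      p ^ Graph.e H₂ * (p ^ Graph.e H₁) ^ Graph.v H₂     ∎

    fibre-bound : ∀ {η x} G g → 0# < η → η ≤ W G g →
      (∀ nz → x ≤ t K H₂ (Transfer.fibreGraph H₁ I a a∉I G g nz)) → x * W G g ^ n ≤ F G H₂ g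
    fibre-bound G g 0<η η≤W x≤t = ≤-respʳ-≈ (≈-sym (Transfer.F≈ H₁ I a a∉I G H₂ g nz))
      (≤-respˡ-≈ (*-comm _ _) (≤-respʳ-≈ (*-comm _ _) (*-monoˡ-≤ (^-nonneg (0≤W G g) n) (x≤t nz))))
      where nz = Transfer.fibre-nonempty H₁ I a a∉I G 0<η g η≤W

    -- The same `ε` is the error in the fibre graph and the cut-off for its size: below the cut-off,
    -- P · Wⁿ ≤ W ≤ ε and the left side is nonpositive. Halving δ′ε meets the condition of
    -- `fibre-dense`.
    fibre-KNRS : KNRS K H₂ → ∀ p ε → Unit p → Unit ε → ∃[ δ ] 0# < δ ×
      (∀ G → LocallyDense K p δ G → ∀ g → p ^ H₂.e * W G g ^ n - ε ≤ F G H₂ g)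
    fibre-KNRS knrs p ε (0<p , p<1) (0<ε , ε<1) = half (δ′ * ε) , half-pos (*-pos 0<δ′ 0<ε) ,
      λ G ld g → [ light G g , heavy G ld g ]′ (total (W G g) ε)
      where
      P = p ^ H₂.e
      0≤P = ^-nonneg (<⇒≤ 0<p) H₂.e
      at-ε = knrs p ε (0<p , p<1) (0<ε , ε<1)
      δ′ = proj₁ at-ε
      0<δ′ = proj₁ (proj₂ at-ε)

      light : ∀ G g → W G g ≤ ε → P * W G g ^ n - ε ≤ F G H₂ g
      light G g W≤ε = ≤-trans
        (≤-by (ε - P * w ^ n) (≤⇒0≤- (≤-trans (PW^n≤W n {{H₂.nonempty}}) W≤ε))
          (solve 2 (λ x e → :0 :- (x :- e) := e :- x) ≈-refl (P * w ^ n) ε))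
        (0≤F G H₂ g)
        where
        w = W G g
        PW^n≤W : ∀ n → .{{NonZero n}} → P * w ^ n ≤ w
        PW^n≤W (suc m) = ≤-respʳ-≈ (*-identityˡ w) (*-mono-≤ 0≤P (0≤W G g) (^-≤1 (<⇒≤ 0<p) (<⇒≤ p<1) H₂.e)
          (≤-respʳ-≈ (*-identityʳ w) (*-monoˡ-≤ (0≤W G g) (^-≤1 (0≤W G g) (W≤1 G g) m))))

      heavy : ∀ G → LocallyDense K p (half (δ′ * ε)) G → ∀ g → ε ≤ W G g → P * W G g ^ n - ε ≤ F G H₂ g
      heavy G ld g ε≤W = ≤-trans
        (≤-by (ε * (1# - w ^ n)) (*-nonneg (<⇒≤ 0<ε) (≤⇒0≤- (^-≤1 (0≤W G g) (W≤1 G g) n)))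
          (solve 3 (λ p e w → (p :- e) :* w :- (p :* w :- e) := e :* (:1 :- w)) ≈-refl P ε (w ^ n)))
        (fibre-bound {ε} {P - ε} G g 0<ε ε≤W λ nz →
          proj₂ (proj₂ at-ε) (Transfer.fibreGraph H₁ I a a∉I G g nz) (Transfer.fibre-dense H₁ I a a∉I G
            {p} {half (δ′ * ε)} {δ′} {ε} (<⇒≤ 0<p) (<⇒≤ 0<δ′) (≤-reflexive (half+half (δ′ * ε))) ld g ε≤W nz))
        where w = W G g

    -- The derivative of P · wᵐ⁺¹ at w = μ, where P = p^e(H₂) and μ = p^e(H₁).
    slope : Carrier → ℕ → Carrier
    slope p m = p ^ H₂.e * (fromℕ (suc m) * (p ^ H₁.e) ^ m)

    slope-pos : ∀ {p} → 0# < p → ∀ m → 0# < slope p m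
    slope-pos 0<p m = *-pos (^-pos 0<p H₂.e) (*-pos (fromℕ-pos (suc m)) (^-pos (^-pos 0<p H₁.e) m))

    -- The tangent at μ is taken in each fibre; as `W` averages to the density of `H₁`, only the
    -- deviation of that density from μ survives.
    linear-bound : ∀ {p ε} m → n ≡ suc m → 0# < p → ∀ G →
      (∀ g → p ^ H₂.e * W G g ^ n - ε ≤ F G H₂ g) →
      p ^ Graph.e H + slope p m * (t K H₁ G - p ^ H₁.e) - ε ≤ t K H G
    linear-bound {p} {ε} m n≡ 0<p G fibres = ≤-respʳ-≈ (≈-sym (t-⋉ H₂)) (≤-respˡ-≈
      (≈-trans (solve 5 (λ x s μ ε w → x :- s :* μ :- ε :+ s :* w :+ :0 :* w := x :+ s :* (w :- μ) :- ε) ≈-refl (P * μ ^ n) s μ ε _)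
        (+-congʳ (+-cong (≈-sym (power-e H₂ p)) (*-congˡ (+-congʳ (≈-sym t-H₁))))))
      (average-linear (P * μ ^ n - s * μ - ε) s 0# (W G) (W G) pointwise))
      where
      open Transfer H₁ I a a∉I G using (t-⋉; t-H₁; average-linear)
      P = p ^ H₂.e
      μ = p ^ H₁.e
      s = slope p m
      0≤μ = ^-nonneg (<⇒≤ 0<p) H₁.e
      tangent : ∀ w → 0# ≤ w → μ ^ n + fromℕ (suc m) * μ ^ m * (w - μ) ≤ w ^ n
      tangent w 0≤w = subst (λ k → μ ^ k + fromℕ (suc m) * μ ^ m * (w - μ) ≤ w ^ k) (sym n≡) (bernoulli m 0≤μ 0≤w)
      pointwise : ∀ g → P * μ ^ n - s * μ - ε + s * W G g + 0# * W G g ≤ F G H₂ g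
      pointwise g = ≤-trans
        (≤-by (P * (W G g ^ n - (μ ^ n + fromℕ (suc m) * μ ^ m * (W G g - μ))))
          (*-nonneg (^-nonneg (<⇒≤ 0<p) H₂.e) (≤⇒0≤- (tangent (W G g) (0≤W G g))))
          (solve 7 (λ P x y k μ ε w → P :* y :- ε :- (P :* x :- P :* k :* μ :- ε :+ P :* k :* w :+ :0 :* w) := P :* (y :- (x :+ k :* (w :- μ))))
            ≈-refl P (μ ^ n) (W G g ^ n) (fromℕ (suc m) * μ ^ m) μ ε (W G g)))
        (fibres g)

    -- The slope is positive, so a lower bound for the density of `H₁` is enough. Half of `ε` goes
    -- to the fibres, half to the deficit `ε₂` magnified by the slope.
    ⋉-KNRS : KNRS K H₁ → KNRS K H₂ → ∀ m → n ≡ suc m → KNRS K H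
    ⋉-KNRS knrs₁ knrs₂ m n≡ p ε (0<p , p<1) (0<ε , ε<1) = choose-ε₂ (small (<⇒≤ 0<s) 0<h)
      where
      h = half ε
      0<h = half-pos 0<ε
      h≤ε = half≤ (<⇒≤ 0<ε)
      s = slope p m
      0<s = slope-pos 0<p m
      μ = p ^ H₁.e
      x = p ^ Graph.e H

      Goal : Set _
      Goal = ∃[ δ ] 0# < δ × (∀ G → LocallyDense K p δ G → x - ε ≤ t K H G)

      bound : ∀ {ε₂} → s * ε₂ ≤ h → ∀ G → μ - ε₂ ≤ t K H₁ G →
        (∀ g → p ^ H₂.e * W G g ^ n - h ≤ F G H₂ g) → x - ε ≤ t K H G
      bound {ε₂} sε₂≤h G T₁≥ fibres = ≤-trans
        (≤-by (s * (T₁ - (μ - ε₂)) + (h - s * ε₂))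
          (+-nonneg (*-nonneg (<⇒≤ 0<s) (≤⇒0≤- T₁≥)) (≤⇒0≤- sε₂≤h))
          (≈-trans (+-congˡ (-‿cong (+-congˡ (-‿cong (≈-sym (half+half ε))))))
            (solve 6 (λ x s T μ h e → x :+ s :* (T :- μ) :- h :- (x :- (h :+ h)) := s :* (T :- (μ :- e)) :+ (h :- s :* e)) ≈-refl x s T₁ μ h ε₂)))
        (linear-bound m n≡ 0<p G fibres)
        where T₁ = t K H₁ G

      choose-ε₂ : (∃[ ε₂ ] 0# < ε₂ × ε₂ ≤ h × s * ε₂ ≤ h) → Goal
      choose-ε₂ (ε₂ , 0<ε₂ , ε₂≤h , sε₂≤h) = choose-δ
        (knrs₁ p ε₂ (0<p , p<1) (0<ε₂ , ≤-<-trans (≤-trans ε₂≤h h≤ε) ε<1))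
        (fibre-KNRS knrs₂ p h (0<p , p<1) (0<h , ≤-<-trans h≤ε ε<1))
        where
        choose-δ : _ → _ → Goal
        choose-δ (δ₁ , 0<δ₁ , bound₁) (δ₂ , 0<δ₂ , bound₂) = δ , proj₁ (proj₂ least) , λ G ld →
          bound sε₂≤h G (bound₁ G (LocallyDense-mono G ≤-refl (proj₁ (proj₂ (proj₂ least))) ld))
            (bound₂ G (LocallyDense-mono G ≤-refl (proj₂ (proj₂ (proj₂ least))) ld))
          where
          least = lowerBound 0<δ₁ 0<δ₂
          δ = proj₁ least

    -- The excess `ε₀` in the density of `H₁` is magnified by the positive slope `s`; half of
    -- `s * ε₀` covers the error in the fibres and the other half is the final excess.
    ⋉-forcing₁ : KNRSForcing K H₁ → KNRS K H₂ → ∀ m → n ≡ suc m → KNRSForcing K H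
    ⋉-forcing₁ forcing knrs₂ m n≡ p α (0<p , p<1) unit-α = choose-ε₁ (forcing p α (0<p , p<1) unit-α)
      where
      s = slope p m
      0<s = slope-pos 0<p m
      μ = p ^ H₁.e
      x = p ^ Graph.e H

      Goal : Set _
      Goal = ∃[ δ ] ∃[ ε ] 0# < δ × 0# < ε × (∀ G → LocallyDense K p δ G → ¬ Quasirandom K p α G → x + ε < t K H G)

      bound : ∀ {ε₀ ε₁} → ε₁ ≤ half (s * ε₀) → ∀ G → μ + ε₀ < t K H₁ G →
        (∀ g → p ^ H₂.e * W G g ^ n - ε₁ ≤ F G H₂ g) → x + half (s * ε₀) < t K H G
      bound {ε₀} {ε₁} ε₁≤h G T₁> fibres = <-≤-trans
        (<-by (s * (T₁ - (μ + ε₀)) + (h - ε₁))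
          (+-pos (*-pos 0<s (0<- T₁>)) (≤⇒0≤- ε₁≤h))
          (begin
            x + s * (T₁ - μ) - ε₁ - (x + h)
              ≈⟨ solve 7 (λ x s T μ h e z → x :+ s :* (T :- μ) :- e :- (x :+ h) := s :* (T :- (μ :+ z)) :+ (s :* z :- h :- e)) ≈-refl x s T₁ μ h ε₁ ε₀ ⟩
            s * (T₁ - (μ + ε₀)) + (s * ε₀ - h - ε₁)
              ≈⟨ +-congˡ (+-congʳ (≈-trans (+-congʳ (≈-sym (half+half (s * ε₀)))) (solve 1 (λ h → h :+ h :- h := h) ≈-refl h))) ⟩
            s * (T₁ - (μ + ε₀)) + (h - ε₁) ∎))
        (linear-bound m n≡ 0<p G fibres)
        where
        T₁ = t K H₁ G
        h = half (s * ε₀)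

      choose-ε₁ : _ → Goal
      choose-ε₁ (δ₁ , ε₀ , 0<δ₁ , 0<ε₀ , bound₁) = choose-δ (lowerBound 0<h (half-pos 0<1))
        where
        h = half (s * ε₀)
        0<h = half-pos (*-pos 0<s 0<ε₀)
        choose-δ : (∃[ ε₁ ] 0# < ε₁ × ε₁ ≤ h × ε₁ ≤ half 1#) → Goal
        choose-δ (ε₁ , 0<ε₁ , ε₁≤h , ε₁≤½) = conclude (fibre-KNRS knrs₂ p ε₁ (0<p , p<1) (≤half⇒Unit 0<ε₁ ε₁≤½))
          where
          conclude : _ → Goal
          conclude (δ₂ , 0<δ₂ , bound₂) = proj₁ least , h , proj₁ (proj₂ least) , 0<h , λ G ld ¬qr →
            bound ε₁≤h G (bound₁ G (LocallyDense-mono G ≤-refl (proj₁ (proj₂ (proj₂ least))) ld) ¬qr)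
              (bound₂ G (LocallyDense-mono G ≤-refl (proj₂ (proj₂ (proj₂ least))) ld))
            where least = lowerBound 0<δ₁ 0<δ₂

    -- Both sides of the hypothesis carry `ℓ` squared: `F` at `K₂` is twice the number of edges
    -- times it. Cancelling it gives the edge condition of `DensityForcing`.
    fibre-edge-density : ∀ r G g nz → r * (W G g * W G g) ≤ F G K₂ g →
      let fibre = Transfer.fibreGraph H₁ I a a∉I G g nz in
      r * fromℕ (Graph.v fibre) ^ 2 / fromℕ 2 ≤ fromℕ (Graph.e fibre)
    fibre-edge-density r G g nz dense = *-cancelˡ-≤ 0<2 (*-cancelˡ-≤ (*-pos 0<ℓ 0<ℓ)
      (≤-respˡ-≈ (begin
        r * (V * ℓ * (V * ℓ))                ≈⟨ solve 3 (λ r v l → r :* (v :* l :* (v :* l)) := l :* l :* (r :* v :^ 2)) ≈-refl r V ℓ ⟩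
        ℓ * ℓ * (r * V ^ 2)                  ≈⟨ *-congˡ (2*half (r * V ^ 2)) ⟨
        ℓ * ℓ * (fromℕ 2 * half (r * V ^ 2)) ∎)
      (≤-respʳ-≈ (begin
        fromℕ (fibreHoms K₂ g) * ℓ ^ 2       ≡⟨ cong (λ z → fromℕ z * ℓ ^ 2) (trans (homsVia-pullback G (E-fibre g) (root ∘ proj₁) K₂ nz) (hom-K₂ fibre)) ⟩
        fromℕ (2 ℕ.* Graph.e fibre) * ℓ ^ 2  ≈⟨ *-congʳ (fromℕ-* 2 (Graph.e fibre)) ⟩
        fromℕ 2 * E * ℓ ^ 2                  ≈⟨ solve 3 (λ t e l → t :* e :* l :^ 2 := l :* l :* (t :* e)) ≈-refl (fromℕ 2) E ℓ ⟩
        ℓ * ℓ * (fromℕ 2 * E)                ∎) dense)))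
      where
      open Transfer H₁ I a a∉I G using (ℓ; 0<ℓ; fibreGraph)
      open Extensions H₁ I a a∉I G using (fibreHoms; E-fibre; root; fibreSize)
      fibre = fibreGraph g nz
      V = fromℕ (fibreSize g)
      E = fromℕ (Graph.e fibre)

    -- Forcing for the product with `K₂` gives an average excess of fibre edges; `gain` turns this
    -- into an excess of copies of `H₂`, since fibres of edge density at least p + q gain `ε′` by
    -- density-forcing. Here `q` is also the cut-off η for fibre sizes.
    ⋉-forcing₂ : KNRS K H₁ → KNRS K H₂ → DensityForcing K H₂ → KNRSForcing K (H₁ ⋉[ I , a ] K₂) →
      ∀ m → n ≡ 2 ℕ.+ m → KNRSForcing K H
    ⋉-forcing₂ knrs₁ knrs₂ density forcing m n≡ p α (0<p , p<1) unit-α =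
      choose-q (forcing p α (0<p , p<1) unit-α)
      where
      0≤p = <⇒≤ 0<p
      P = p ^ H₂.e
      μ = p ^ H₁.e
      0<P = ^-pos 0<p H₂.e
      0<μ = ^-pos 0<p H₁.e
      0≤P = <⇒≤ 0<P
      0≤μ = <⇒≤ 0<μ
      μ≤1 = ^-≤1 0≤p (<⇒≤ p<1) H₁.e
      μ²≤1 : μ * μ ≤ 1#
      μ²≤1 = ≤-respʳ-≈ (*-identityʳ 1#) (*-mono-≤ 0≤μ 0≤1 μ≤1 μ≤1)
      C = P * μ ^ m
      0<C = *-pos 0<P (^-pos 0<μ m)
      x = p ^ Graph.e H

      Goal : Set _
      Goal = ∃[ δ ] ∃[ ε ] 0# < δ × 0# < ε × (∀ G → LocallyDense K p δ G → ¬ Quasirandom K p α G → x + ε < t K H G)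

      -- The coefficient `A` of `gain` at r = p + q.
      slope₂ : Carrier → Carrier → Carrier
      slope₂ c q = P * (fromℕ m * (μ * μ ^ m)) + ((C - c * (p + q)) * μ + (C - c * (p + q)) * μ)

      slope₂-nonneg : ∀ {c q} → c * (p + q) ≤ C → 0# ≤ slope₂ c q
      slope₂-nonneg cr≤ = +-nonneg (*-nonneg 0≤P (*-nonneg (fromℕ-nonneg m) (*-nonneg 0≤μ (^-nonneg 0≤μ m))))
        (+-nonneg (*-nonneg (≤⇒0≤- cr≤) 0≤μ) (*-nonneg (≤⇒0≤- cr≤) 0≤μ))

      module _ {q c ε₀ ε₁ ε₂ ε′ h δ δB} (0<q : 0# < q) (0<c : 0# < c) (0≤h : 0# ≤ h) (0≤ε₁ : 0# ≤ ε₁) (0<ε′ : 0# < ε′) (0<δB : 0# < δB)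
               (c≤ : c ≤ ε′ * q ^ m) (cr≤ : c * (p + q) ≤ C)
               (Aε₂≤h : slope₂ c q * ε₂ ≤ h) (ε₁≤h : ε₁ ≤ h) (2h≤cq : h + h ≤ c * q) (4q≤ε₀ : (q + q) + (q + q) ≤ ε₀)
               (2δ≤ : δ + δ ≤ δB * q)
               (forces : ∀ G → LocallyDense K p δB G → (p + q) * fromℕ (Graph.v G) ^ 2 / fromℕ 2 ≤ fromℕ (Graph.e G) → P + ε′ < t K H₂ G)
               (G : Graph) (ld : LocallyDense K p δ G)
               (fibres : ∀ g → P * W G g ^ n - ε₁ ≤ F G H₂ g)
               (T₁≥ : μ - ε₂ ≤ t K H₁ G) (T₂> : p ^ Graph.e (H₁ ⋉[ I , a ] K₂) + ε₀ < t K (H₁ ⋉[ I , a ] K₂) G)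
               where

        open Transfer H₁ I a a∉I G using (t-⋉; t-H₁; average-linear; average; fibre-dense; fibreGraph)
        private
          A = slope₂ c q
          X = P * μ ^ (2 ℕ.+ m) - c * (p + q) * (μ * μ) - A * μ - (c * q + ε₁)

        dense-fibre : ∀ g → (p + q) * (W G g * W G g) ≤ F G K₂ g → q ≤ W G g → (P + ε′) * W G g ^ n ≤ F G H₂ g
        dense-fibre g many q≤W = fibre-bound {q} {P + ε′} G g 0<q q≤W λ nz →
          <⇒≤ (forces (fibreGraph g nz) (fibre-dense {p} {δ} {δB} {q} 0≤p (<⇒≤ 0<δB) 2δ≤ ld g q≤W nz)
            (fibre-edge-density (p + q) G g nz many))

        pointwise : ∀ g → X + A * W G g + c * F G K₂ g ≤ F G H₂ g
        pointwise g = gain m 0≤P 0≤μ (+-nonneg 0≤p (<⇒≤ 0<q)) (<⇒≤ 0<q) (<⇒≤ 0<c) 0≤ε₁ (<⇒≤ 0<ε′) c≤ cr≤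
          (0≤W G g) (W≤1 G g) (≤-respʳ-≈ (*-congˡ (*-identityʳ _)) (F≤W^ G K₂ g))
          (subst (λ k → P * W G g ^ k - ε₁ ≤ F G H₂ g) n≡ (fibres g))
          (λ many q≤W → subst (λ k → (P + ε′) * W G g ^ k ≤ F G H₂ g) n≡ (dense-fibre g many q≤W))

        gain-on-average : x + h < t K H G
        gain-on-average = <-≤-trans
          (≤-<-trans (≤-reflexive (+-congʳ (≈-trans (power-e H₂ p) (≈-reflexive (cong (λ k → P * μ ^ k) n≡)))))
            (averaging-margin (slope₂-nonneg cr≤) 0<c (<⇒≤ 0<q) 0≤h μ²≤1 T₁≥ Aε₂≤h ε₁≤h 2h≤cq 4q≤ε₀
              (<-resp (+-congʳ (≈-trans (power-e K₂ p) (solve 2 (λ p μ → p :* :1 :* (μ :* (μ :* :1)) := p :* (μ :* μ)) ≈-refl p μ))) ≈-refl T₂>)))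
          (≤-respʳ-≈ (≈-sym (t-⋉ H₂)) (≤-respˡ-≈ (+-cong (+-congˡ (*-congˡ (≈-sym t-H₁))) (*-congˡ (≈-sym (t-⋉ K₂))))
            (average-linear X A c (W G) (F G K₂) pointwise)))

      choose-q : _ → Goal
      choose-q (δA , ε₀ , 0<δA , 0<ε₀ , boundA) = with-x₀ (lowerBound 0<ε₀ 0<1)
        where
        with-x₀ : (∃[ x₀ ] 0# < x₀ × x₀ ≤ ε₀ × x₀ ≤ 1#) → Goal
        with-x₀ (x₀ , 0<x₀ , x₀≤ε₀ , x₀≤1) = with-density (density p q (0<p , p<1) (0<q , q<1))
          where
          -- A quarter of the available excess, as `averaging-margin` asks; capping `x₀` at 1 keeps
          -- `q` in the unit interval.
          q = half (half x₀)
          0<q = half-pos (half-pos 0<x₀)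
          4q≤ε₀ : (q + q) + (q + q) ≤ ε₀
          4q≤ε₀ = ≤-respˡ-≈ (≈-sym (≈-trans (+-cong (half+half _) (half+half _)) (half+half x₀))) x₀≤ε₀
          q<1 : q < 1#
          q<1 = ≤-<-trans (≤-trans (half≤ (<⇒≤ (half-pos 0<x₀))) (*-mono-≤ (<⇒≤ 0<x₀) (<⇒≤ (⁻¹-pos 0<2)) x₀≤1 ≤-refl)) half<1

          with-density : _ → Goal
          -- The first bound on `c` lets `ε′` pay in large dense fibres. The second, with p + q ≤ 2,
          -- gives `cr≤`, so that convexity absorbs the concave term.
          with-density (δB , ε′ , 0<δB , 0<ε′ , forces) = with-c (lowerBound (*-pos 0<ε′ (^-pos 0<q m)) (half-pos 0<C))
            where
            with-c : (∃[ c ] 0# < c × c ≤ ε′ * q ^ m × c ≤ half C) → Goal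
            with-c (c , 0<c , c≤ , c≤½C) = with-h (lowerBound (half-pos (*-pos 0<c 0<q)) (half-pos 0<1))
              where
              cr≤ : c * (p + q) ≤ C
              cr≤ = ≤-trans (*-monoˡ-≤ (<⇒≤ 0<c) (+-mono-≤ (<⇒≤ p<1) (<⇒≤ q<1)))
                (≤-respˡ-≈ (solve 1 (λ c → c :+ c := c :* (:1 :+ :1)) ≈-refl c)
                  (≤-respʳ-≈ (half+half C) (+-mono-≤ c≤½C c≤½C)))

              with-h : (∃[ h ] 0# < h × h ≤ half (c * q) × h ≤ half 1#) → Goal
              -- `ε₂` comes after `c` and `q` because the slope that magnifies it depends on them;
              -- `h` serves both as the error in the fibres and as the final excess.
              with-h (h , 0<h , h≤ , h≤½) = with-ε₂ (small (slope₂-nonneg cr≤) 0<h)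
                where
                2h≤cq : h + h ≤ c * q
                2h≤cq = ≤-respʳ-≈ (half+half (c * q)) (+-mono-≤ h≤ h≤)

                with-ε₂ : (∃[ ε₂ ] 0# < ε₂ × ε₂ ≤ h × slope₂ c q * ε₂ ≤ h) → Goal
                with-ε₂ (ε₂ , 0<ε₂ , ε₂≤h , Aε₂≤h) = with-δ
                  (knrs₁ p ε₂ (0<p , p<1) (≤half⇒Unit 0<ε₂ (≤-trans ε₂≤h h≤½)))
                  (fibre-KNRS knrs₂ p h (0<p , p<1) (≤half⇒Unit 0<h h≤½))
                  where
                  δC = half (δB * q)
                  with-δ : _ → _ → Goal
                  with-δ (δ₁ , 0<δ₁ , bound₁) (δ₂ , 0<δ₂ , bound₂) =
                    conclude (lowerBound 0<δ₁ 0<δ₂) (lowerBound 0<δA (half-pos (*-pos 0<δB 0<q)))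
                    where
                    conclude : (∃[ δ ] 0# < δ × δ ≤ δ₁ × δ ≤ δ₂) → (∃[ δ ] 0# < δ × δ ≤ δA × δ ≤ δC) → Goal
                    conclude (δ , 0<δ , δ≤δ₁ , δ≤δ₂) (δ′ , 0<δ′ , δ′≤δA , δ′≤δC) = combine′ (lowerBound 0<δ 0<δ′)
                      where
                      combine′ : (∃[ γ ] 0# < γ × γ ≤ δ × γ ≤ δ′) → Goal
                      combine′ (γ , 0<γ , γ≤δ , γ≤δ′) = γ , h , 0<γ , 0<h , λ G ld ¬qr →
                        let weaken = λ {δ} (γ≤δ : γ ≤ δ) → LocallyDense-mono {p} {p} {γ} {δ} G ≤-refl γ≤δ ld in
                        gain-on-average 0<q 0<c (<⇒≤ 0<h) (<⇒≤ 0<h) 0<ε′ 0<δB c≤ cr≤ Aε₂≤h ≤-refl 2h≤cq 4q≤ε₀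
                          (≤-reflexive (half+half (δB * q))) forces G (weaken (≤-trans γ≤δ′ δ′≤δC))
                          (bound₂ G (weaken (≤-trans γ≤δ δ≤δ₂))) (bound₁ G (weaken (≤-trans γ≤δ δ≤δ₁)))
                          (boundA G (weaken (≤-trans γ≤δ′ δ′≤δA)) ¬qr)

  -- A (p,δ)-locally dense graph has density at least p = p/2 + p/2, so forcing at (p/2, p/2) would give t > 1.
  one-vertex-not-density-forcing : ∀ H → Graph.v H ≡ 1 → DensityForcing K H →
    ∀ p → Unit p → ∃[ δ ] 0# < δ × (∀ G → ¬ LocallyDense K p δ G)
  one-vertex-not-density-forcing H v≡1 density p (0<p , p<1) =
    refute (density q q unit-q unit-q)
    where
    q = half p
    0<q = half-pos 0<p
    q≤p = half≤ (<⇒≤ 0<p)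
    unit-q : Unit q
    unit-q = 0<q , ≤-<-trans q≤p p<1

    no-edges : ∀ n → n ≡ 1 → Graph.V H ↔ Fin n → Graph.e H ≡ 0
    no-edges .1 refl E = ℕ.*-cancelˡ-≡ (Graph.e H) 0 2 (trans (e-double-total H)
      (∑-zero (Graph.V↔Fin H) (λ x → ∑-zero (Graph.V↔Fin H) (λ y → trans (cong (adj H x) (Injection.injective (↔⇒↣ E) (unique (to E y) (to E x)))) (adj-irrefl H x)))))
      where
      unique : ∀ (i j : Fin 1) → i ≡ j
      unique 0F 0F = refl

    t≤1 : ∀ G → t K H G ≤ 1#
    t≤1 G = ≤-respʳ-≈ (⁻¹-inverse 0<N^) (*-mono-≤ (fromℕ-nonneg (hom H G)) (<⇒≤ (⁻¹-pos 0<N^)) (fromℕ-mono (hom≤ H G)) ≤-refl)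
      where
      0<N^ : 0# < fromℕ (Graph.v G ℕ.^ Graph.v H)
      0<N^ = <-resp ≈-refl (≈-sym (fromℕ-^ (Graph.v G) (Graph.v H))) (^-pos (fromℕ-pos (Graph.v G) {{Graph.nonempty G}}) (Graph.v H))

    refute : _ → _
    refute (δ′ , ε , 0<δ′ , 0<ε , forces) = absurd (lowerBound 0<δ′ 0<1)
      where
      absurd : (∃[ δ ] 0# < δ × δ ≤ δ′ × δ ≤ 1#) → ∃[ δ ] 0# < δ × (∀ G → ¬ LocallyDense K p δ G)
      -- With δ ≤ 1 the whole vertex set is large enough for local density to apply to it, which
      -- yields the edge count that density-forcing asks for.
      absurd (δ , 0<δ , δ≤δ′ , δ≤1) = δ , 0<δ , λ G ld → <⇒≱ (forces G (LocallyDense-mono G q≤p δ≤δ′ ld) (dense G ld))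
        (≤-trans (t≤1 G) (≤-by ε (<⇒≤ 0<ε) (≈-trans (+-congʳ (+-congʳ (≈-reflexive (cong (q ^_) (no-edges _ v≡1 (Graph.V↔Fin H))))))
          (solve 1 (λ e → :1 :+ e :- :1 := e) ≈-refl ε))))
        where
        all : ∀ G → Subset (Graph.V G)
        all G _ = true
        ∣all∣ : ∀ G → Graph.∣_∣ G (all G) ≡ Graph.v G
        ∣all∣ G = trans (∣∣-∑ G (all G)) (trans (∑-const (Graph.V↔Fin G) 1) (ℕ.*-identityʳ _))
        dense : ∀ G → LocallyDense K p δ G → (q + q) * fromℕ (Graph.v G) ^ 2 / fromℕ 2 ≤ fromℕ (Graph.e G)
        dense G ld = subst (λ k → (q + q) * fromℕ k ^ 2 / fromℕ 2 ≤ fromℕ (Graph.e G)) (∣all∣ G)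
          (≤-respˡ-≈ (*-congʳ (*-congʳ (≈-sym (half+half p)))) (ld (all G)
            (subst (λ k → δ * fromℕ (Graph.v G) ≤ fromℕ k) (sym (∣all∣ G))
              (≤-respʳ-≈ (*-identityˡ _) (*-mono-≤ (<⇒≤ 0<δ) (fromℕ-nonneg (Graph.v G)) δ≤1 ≤-refl)))))

theorem3p2 : ∀ {c ℓ₁ ℓ₂} (K : ArchimedeanOrderedField c ℓ₁ ℓ₂)
    (H₁ H₂ : Graph) (I : Subset (Graph.V H₁)) (a : Graph.V H₁) →
    KNRS K H₁ → KNRS K H₂ → Graph.Independent H₁ I → a ∉ I →
    KNRS K (H₁ ⋉[ I , a ] H₂) ×
    ((KNRSForcing K H₁ ⊎ (DensityForcing K H₂ × KNRSForcing K (H₁ ⋉[ I , a ] K₂))) →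
    KNRSForcing K (H₁ ⋉[ I , a ] H₂))
theorem3p2 K H₁ H₂ I a knrs₁ knrs₂ independent a∉I =
  ⋉-KNRS K H₁ H₂ I a independent a∉I knrs₁ knrs₂ (ℕ.pred (Graph.v H₂)) v≡ ,
  [ (λ forcing → ⋉-forcing₁ K H₁ H₂ I a independent a∉I forcing knrs₂ (ℕ.pred (Graph.v H₂)) v≡)
  , forcing₂ (ℕ.pred (Graph.v H₂)) v≡ ]′
  where
  v≡ : Graph.v H₂ ≡ suc (ℕ.pred (Graph.v H₂))
  v≡ = sym (ℕ.suc-pred (Graph.v H₂) {{Graph.nonempty H₂}})

  forcing₂ : ∀ m → Graph.v H₂ ≡ suc m →
    DensityForcing K H₂ × KNRSForcing K (H₁ ⋉[ I , a ] K₂) → KNRSForcing K (H₁ ⋉[ I , a ] H₂)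
  forcing₂ (suc m) v≡ (density , forcing) =
    ⋉-forcing₂ K H₁ H₂ I a independent a∉I knrs₁ knrs₂ density forcing m v≡
  -- A one-vertex `H₂`: no graph is locally dense for this `δ`, so the claim is vacuous and any
  -- positive `ε` serves.
  forcing₂ zero    v≡ (density , _) p α unit-p _ =
    let (δ , 0<δ , none) = one-vertex-not-density-forcing K H₂ v≡ density p unit-p in
    δ , ArchimedeanOrderedField.1# K , 0<δ , OrderedField.0<1 K , λ G ld _ → contradiction ld (none G)
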